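{- Let $G$ be a cubic (i.e. $3$-regular) graph on $n$ vertices that is not isomorphic to $K_4$, $K_{3,3}$, or $3K_4$. Then $G$ contains a spanning subgraph $H$ such that for every integer $k$ with $0 \le k \le 3$, $$m(H,k) \in \left\{\left\lfloor\frac{n}{4}\right\rfloor, \left\lceil\frac{n}{4}\right\rceil\right\}.$$
   Context: All graphs are finite and simple (no loops, no parallel edges); they are not assumed to be connected. A spanning subgraph of $G$ is a subgraph with the same vertex set as $G$ (and an arbitrary subset of the edges of $G$). For a graph $H$ and a nonnegative integer $k$, $m(H,k)$ denotes the number of vertices of degree $k$ in $H$. $K_4$ is the complete graph on $4$ vertices, $K_{3,3}$ the complete bipartite graph with parts of size $3$ and $3$, and $3K_4$ the disjoint union of three copies of $K_4$. -}

module Defs where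

open import Level using (0ℓ)
open import Data.Nat using (ℕ; _+_; _/_; _≟_; pred; NonZero)
open import Data.Fin using (Fin)
import Data.Fin.Properties as Fin
open import Data.Vec using (allFin; count)
open import Data.Product using (_×_; _,_; Σ-syntax)
open import Data.Sum using (_⊎_; inj₁; inj₂)
open import Data.Unit using (⊤; tt)
open import Data.Empty using (⊥)
open import Function using (_↔_; _⇔_; Inverse)
open import Relation.Binary using (Rel; Decidable; Symmetric; Irreflexive)
open import Relation.Binary.PropositionalEquality using (_≡_; _≢_; ≢-sym; sym; refl)
open import Relation.Nullary using (yes; no)
open import Relation.Nullary.Decidable using (¬?; _×-dec_)

-- Decidability of adjacency is the constructive content of "finite graph":
-- on Fin n it makes degrees and vertex counts computable natural numbers.
record Graph (V : Set) : Set₁ where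
  field
    Adj    : Rel V 0ℓ
    adj?   : Decidable Adj
    symm   : Symmetric Adj
    irrefl : Irreflexive _≡_ Adj

open Graph public

degree : ∀ {n} → Graph (Fin n) → Fin n → ℕ
degree {n} G v = count (adj? G v) (allFin n)

Cubic : ∀ {n} → Graph (Fin n) → Set
Cubic G = ∀ v → degree G v ≡ 3

m : ∀ {n} → Graph (Fin n) → ℕ → ℕ
m {n} H k = count (λ v → degree H v ≟ k) (allFin n)

-- The vertex set is shared, so this is exactly inclusion of edge sets.
_IsSpanningSubgraphOf_ : ∀ {V} → Graph V → Graph V → Set
H IsSpanningSubgraphOf G = ∀ {u v} → Adj H u v → Adj G u v

_≅_ : ∀ {V W} → Graph V → Graph W → Set
_≅_ {V} {W} G H =
  Σ[ f ∈ V ↔ W ] (∀ u v → Adj G u v ⇔ Adj H (Inverse.to f u) (Inverse.to f v))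

K : ∀ n → Graph (Fin n)
K n = record
  { Adj    = _≢_
  ; adj?   = λ u v → ¬? (u Fin.≟ v)
  ; symm   = ≢-sym
  ; irrefl = λ u≡v u≢v → u≢v u≡v
  }

BipartiteAdj : ∀ {A B : Set} → Rel (A ⊎ B) 0ℓ
BipartiteAdj (inj₁ _) (inj₁ _) = ⊥
BipartiteAdj (inj₁ _) (inj₂ _) = ⊤
BipartiteAdj (inj₂ _) (inj₁ _) = ⊤
BipartiteAdj (inj₂ _) (inj₂ _) = ⊥

Kᵇ : ∀ a b → Graph (Fin a ⊎ Fin b)
Kᵇ a b = record { Adj = BipartiteAdj ; adj? = dec ; symm = λ {u} {v} → sy u v ; irrefl = irr }
  where
  dec : Decidable (BipartiteAdj {Fin a} {Fin b})
  dec (inj₁ _) (inj₁ _) = no λ ()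
  dec (inj₁ _) (inj₂ _) = yes tt
  dec (inj₂ _) (inj₁ _) = yes tt
  dec (inj₂ _) (inj₂ _) = no λ ()

  sy : ∀ u v → BipartiteAdj {Fin a} {Fin b} u v → BipartiteAdj v u
  sy (inj₁ _) (inj₂ _) _ = tt
  sy (inj₂ _) (inj₁ _) _ = tt

  irr : Irreflexive _≡_ (BipartiteAdj {Fin a} {Fin b})
  irr {inj₁ _} refl ()
  irr {inj₂ _} refl ()

-- The disjoint union of c copies of G; the vertex (i , v) is v in the i-th copy.
_copiesOf_ : ∀ {V} c → Graph V → Graph (Fin c × V)
c copiesOf G = record
  { Adj    = λ (i , u) (j , v) → i ≡ j × Adj G u v
  ; adj?   = λ (i , u) (j , v) → (i Fin.≟ j) ×-dec adj? G u v
  ; symm   = λ (i≡j , uv) → sym i≡j , symm G uv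
  ; irrefl = λ { refl (_ , uu) → irrefl G refl uu }
  }

⌊_/_⌋ : ∀ n d .{{_ : NonZero d}} → ℕ
⌊ n / d ⌋ = n / d

-- The ceiling of n / d equals the floor of (n + (d - 1)) / d.
⌈_/_⌉ : ∀ n d .{{_ : NonZero d}} → ℕ
⌈ n / d ⌉ = (n + pred d) / d

{-# OPTIONS --safe #-}

-- Colour the edges of G inside H red and the others blue, and let x_k be the number of vertices of red degree k.
-- Put α = (x₁ − x₃)/2, β = (x₀ − x₂)/2 and σ = ((x₁ + x₃) − (x₀ + x₂))/2.  H is as required iff α = β = 0 and
-- |σ| ≤ 1.  Recolouring an edge changes the parity of both ends, so it changes σ by 0 or ±2; starting from the
-- all-blue colouring, recolour edges between vertices of even red degree until |σ| ≤ 1.  From then on recolour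
-- a few edges at a time, keeping |σ| ≤ 1 and lowering a weighted sum of |α| and |β|.  An edge whose ends have red
-- degrees of different parity moves (α , β) by a unit vector; when no such edge moves it in a useful direction,
-- double counting of edges between the degree classes D₀, …, D₃ leaves enough structure to find a combination of
-- edges that does, or else exhibits G as K₄, K₃,₃ or 3K₄.  Exchanging the colours maps (α , β , σ) to
-- (−β , −α , −σ), which halves the number of cases.
module Submission where

open import Data.Nat
open import Data.Nat.Properties
open import Data.Nat.DivMod using (m*n/n≡m; +-distrib-/-∣ʳ)
open import Data.Nat.Divisibility using (divides-refl)
open import Data.Nat.Induction using (<-wellFounded)
open import Data.Nat.Solver using (module +-*-Solver)
open import Data.Integer as ℤ using (ℤ) renaming (+_ to pos; -[1+_] to neg)
import Data.Integer.Properties as ℤ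
open import Data.Integer.Solver renaming (module +-*-Solver to ℤ-Solver)
open import Data.Bool using (Bool; true; false; if_then_else_; not; T)
import Data.Bool.Properties as Bool
open import Data.Fin using (Fin; zero; suc; punchOut)
open import Data.Fin.Patterns
import Data.Fin.Properties as Fin
open import Data.List as List using (List; []; _∷_; length)
open import Data.List.Properties using (length-map)
open import Data.List.Membership.Propositional using (_∈_)
open import Data.List.Membership.Propositional.Properties using (∈-lookup)
open import Data.List.Relation.Unary.Any using (here; there)
open import Data.List.Relation.Unary.All as All using (All; []; _∷_)
import Data.List.Relation.Unary.All.Properties as All
open import Data.List.Relation.Unary.AllPairs as AllPairs using (AllPairs; []; _∷_)
import Data.List.Relation.Unary.AllPairs.Properties as AllPairs
open import Data.Vec using (Vec; []; _∷_; lookup; updateAt; count; tabulate; allFin)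
import Data.Vec.Properties as Vec
open import Data.Product using (_×_; _,_; proj₁; proj₂; ∃-syntax; Σ-syntax)
open import Data.Product.Properties using (≡-dec)
open import Data.Sum using (_⊎_; inj₁; inj₂)
open import Data.Unit using (⊤; tt)
open import Function using (_∘_; id; mk⇔; _↔_; mk↔ₛ′; Inverse)
open import Induction.WellFounded using (Acc; acc)
open import Relation.Binary using (DecidableEquality)
open import Relation.Binary.PropositionalEquality
open import Relation.Nullary using (Dec; yes; no; ¬_; does; contradiction)
open import Relation.Nullary.Decidable
  using (_×-dec_; _⊎-dec_; ¬?; dec-true; dec-false; does-⇔; map′; True; toWitness; from-yes)
open import Relation.Unary using (Decidable)
import Algebra.Properties.CommutativeMonoid.Sum +-0-commutativeMonoid as Sum
open import Defs

-- Effects on (α, β, σ), by the red degrees of the two ends. Joining a blue edge 0-0, 0-1, 0-2, 1-1,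
-- 1-2, 2-2 adds (1, -1, 2), (0, -1, 0), (0, 0, 2), (-1, -1, -2), (-1, 0, 0), (-1, 1, 2). Cutting a
-- red edge 1-1, 1-2, 1-3, 2-2, 2-3, 3-3 adds (-1, 1, -2), (0, 1, 0), (0, 0, -2), (1, 1, 2), (1, 0,
-- 0), (1, -1, -2). When a script meets a vertex again, the degree that counts is the current one;
-- hence a join and a cut at one vertex can leave that vertex in its class. The obstacle is the last
-- unit. Toggles paired so that σ is restored often move α or β by 2, which from distance one merely
-- changes the sign. The exceptional graphs are therefore met only next to the goal, up to exchange
-- of colours: 3K₄ at (α, β) = (-1, 0), and K₄ and K₃,₃ at (1, 0). There the scripts must be longer,
-- and the counts become so tight that the graph is determined whenever no script applies.

private variable
  n : ℕ

-- Sums and counts over `Fin n`.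

opaque
  -- Opaque, so that degrees and class sizes stay folded during conversion and unification; outside
  -- the block only the laws proved in it are available.
  sum : (Fin n → ℕ) → ℕ
  sum = Sum.sum

  sum-zero : ∀ n → sum {n} (λ _ → 0) ≡ 0
  sum-zero = Sum.sum-replicate-zero

  sum-suc : (f : Fin (suc n) → ℕ) → sum f ≡ f zero + sum (f ∘ suc)
  sum-suc f = refl

  sum-ones : ∀ n → sum {n} (λ _ → 1) ≡ n
  sum-ones zero    = refl
  sum-ones (suc n) = cong suc (sum-ones n)

  sum-cong : {f g : Fin n → ℕ} → (∀ v → f v ≡ g v) → sum f ≡ sum g
  sum-cong = Sum.sum-cong-≗

  sum-+ : (f g : Fin n → ℕ) → sum (λ v → f v + g v) ≡ sum f + sum g
  sum-+ = Sum.∑-distrib-+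

  sum-comm : ∀ {m} (f : Fin m → Fin n → ℕ) → sum (λ u → sum (f u)) ≡ sum (λ v → sum (λ u → f u v))
  sum-comm = Sum.∑-comm

  sum-mono : {f g : Fin n → ℕ} → (∀ v → f v ≤ g v) → sum f ≤ sum g
  sum-mono {zero}  f≤g = z≤n
  sum-mono {suc n} f≤g = +-mono-≤ (f≤g zero) (sum-mono (f≤g ∘ suc))

  -- A single strict inequality between terms would make the totals strict. This turns tight double
  -- counts into pointwise information.
  sum-squeeze : {f g : Fin n → ℕ} → (∀ v → f v ≤ g v) → sum g ≤ sum f → ∀ v → g v ≤ f v
  sum-squeeze {suc n} {f} {g} f≤g Σg≤Σf zero = +-cancelʳ-≤ (sum (g ∘ suc)) _ _
    (≤-trans Σg≤Σf (+-monoʳ-≤ (f zero) (sum-mono (f≤g ∘ suc))))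
  sum-squeeze {suc n} {f} {g} f≤g Σg≤Σf (suc v) = sum-squeeze (f≤g ∘ suc)
    (+-cancelˡ-≤ (g zero) _ _ (≤-trans Σg≤Σf (+-monoˡ-≤ _ (f≤g zero)))) v

  sum-*ˡ : ∀ c (f : Fin n → ℕ) → sum (λ v → c * f v) ≡ c * sum f
  sum-*ˡ {zero}  c f = sym (*-zeroʳ c)
  sum-*ˡ {suc n} c f = trans (cong (c * f zero +_) (sum-*ˡ c (f ∘ suc)))
    (sym (*-distribˡ-+ c (f zero) _))

  -- Both sides are `f x + g x` plus the common terms; the crosswise form avoids truncated
  -- subtraction.
  sum-update : (f g : Fin n → ℕ) (x : Fin n) → (∀ v → v ≢ x → f v ≡ g v) →
    g x + sum f ≡ f x + sum g
  sum-update {suc n} f g zero f≗g = trans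
    (cong (λ s → g zero + (f zero + s)) (sum-cong (λ v → f≗g (suc v) λ ())))
    (solve 3 (λ a b c → a :+ (b :+ c) := b :+ (a :+ c)) refl (g zero) (f zero) _)
    where
    open +-*-Solver
  sum-update {suc n} f g (suc x) f≗g = begin
    g (suc x) + (f zero + sum (f ∘ suc))
      ≡⟨ solve 3 (λ a b c → a :+ (b :+ c) := b :+ (a :+ c)) refl (g (suc x)) (f zero) _ ⟩
    f zero + (g (suc x) + sum (f ∘ suc))
      ≡⟨ cong₂ _+_ (f≗g zero λ ()) (sum-update (f ∘ suc) (g ∘ suc) x
           (λ v v≢x → f≗g (suc v) (v≢x ∘ Fin.suc-injective))) ⟩
    g zero + (f (suc x) + sum (g ∘ suc))
      ≡⟨ solve 3 (λ a b c → a :+ (b :+ c) := b :+ (a :+ c)) refl (g zero) (f (suc x)) _ ⟩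
    f (suc x) + (g zero + sum (g ∘ suc)) ∎
    where
    open ≡-Reasoning
    open +-*-Solver

  -- The entries off a zero diagonal of a symmetric matrix come in equal pairs.
  symmetric-sum-even : (M : Fin n → Fin n → ℕ) → (∀ u v → M u v ≡ M v u) → (∀ u → M u u ≡ 0) →
    ∃[ h ] sum (λ u → sum (M u)) ≡ h + h
  symmetric-sum-even {zero}  M M-sym M-diag = 0 , refl
  symmetric-sum-even {suc n} M M-sym M-diag =
    let h , even = symmetric-sum-even (λ u v → M (suc u) (suc v)) (λ u v → M-sym (suc u) (suc v)) (M-diag ∘ suc)
        r = sum (λ v → M zero (suc v))
    in r + h , (begin
      (M zero zero + r) + sum (λ u → M (suc u) zero + sum (λ v → M (suc u) (suc v)))
        ≡⟨ cong₂ _+_ (cong (_+ r) (M-diag zero)) (sum-+ (λ u → M (suc u) zero) _) ⟩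
      r + (sum (λ u → M (suc u) zero) + sum (λ u → sum (λ v → M (suc u) (suc v))))
        ≡⟨ cong (r +_) (cong₂ _+_ (sum-cong (λ u → M-sym (suc u) zero)) even) ⟩
      r + (r + (h + h))
        ≡⟨ solve 2 (λ r h → r :+ (r :+ (h :+ h)) := (r :+ h) :+ (r :+ h)) refl r h ⟩
      (r + h) + (r + h) ∎)
    where
    open ≡-Reasoning
    open +-*-Solver

𝟙 : {P : Set} → Dec P → ℕ
𝟙 P? = if does P? then 1 else 0

# : {P : Fin n → Set} → Decidable P → ℕ
# P? = sum (λ v → 𝟙 (P? v))

𝟙-yes : {P : Set} (P? : Dec P) → P → 𝟙 P? ≡ 1
𝟙-yes P? p = cong (if_then 1 else 0) (dec-true P? p)

𝟙-no : {P : Set} (P? : Dec P) → ¬ P → 𝟙 P? ≡ 0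
𝟙-no P? ¬p = cong (if_then 1 else 0) (dec-false P? ¬p)

𝟙-cong : {P Q : Set} (P? : Dec P) (Q? : Dec Q) → (P → Q) → (Q → P) → 𝟙 P? ≡ 𝟙 Q?
𝟙-cong (yes p) Q? f g = sym (𝟙-yes Q? (f p))
𝟙-cong (no ¬p) Q? f g = sym (𝟙-no Q? (¬p ∘ g))

sum-update₂ : (f g : Fin n → ℕ) {x y : Fin n} → x ≢ y →
  (∀ v → v ≢ x → v ≢ y → f v ≡ g v) → (g x + g y) + sum f ≡ (f x + f y) + sum g
sum-update₂ {n} f g {x} {y} x≢y f≗g = begin
  (g x + g y) + sum f ≡⟨ solve 3 (λ a b c → (a :+ b) :+ c := b :+ (a :+ c)) refl (g x) (g y) _ ⟩
  g y + (g x + sum f) ≡⟨ cong (λ z → g y + (z + sum f)) hx ⟨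
  g y + (h x + sum f) ≡⟨ cong (g y +_) (sum-update f h x f≗h) ⟩
  g y + (f x + sum h) ≡⟨ solve 3 (λ a b c → a :+ (b :+ c) := b :+ (a :+ c)) refl (g y) (f x) _ ⟩
  f x + (g y + sum h) ≡⟨ cong (f x +_) (sum-update h g y h≗g) ⟩
  f x + (h y + sum g) ≡⟨ cong (λ z → f x + (z + sum g)) (sym (f≗h y (x≢y ∘ sym))) ⟩
  f x + (f y + sum g) ≡⟨ +-assoc (f x) (f y) _ ⟨
  (f x + f y) + sum g ∎
  where
  open ≡-Reasoning
  open +-*-Solver
  -- The hybrid of `f` and `g` differs from each of them at one point only, so the single update
  -- applies twice.
  h : Fin n → ℕ
  h v = if does (v Fin.≟ x) then g v else f v
  hx : h x ≡ g x
  hx = cong (if_then g x else f x) (dec-true (x Fin.≟ x) refl)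
  f≗h : ∀ v → v ≢ x → f v ≡ h v
  f≗h v v≢x = sym (cong (if_then g v else f v) (dec-false (v Fin.≟ x) v≢x))
  h≗g : ∀ v → v ≢ y → h v ≡ g v
  h≗g v v≢y with v Fin.≟ x
  ... | yes refl = refl
  ... | no v≢x   = f≗g v v≢x v≢y

-- Its sum is the length of the list, so comparing it pointwise with an indicator bounds a count:
-- from above if the list covers the set, from below if the list is duplicate-free and inside the
-- set.
multiplicity : List (Fin n) → Fin n → ℕ
multiplicity []       v = 0
multiplicity (x ∷ xs) v = 𝟙 (v Fin.≟ x) + multiplicity xs v

sum-multiplicity : (xs : List (Fin n)) → sum (multiplicity xs) ≡ length xs
sum-multiplicity {n} []       = sum-zero n
sum-multiplicity {n} (x ∷ xs) = trans (sum-+ (λ v → 𝟙 (v Fin.≟ x)) (multiplicity xs))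
  (cong₂ _+_ single (sum-multiplicity xs))
  where
  single : sum (λ v → 𝟙 (v Fin.≟ x)) ≡ 1
  single = trans (sum-update _ (λ _ → 0) x (λ v v≢x → 𝟙-no (v Fin.≟ x) v≢x))
    (cong₂ _+_ (𝟙-yes (x Fin.≟ x) refl) (sum-zero n))

module _ {P : Fin n → Set} (P? : Decidable P) where

  #-cover : (xs : List (Fin n)) → (∀ v → P v → v ∈ xs) → # P? ≤ length xs
  #-cover xs P⊆xs = ≤-trans (sum-mono pointwise) (≤-reflexive (sum-multiplicity xs))
    where
    occurs : ∀ {v} ys → v ∈ ys → 1 ≤ multiplicity ys v
    occurs {v} (y ∷ ys) (here v≡y) = ≤-trans (≤-reflexive (sym (𝟙-yes (v Fin.≟ y) v≡y))) (m≤m+n _ _)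
    occurs (y ∷ ys) (there v∈ys)   = ≤-trans (occurs ys v∈ys) (m≤n+m _ _)
    pointwise : ∀ v → 𝟙 (P? v) ≤ multiplicity xs v
    pointwise v with P? v
    ... | yes p = occurs xs (P⊆xs v p)
    ... | no _  = z≤n

  #-pack : (xs : List (Fin n)) → AllPairs _≢_ xs → All P xs → length xs ≤ # P?
  #-pack xs xs! Pxs = ≤-trans (≤-reflexive (sym (sum-multiplicity xs))) (sum-mono pointwise)
    where
    absent : ∀ {v} ys → All (v ≢_) ys → multiplicity ys v ≡ 0
    absent []       []           = refl
    absent (y ∷ ys) (v≢y ∷ v≢ys) = cong₂ _+_ (𝟙-no (_ Fin.≟ y) v≢y) (absent ys v≢ys)
    simple : ∀ v ys → AllPairs _≢_ ys → All P ys → multiplicity ys v ≤ 𝟙 (P? v)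
    simple v []       _          _         = z≤n
    simple v (y ∷ ys) (y≢ ∷ ys!) (p ∷ ps) with v Fin.≟ y
    ... | yes refl = ≤-reflexive (trans (cong suc (absent ys y≢)) (sym (𝟙-yes (P? v) p)))
    ... | no _     = simple v ys ys! ps
    pointwise : ∀ v → multiplicity xs v ≤ 𝟙 (P? v)
    pointwise v = simple v xs xs! Pxs

  #-avoid : (xs : List (Fin n)) → length xs < # P? → ∃[ v ] P v × All (v ≢_) xs
  #-avoid xs short with Fin.any? (λ v → P? v ×-dec All.all? (λ x → ¬? (v Fin.≟ x)) xs)
  ... | yes found = found
  ... | no none   = contradiction (#-cover xs cover) (<⇒≱ short)
    where
    open import Data.List.Membership.DecPropositional Fin._≟_ using (_∈?_)
    cover : ∀ v → P v → v ∈ xs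
    cover v p with v ∈? xs
    ... | yes v∈xs = v∈xs
    ... | no v∉xs  = contradiction (v , p , All.¬Any⇒All¬ xs v∉xs) none

  #-mono : {Q : Fin n → Set} (Q? : Decidable Q) → (∀ v → P v → Q v) → # P? ≤ # Q?
  #-mono Q? P⇒Q = sum-mono pointwise
    where
    pointwise : ∀ v → 𝟙 (P? v) ≤ 𝟙 (Q? v)
    pointwise v with P? v
    ... | yes p = ≤-reflexive (sym (𝟙-yes (Q? v) (P⇒Q v p)))
    ... | no _  = z≤n

𝟙-mono : {P Q : Set} (P? : Dec P) (Q? : Dec Q) → (P → Q) → 𝟙 P? ≤ 𝟙 Q?
𝟙-mono (yes p) Q? f = ≤-reflexive (sym (𝟙-yes Q? (f p)))
𝟙-mono (no _)  Q? f = z≤n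

#-squeeze : {P Q : Fin n → Set} (P? : Decidable P) (Q? : Decidable Q) →
  (∀ v → P v → Q v) → # Q? ≤ # P? → ∀ v → Q v → P v
#-squeeze P? Q? P⇒Q #Q≤#P v q with P? v | sum-squeeze (λ v → 𝟙-mono (P? v) (Q? v) (P⇒Q v)) #Q≤#P v
... | yes p | _ = p
... | no ¬p | Q≤P with subst (_≤ 0) (𝟙-yes (Q? v) q) Q≤P
...   | ()

-- Colours, toggles and scripts.

data Colour : Set where
  none blue red : Colour

_≟ᶜ_ : DecidableEquality Colour
none ≟ᶜ none = yes refl
none ≟ᶜ blue = no λ ()
none ≟ᶜ red  = no λ ()
blue ≟ᶜ none = no λ ()
blue ≟ᶜ blue = yes refl
blue ≟ᶜ red  = no λ ()
red  ≟ᶜ none = no λ ()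
red  ≟ᶜ blue = no λ ()
red  ≟ᶜ red  = yes refl

swap : Colour → Colour
swap none = none
swap blue = red
swap red  = blue

paint : Bool → Bool → Colour
paint false _     = none
paint true  false = blue
paint true  true  = red

paint-not : ∀ a c → paint a (not c) ≡ swap (paint a c)
paint-not false c     = refl
paint-not true  false = refl
paint-not true  true  = refl

record CubicGraph (n : ℕ) : Set where
  field
    adj      : Fin n → Fin n → Bool
    adj-sym  : ∀ u v → adj u v ≡ adj v u
    adj-irr  : ∀ u → adj u u ≡ false
    adj-three : ∀ u → # (λ v → adj u v Bool.≟ true) ≡ 3

data Toggle (k : ℕ) : Set where
  cut join : Fin k → Fin k → Toggle k

ends : ∀ {k} → Toggle k → Fin k × Fin k
ends (cut i j)  = i , j
ends (join i j) = i , j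

before after : ∀ {k} → Toggle k → Colour
before (cut _ _)  = red
before (join _ _) = blue
after  (cut _ _)  = blue
after  (join _ _) = red

shift : ∀ {k} → Toggle k → ℕ → ℕ
shift (cut _ _)  = pred
shift (join _ _) = suc

SamePair : {A : Set} → A × A → A × A → Set
SamePair (x , y) (u , v) = (x ≡ u × y ≡ v) ⊎ (x ≡ v × y ≡ u)

samePair? : ∀ {k} (p q : Fin k × Fin k) → Dec (SamePair p q)
samePair? (x , y) (u , v) = ((x Fin.≟ u) ×-dec (y Fin.≟ v)) ⊎-dec ((x Fin.≟ v) ×-dec (y Fin.≟ u))

swapˡ : {A : Set} {x y : A} {p : A × A} → SamePair (x , y) p → SamePair (y , x) p
swapˡ (inj₁ (a , b)) = inj₂ (b , a)
swapˡ (inj₂ (a , b)) = inj₁ (b , a)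

-- A script toggles edges among k vertices of known red degrees; its effect is computed from these degrees alone.
relabel : ∀ {k} → Toggle k → Vec ℕ k → Vec ℕ k
relabel t ℓ = updateAt (updateAt ℓ (proj₂ (ends t)) (shift t)) (proj₁ (ends t)) (shift t)

tally : ∀ {k} → Toggle k → Vec ℕ k → ℕ → ℕ
tally t ℓ m = 𝟙 (lookup ℓ (proj₁ (ends t)) ≟ m) + 𝟙 (lookup ℓ (proj₂ (ends t)) ≟ m)

-- Departures from and arrivals in class `m` are kept apart, so that the update of class sizes is an
-- equation in ℕ. A vertex toggled twice also counts at its intermediate degree, which cancels in
-- `net`.
lost gained : ∀ {k} → Vec ℕ k → List (Toggle k) → ℕ → ℕ
lost ℓ []       m = 0
lost ℓ (t ∷ ts) m = tally t ℓ m + lost (relabel t ℓ) ts m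
gained ℓ []       m = 0
gained ℓ (t ∷ ts) m = tally t (relabel t ℓ) m + gained (relabel t ℓ) ts m

-- (α , β , σ), half the differences x₁ − x₃, x₀ − x₂ and (x₁ + x₃) − (x₀ + x₂) of the degree class sizes.
Balance : Set
Balance = ℤ × ℤ × ℤ

_⊞_ : Balance → Balance → Balance
(a , b , s) ⊞ (a′ , b′ , s′) = (a ℤ.+ a′) , (b ℤ.+ b′) , (s ℤ.+ s′)

double : Balance → Balance
double p = p ⊞ p

balance : (ℕ → ℤ) → Balance
balance x = (x 1 ℤ.- x 3) , (x 0 ℤ.- x 2) , ((x 1 ℤ.+ x 3) ℤ.- (x 0 ℤ.+ x 2))

-- Exact on even integers, where `neg m` stands for -(m + 1); odd ones are rounded. `Legal` checks
-- that no rounding took place.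
halve : ℤ → ℤ
halve (pos m) = pos ⌊ m /2⌋
halve (neg m) = neg ⌊ m /2⌋

data Small : ℤ → Set where
  minus : Small (neg 0)
  zero  : Small (pos 0)
  plus  : Small (pos 1)

-- Weighting positive α and negative β more heavily lets (1 , 0) improve to (−1 , 0) or (0 , 1), which are easier
-- to improve further; the cost is still invariant under exchanging the colours.
weight : ℤ → ℕ
weight (pos m)    = 3 * m
weight (neg m) = 2 * suc m

cost : Balance → ℕ
cost (a , b , s) = weight a + weight (ℤ.- b)

record Gain (p δ : Balance) : Set where
  constructor _⨾_
  field
    stays-small : Small (proj₂ (proj₂ (p ⊞ δ)))
    cheaper     : cost (p ⊞ δ) < cost p

net : ∀ {k} → Vec ℕ k → List (Toggle k) → ℕ → ℤ
net ℓ ts m = pos (gained ℓ ts m) ℤ.- pos (lost ℓ ts m)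

effect : ∀ {k} → Vec ℕ k → List (Toggle k) → Balance
effect ℓ ts = let a , b , s = balance (net ℓ ts) in halve a , halve b , halve s

-- The edges are pairwise different, so no toggle disturbs the colour that a later one expects, and
-- the effect is an exact half. For a concrete script both are closed computations, settled by
-- evaluation at each use.
Legal : ∀ {k} → Vec ℕ k → List (Toggle k) → Set
Legal ℓ ts = AllPairs (λ t t′ → ¬ SamePair (ends t) (ends t′)) ts
           × double (effect ℓ ts) ≡ balance (net ℓ ts)

legal? : ∀ {k} (ℓ : Vec ℕ k) ts → Dec (Legal ℓ ts)
legal? ℓ ts = AllPairs.allPairs? (λ t t′ → ¬? (samePair? (ends t) (ends t′))) ts ×-dec
  ≡-dec ℤ._≟_ (≡-dec ℤ._≟_ ℤ._≟_) _ _
  where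
  open import Data.Product.Properties using (≡-dec)

-- Passing the remaining conditions through `R` makes `Distinct` reduce to one flat tuple of exactly
-- the inequalities that have to be supplied.
Apart : ∀ {V : Set} {k} → ℕ → V → Vec ℕ k → Vec V k → Set → Set
Apart l v []      []       R = R
Apart l v (m ∷ ℓ) (w ∷ ws) R = if l ≡ᵇ m then v ≢ w × Apart l v ℓ ws R else Apart l v ℓ ws R

-- Vertices with different labels are distinct anyway.
Distinct : ∀ {V : Set} {k} → Vec ℕ k → Vec V k → Set
Distinct []      []       = ⊤
Distinct (l ∷ ℓ) (v ∷ vs) = Apart l v ℓ vs (Distinct ℓ vs)

-- Colourings, and the execution of scripts on them.

module Colourings {n} (𝒢 : CubicGraph n) where
  open CubicGraph 𝒢 public

  V : Set
  V = Fin n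

  -- The red bit exists for every pair and `col` masks it by adjacency, so toggling and
  -- complementing need no care about non-edges.
  record Colouring : Set where
    constructor colouring
    field
      isRed     : V → V → Bool
      isRed-sym : ∀ u v → isRed u v ≡ isRed v u

  open Colouring public

  col : Colouring → V → V → Colour
  col E u v = paint (adj u v) (isRed E u v)

  d : Colouring → V → ℕ
  d E u = # (λ v → col E u v ≟ᶜ red)

  x : Colouring → ℕ → ℕ
  x E k = # (λ v → d E v ≟ k)

  module _ (E : Colouring) where

    col-sym : ∀ u v → col E u v ≡ col E v u
    col-sym u v = cong₂ paint (adj-sym u v) (isRed-sym E u v)

    col-irr : ∀ u → col E u u ≡ none
    col-irr u = cong (λ a → paint a (isRed E u u)) (adj-irr u)

    apart : ∀ {u v} κ → col E u v ≡ κ → κ ≢ none → u ≢ v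
    apart κ uv κ≢none refl = κ≢none (trans (sym uv) (col-irr _))

  toggle : V → V → Colouring → Colouring
  toggle u v E .isRed x y = if does (samePair? (x , y) (u , v)) then not (isRed E x y) else isRed E x y
  toggle u v E .isRed-sym x y = cong₂ (λ b c → if b then not c else c)
    (does-⇔ (mk⇔ swapˡ swapˡ) (samePair? (x , y) (u , v)) (samePair? (y , x) (u , v)))
    (isRed-sym E x y)

  module _ (E : Colouring) {k} (t : Toggle k) {u v : V} (uv : col E u v ≡ before t) where
    private
      E′ = toggle u v E

      u≢v : u ≢ v
      u≢v = apart E _ uv (λ eq → before≢none t eq)
        where
        before≢none : ∀ {k} (t : Toggle k) → before t ≢ none
        before≢none (cut _ _)  ()
        before≢none (join _ _) ()

      on : ∀ x y → SamePair (x , y) (u , v) → col E′ x y ≡ swap (col E x y)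
      on x y p = trans
        (cong (λ b → paint (adj x y) (if b then not (isRed E x y) else isRed E x y))
          (dec-true (samePair? (x , y) (u , v)) p))
        (paint-not (adj x y) _)

    col-toggle : ∀ x y → ¬ SamePair (x , y) (u , v) → col E′ x y ≡ col E x y
    col-toggle x y ¬p = cong (λ b → paint (adj x y) (if b then not (isRed E x y) else isRed E x y))
      (dec-false (samePair? (x , y) (u , v)) ¬p)

    private
      shifted : ∀ {k} (t : Toggle k) {c c′ : Colour} {m m′} → c ≡ before t → c′ ≡ swap c →
        𝟙 (c ≟ᶜ red) + m′ ≡ 𝟙 (c′ ≟ᶜ red) + m → m′ ≡ shift t m
      shifted (cut _ _)  refl refl eq = cong pred eq
      shifted (join _ _) refl refl eq = eq

      d-at : ∀ a b → SamePair (a , b) (u , v) → (∀ y → SamePair (a , y) (u , v) → y ≡ b) →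
        d E′ a ≡ shift t (d E a)
      d-at a b p unique = shifted t ab (on a b p)
        (sum-update _ _ b λ y y≢b → cong (λ c → 𝟙 (c ≟ᶜ red)) (col-toggle a y (y≢b ∘ unique y)))
        where
        orient : SamePair (a , b) (u , v) → col E a b ≡ before t
        orient (inj₁ (refl , refl)) = uv
        orient (inj₂ (refl , refl)) = trans (col-sym E v u) uv
        ab = orient p

    d-toggleˡ : d E′ u ≡ shift t (d E u)
    d-toggleˡ = d-at u v (inj₁ (refl , refl))
      λ { y (inj₁ (_ , eq)) → eq ; y (inj₂ (u≡v , _)) → contradiction u≡v u≢v }

    d-toggleʳ : d E′ v ≡ shift t (d E v)
    d-toggleʳ = d-at v u (inj₂ (refl , refl))
      λ { y (inj₁ (v≡u , _)) → contradiction (sym v≡u) u≢v ; y (inj₂ (_ , eq)) → eq }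

    d-toggle : ∀ y → y ≢ u → y ≢ v → d E′ y ≡ d E y
    d-toggle y y≢u y≢v = sum-cong λ z → cong (λ c → 𝟙 (c ≟ᶜ red)) (col-toggle y z
      λ { (inj₁ (y≡u , _)) → y≢u y≡u ; (inj₂ (y≡v , _)) → y≢v y≡v })

    x-toggle : ∀ m → x E′ m + (𝟙 (d E u ≟ m) + 𝟙 (d E v ≟ m))
                   ≡ x E m + (𝟙 (shift t (d E u) ≟ m) + 𝟙 (shift t (d E v) ≟ m))
    x-toggle m = begin
      x E′ m + (𝟙 (d E u ≟ m) + 𝟙 (d E v ≟ m))   ≡⟨ +-comm (x E′ m) _ ⟩
      (𝟙 (d E u ≟ m) + 𝟙 (d E v ≟ m)) + x E′ m
        ≡⟨ sum-update₂ _ _ u≢v (λ y y≢u y≢v → cong (λ l → 𝟙 (l ≟ m)) (d-toggle y y≢u y≢v)) ⟩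
      (𝟙 (d E′ u ≟ m) + 𝟙 (d E′ v ≟ m)) + x E m
        ≡⟨ cong₂ (λ a b → (𝟙 (a ≟ m) + 𝟙 (b ≟ m)) + x E m) d-toggleˡ d-toggleʳ ⟩
      (𝟙 (shift t (d E u) ≟ m) + 𝟙 (shift t (d E v) ≟ m)) + x E m ≡⟨ +-comm _ (x E m) ⟩
      x E m + (𝟙 (shift t (d E u) ≟ m) + 𝟙 (shift t (d E v) ≟ m)) ∎
      where
      open ≡-Reasoning

  Labels : Colouring → ∀ {k} → Vec ℕ k → Vec V k → Set
  Labels E []      []       = ⊤
  Labels E (l ∷ ℓ) (v ∷ vs) = d E v ≡ l × Labels E ℓ vs

  Edges : Colouring → ∀ {k} → Vec V k → List (Toggle k) → Set
  Edges E vs []              = ⊤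
  Edges E vs (cut i j ∷ ts)  = col E (lookup vs i) (lookup vs j) ≡ red × Edges E vs ts
  Edges E vs (join i j ∷ ts) = col E (lookup vs i) (lookup vs j) ≡ blue × Edges E vs ts

  private
    labelled : ∀ {E k} (ℓ : Vec ℕ k) vs → Labels E ℓ vs → ∀ i → d E (lookup vs i) ≡ lookup ℓ i
    labelled (l ∷ ℓ) (v ∷ vs) (eq , eqs) zero    = eq
    labelled (l ∷ ℓ) (v ∷ vs) (eq , eqs) (suc i) = labelled ℓ vs eqs i

    unpack : ∀ {E l v k} (ℓ : Vec ℕ k) ws {R} → d E v ≡ l → Labels E ℓ ws →
      Apart l v ℓ ws R → (∀ i → v ≢ lookup ws i) × R
    unpack [] [] dv _ R = (λ ()) , R
    unpack {l = l} (m ∷ ℓ) (w ∷ ws) dv (dw , dws) R with l ≡ᵇ m in eq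
    ... | true  = let v≢w , R′ = R ; v≢ws , r = unpack ℓ ws dv dws R′
                  in (λ { zero → v≢w ; (suc i) → v≢ws i }) , r
    ... | false = let v≢ws , r = unpack ℓ ws dv dws R
                  in (λ { zero refl → subst T eq (≡⇒≡ᵇ l m (trans (sym dv) dw)) ; (suc i) → v≢ws i }) , r

    injective : ∀ {E k} (ℓ : Vec ℕ k) vs → Labels E ℓ vs → Distinct ℓ vs →
      ∀ i j → lookup vs i ≡ lookup vs j → i ≡ j
    injective (l ∷ ℓ) (v ∷ vs) (dv , dvs) D zero    zero    eq = refl
    injective (l ∷ ℓ) (v ∷ vs) (dv , dvs) D zero    (suc j) eq =
      contradiction eq (proj₁ (unpack ℓ vs dv dvs D) j)
    injective (l ∷ ℓ) (v ∷ vs) (dv , dvs) D (suc i) zero    eq =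
      contradiction (sym eq) (proj₁ (unpack ℓ vs dv dvs D) i)
    injective (l ∷ ℓ) (v ∷ vs) (dv , dvs) D (suc i) (suc j) eq =
      cong suc (injective ℓ vs dvs (proj₂ (unpack ℓ vs dv dvs D)) i j eq)

    module _ {k} (vs : Vec V k) (inj : ∀ i j → lookup vs i ≡ lookup vs j → i ≡ j) where

      Present : Colouring → Toggle k → Set
      Present E t = let i , j = ends t in col E (lookup vs i) (lookup vs j) ≡ before t

      present : ∀ {E} ts → Edges E vs ts → All (Present E) ts
      present []              _        = []
      present (cut i j ∷ ts)  (e , es) = e ∷ present ts es
      present (join i j ∷ ts) (e , es) = e ∷ present ts es

      -- Injectivity of the placement keeps the labels of untouched indices valid, and disjointness
      -- of the edges keeps the colours of the remaining toggles. So the class sizes change exactly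
      -- as computed from the labels.
      run : ∀ E ℓ ts → (∀ i → d E (lookup vs i) ≡ lookup ℓ i) → All (Present E) ts →
        AllPairs (λ t t′ → ¬ SamePair (ends t) (ends t′)) ts →
        ∃[ E′ ] (∀ m → x E′ m + lost ℓ ts m ≡ x E m + gained ℓ ts m)
      run E ℓ []       labels []       []             = E , λ m → refl
      run E ℓ (t ∷ ts) labels (e ∷ es) (fresh ∷ disj) = E₂ , total
        where
        i j : Fin k
        i = proj₁ (ends t)
        j = proj₂ (ends t)
        u v : V
        u = lookup vs i
        v = lookup vs j
        E₁ : Colouring
        E₁ = toggle u v E
        i≢j : i ≢ j
        i≢j i≡j = before-≢ t (trans (sym e) (trans (cong (λ i → col E (lookup vs i) v) i≡j) (col-irr E v)))
          where
          before-≢ : ∀ (t : Toggle k) → before t ≢ none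
          before-≢ (cut _ _)  ()
          before-≢ (join _ _) ()
        ℓ₁ : Vec ℕ k
        ℓ₁ = updateAt ℓ j (shift t)
        ℓ₂ : Vec ℕ k
        ℓ₂ = relabel t ℓ
        at-i : lookup ℓ₂ i ≡ shift t (d E u)
        at-i = trans (Vec.lookup∘updateAt i ℓ₁)
          (cong (shift t) (trans (Vec.lookup∘updateAt′ i j i≢j ℓ) (sym (labels i))))
        at-j : lookup ℓ₂ j ≡ shift t (d E v)
        at-j = trans (Vec.lookup∘updateAt′ j i (i≢j ∘ sym) ℓ₁)
          (trans (Vec.lookup∘updateAt j ℓ) (cong (shift t) (sym (labels j))))
        labels₁ : ∀ h → d E₁ (lookup vs h) ≡ lookup ℓ₂ h
        labels₁ h with h Fin.≟ i | h Fin.≟ j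
        ... | yes refl | _        = trans (d-toggleˡ E t e) (sym at-i)
        ... | no h≢i   | yes refl = trans (d-toggleʳ E t e) (sym at-j)
        ... | no h≢i   | no h≢j   = trans
          (d-toggle E t e (lookup vs h) (h≢i ∘ inj h i) (h≢j ∘ inj h j))
          (trans (labels h) (sym (trans (Vec.lookup∘updateAt′ h i h≢i ℓ₁) (Vec.lookup∘updateAt′ h j h≢j ℓ))))
        keep : ∀ {t′} → ¬ SamePair (ends t) (ends t′) × Present E t′ → Present E₁ t′
        keep {t′} (¬same , e′) = trans (col-toggle E t e _ _ (¬same ∘ back)) e′
          where
          back : SamePair (lookup vs (proj₁ (ends t′)) , lookup vs (proj₂ (ends t′))) (u , v) →
            SamePair (ends t) (ends t′)
          back (inj₁ (p , q)) = inj₁ (sym (inj _ _ p) , sym (inj _ _ q))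
          back (inj₂ (p , q)) = inj₂ (sym (inj _ _ q) , sym (inj _ _ p))
        rest : ∃[ E₂ ] (∀ m → x E₂ m + lost ℓ₂ ts m ≡ x E₁ m + gained ℓ₂ ts m)
        rest = run E₁ ℓ₂ ts labels₁ (All.zipWith keep (fresh , es)) disj
        E₂ = proj₁ rest
        first : ∀ m → x E₁ m + tally t ℓ m ≡ x E m + tally t ℓ₂ m
        first m = trans (cong₂ (λ a b → x E₁ m + (𝟙 (a ≟ m) + 𝟙 (b ≟ m))) (sym (labels i)) (sym (labels j)))
          (trans (x-toggle E t e m)
            (cong₂ (λ a b → x E m + (𝟙 (a ≟ m) + 𝟙 (b ≟ m))) (sym at-i) (sym at-j)))
        total : ∀ m → x E₂ m + lost ℓ (t ∷ ts) m ≡ x E m + gained ℓ (t ∷ ts) m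
        total m = begin
          x E₂ m + (tally t ℓ m + lost ℓ₂ ts m)
            ≡⟨ solve 3 (λ a b c → a :+ (b :+ c) := (a :+ c) :+ b) refl (x E₂ m) (tally t ℓ m) _ ⟩
          (x E₂ m + lost ℓ₂ ts m) + tally t ℓ m    ≡⟨ cong (_+ tally t ℓ m) (proj₂ rest m) ⟩
          (x E₁ m + gained ℓ₂ ts m) + tally t ℓ m
            ≡⟨ solve 3 (λ a b c → (a :+ b) :+ c := (a :+ c) :+ b) refl (x E₁ m) (gained ℓ₂ ts m) _ ⟩
          (x E₁ m + tally t ℓ m) + gained ℓ₂ ts m  ≡⟨ cong (_+ gained ℓ₂ ts m) (first m) ⟩
          (x E m + tally t ℓ₂ m) + gained ℓ₂ ts m  ≡⟨ +-assoc (x E m) _ _ ⟩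
          x E m + (tally t ℓ₂ m + gained ℓ₂ ts m) ∎
          where
          open ≡-Reasoning
          open +-*-Solver

  record At (E : Colouring) (p : Balance) : Set where
    constructor at
    field
      balanced : balance (λ m → pos (x E m)) ≡ double p

  open At public

  surgery : ∀ {E p k} → At E p → (ℓ : Vec ℕ k) (ts : List (Toggle k)) {_ : True (legal? ℓ ts)} (vs : Vec V k) →
    Labels E ℓ vs → Distinct ℓ vs → Edges E vs ts → ∃[ E′ ] At E′ (p ⊞ effect ℓ ts)
  surgery {E} {p} atE ℓ ts {legal} vs labels distinct edges = E′ , at (begin
    balance (λ m → pos (x E′ m))
      ≡⟨ cong₂ _,_ (cong₂ ℤ._-_ (x′ 1) (x′ 3)) (cong₂ _,_ (cong₂ ℤ._-_ (x′ 0) (x′ 2))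
                                                     (cong₂ ℤ._-_ (cong₂ ℤ._+_ (x′ 1) (x′ 3))
                                                       (cong₂ ℤ._+_ (x′ 0) (x′ 2)))) ⟩
    balance (λ m → pos (x E m) ℤ.+ net ℓ ts m)
      ≡⟨ cong₂ _,_ (diff (X 1) (N 1) (X 3) (N 3)) (cong₂ _,_ (diff (X 0) (N 0) (X 2) (N 2))
                                                     (diff₄ (X 1) (N 1) (X 3) (N 3) (X 0) (N 0) (X 2) (N 2))) ⟩
    balance (λ m → pos (x E m)) ⊞ balance (net ℓ ts) ≡⟨ cong₂ _⊞_ (balanced atE) (sym (proj₂ ok)) ⟩
    double p ⊞ double (effect ℓ ts)
      ≡⟨ cong₂ _,_ (mix (proj₁ p) _) (cong₂ _,_ (mix (proj₁ (proj₂ p)) _) (mix (proj₂ (proj₂ p)) _)) ⟩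
    double (p ⊞ effect ℓ ts) ∎)
    where
    open ≡-Reasoning
    open ℤ-Solver
    ok : Legal ℓ ts
    ok = toWitness legal
    inj = injective ℓ vs labels distinct
    result : ∃[ E′ ] (∀ m → x E′ m + lost ℓ ts m ≡ x E m + gained ℓ ts m)
    result = run vs inj E ℓ ts (labelled ℓ vs labels) (present vs inj ts edges) (proj₁ ok)
    E′ = proj₁ result
    X N : ℕ → ℤ
    X m = pos (x E m)
    N = net ℓ ts
    cancel : ∀ a l → a ≡ (a ℤ.+ l) ℤ.- l
    cancel = solve 2 (λ a l → a := (a :+ l) :- l) refl
    assoc : ∀ a g l → (a ℤ.+ g) ℤ.- l ≡ a ℤ.+ (g ℤ.- l)
    assoc = solve 3 (λ a g l → (a :+ g) :- l := a :+ (g :- l)) refl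
    diff : ∀ a b c e → (a ℤ.+ b) ℤ.- (c ℤ.+ e) ≡ (a ℤ.- c) ℤ.+ (b ℤ.- e)
    diff = solve 4 (λ a b c e → (a :+ b) :- (c :+ e) := (a :- c) :+ (b :- e)) refl
    diff₄ : ∀ a b c e f g h i → ((a ℤ.+ b) ℤ.+ (c ℤ.+ e)) ℤ.- ((f ℤ.+ g) ℤ.+ (h ℤ.+ i))
      ≡ ((a ℤ.+ c) ℤ.- (f ℤ.+ h)) ℤ.+ ((b ℤ.+ e) ℤ.- (g ℤ.+ i))
    diff₄ = solve 8 (λ a b c e f g h i → ((a :+ b) :+ (c :+ e)) :- ((f :+ g) :+ (h :+ i))
      := ((a :+ c) :- (f :+ h)) :+ ((b :+ e) :- (g :+ i))) refl
    mix : ∀ a b → (a ℤ.+ a) ℤ.+ (b ℤ.+ b) ≡ (a ℤ.+ b) ℤ.+ (a ℤ.+ b)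
    mix = solve 2 (λ a b → (a :+ a) :+ (b :+ b) := (a :+ b) :+ (a :+ b)) refl
    x′ : ∀ m → pos (x E′ m) ≡ pos (x E m) ℤ.+ net ℓ ts m
    x′ m = begin
      pos (x E′ m)                                           ≡⟨ cancel (pos (x E′ m)) (pos (lost ℓ ts m)) ⟩
      (pos (x E′ m) ℤ.+ pos (lost ℓ ts m)) ℤ.- pos (lost ℓ ts m)
        ≡⟨ cong (λ z → pos z ℤ.- pos (lost ℓ ts m)) (proj₂ result m) ⟩
      (pos (x E m) ℤ.+ pos (gained ℓ ts m)) ℤ.- pos (lost ℓ ts m)
        ≡⟨ assoc (pos (x E m)) (pos (gained ℓ ts m)) (pos (lost ℓ ts m)) ⟩
      pos (x E m) ℤ.+ net ℓ ts m ∎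

  record Better (p : Balance) : Set where
    constructor better
    field
      {colouring′} : Colouring
      {balance′}   : Balance
      at′    : At colouring′ balance′
      small′ : Small (proj₂ (proj₂ balance′))
      drop   : cost balance′ < cost p

  move : ∀ {E p} → At E p → ∀ {k} (ℓ : Vec ℕ k) (ts : List (Toggle k)) {_ : True (legal? ℓ ts)} (vs : Vec V k) →
    Labels E ℓ vs → Distinct ℓ vs → Edges E vs ts → Gain p (effect ℓ ts) → Better p
  move atE ℓ ts {legal} vs labels distinct edges (small ⨾ lt) =
    better (proj₂ (surgery atE ℓ ts {legal} vs labels distinct edges)) small lt

𝟙-× : {P Q : Set} (P? : Dec P) (Q? : Dec Q) → 𝟙 (P? ×-dec Q?) ≡ 𝟙 P? * 𝟙 Q?
𝟙-× (yes _) Q? = sym (+-identityʳ (𝟙 Q?))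
𝟙-× (no _)  Q? = refl

-- Neighbourhoods and double counting between degree classes.

module Structure {n} (𝒢 : CubicGraph n) where
  open Colourings 𝒢 public

  module _ (E : Colouring) where

    red+blue : ∀ u → d E u + # (λ v → col E u v ≟ᶜ blue) ≡ 3
    red+blue u = trans (sym (sum-+ (λ v → 𝟙 (col E u v ≟ᶜ red)) _))
      (trans (sum-cong λ v → split (adj u v) (isRed E u v)) (adj-three u))
      where
      split : ∀ a c → 𝟙 (paint a c ≟ᶜ red) + 𝟙 (paint a c ≟ᶜ blue) ≡ 𝟙 (a Bool.≟ true)
      split false c     = refl
      split true  false = refl
      split true  true  = refl

    red-nbr : ∀ u xs → length xs < d E u → ∃[ v ] col E u v ≡ red × All (v ≢_) xs
    red-nbr u xs = #-avoid (λ v → col E u v ≟ᶜ red) xs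

    blue-nbr : ∀ u xs → length xs + d E u < 3 → ∃[ v ] col E u v ≡ blue × All (v ≢_) xs
    blue-nbr u xs short = #-avoid (λ v → col E u v ≟ᶜ blue) xs
      (+-cancelʳ-< (d E u) (length xs) _ (subst (length xs + d E u <_)
        (sym (trans (+-comm _ (d E u)) (red+blue u))) short))

    red-bound : ∀ u xs → AllPairs _≢_ xs → All (λ v → col E u v ≡ red) xs → length xs ≤ d E u
    red-bound u = #-pack (λ v → col E u v ≟ᶜ red)

    blue-bound : ∀ u xs → AllPairs _≢_ xs → All (λ v → col E u v ≡ blue) xs → length xs + d E u ≤ 3
    blue-bound u xs xs! bs = subst (length xs + d E u ≤_) (trans (+-comm _ (d E u)) (red+blue u))
      (+-monoˡ-≤ (d E u) (#-pack (λ v → col E u v ≟ᶜ blue) xs xs! bs))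

    d≤3 : ∀ u → d E u ≤ 3
    d≤3 u = blue-bound u [] [] []

    blue-label : ∀ {u v} → col E u v ≡ blue → d E v ≡ 0 ⊎ d E v ≡ 1 ⊎ d E v ≡ 2
    blue-label {u} {v} uv with d E v | blue-bound v (u ∷ []) ([] ∷ []) (trans (col-sym E v u) uv ∷ [])
    ... | 0 | _ = inj₁ refl
    ... | 1 | _ = inj₂ (inj₁ refl)
    ... | 2 | _ = inj₂ (inj₂ refl)
    ... | suc (suc (suc _)) | s≤s (s≤s (s≤s ()))

    red-label : ∀ {u v} → col E u v ≡ red → d E v ≡ 1 ⊎ d E v ≡ 2 ⊎ d E v ≡ 3
    red-label {u} {v} uv with d E v | red-bound v (u ∷ []) ([] ∷ []) (trans (col-sym E v u) uv ∷ []) | d≤3 v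
    ... | 1 | _ | _ = inj₁ refl
    ... | 2 | _ | _ = inj₂ (inj₁ refl)
    ... | 3 | _ | _ = inj₂ (inj₂ refl)
    ... | suc (suc (suc (suc _))) | _ | s≤s (s≤s (s≤s ()))

    red-unique : ∀ {u a b} → d E u ≡ 1 → col E u a ≡ red → col E u b ≡ red → a ≡ b
    red-unique {u} {a} {b} du ua ub with a Fin.≟ b
    ... | yes a≡b = a≡b
    ... | no a≢b  with subst (2 ≤_) du (red-bound u (a ∷ b ∷ []) ((a≢b ∷ []) ∷ [] ∷ []) (ua ∷ ub ∷ []))
    ...   | s≤s ()

    blue-unique : ∀ {u a b} → d E u ≡ 2 → col E u a ≡ blue → col E u b ≡ blue → a ≡ b
    blue-unique {u} {a} {b} du ua ub with a Fin.≟ b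
    ... | yes a≡b = a≡b
    ... | no a≢b  with subst (λ m → 2 + m ≤ 3) du (blue-bound u (a ∷ b ∷ []) ((a≢b ∷ []) ∷ [] ∷ []) (ua ∷ ub ∷ []))
    ...   | s≤s (s≤s (s≤s ()))

    record Edge (κ : Colour) (k l : ℕ) : Set where
      constructor edge
      field
        {u v} : V
        du : d E u ≡ k
        dv : d E v ≡ l
        uv : col E u v ≡ κ

    edge? : ∀ κ k l → Dec (Edge κ k l)
    edge? κ k l = map′ (λ (u , v , du , dv , uv) → edge du dv uv) (λ (edge du dv uv) → _ , _ , du , dv , uv)
      (Fin.any? λ u → Fin.any? λ v → (d E u ≟ k) ×-dec (d E v ≟ l) ×-dec (col E u v ≟ᶜ κ))

    N : Colour → ℕ → V → ℕ
    N κ l u = # (λ v → (col E u v ≟ᶜ κ) ×-dec (d E v ≟ l))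

    -- Edges of colour κ between labels k and l, each counted from its k-end (twice if k ≡ l).
    e : Colour → ℕ → ℕ → ℕ
    e κ k l = sum (λ u → 𝟙 (d E u ≟ k) * N κ l u)

    private
      cell : Colour → ℕ → ℕ → V → V → ℕ
      cell κ k l u v = 𝟙 (d E u ≟ k) * (𝟙 (col E u v ≟ᶜ κ) * 𝟙 (d E v ≟ l))

      e-cells : ∀ κ k l → e κ k l ≡ sum (λ u → sum (cell κ k l u))
      e-cells κ k l = sum-cong λ u → trans (sym (sum-*ˡ (𝟙 (d E u ≟ k)) _))
        (sum-cong λ v → cong (𝟙 (d E u ≟ k) *_) (𝟙-× (col E u v ≟ᶜ κ) (d E v ≟ l)))

      cell-sym : ∀ κ k l u v → cell κ k l u v ≡ cell κ l k v u
      cell-sym κ k l u v = trans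
        (cong (λ c → 𝟙 (d E u ≟ k) * (𝟙 (c ≟ᶜ κ) * 𝟙 (d E v ≟ l))) (col-sym E u v))
        (solve 3 (λ a b c → a :* (b :* c) := c :* (b :* a)) refl
          (𝟙 (d E u ≟ k)) (𝟙 (col E v u ≟ᶜ κ)) (𝟙 (d E v ≟ l)))
        where
        open +-*-Solver

    e-sym : ∀ κ k l → e κ k l ≡ e κ l k
    e-sym κ k l = begin
      e κ k l                               ≡⟨ e-cells κ k l ⟩
      sum (λ u → sum (cell κ k l u))         ≡⟨ sum-comm (cell κ k l) ⟩
      sum (λ v → sum (λ u → cell κ k l u v)) ≡⟨ sum-cong (λ v → sum-cong (λ u → cell-sym κ k l u v)) ⟩
      sum (λ v → sum (cell κ l k v))         ≡⟨ e-cells κ l k ⟨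
      e κ l k ∎
      where
      open ≡-Reasoning

    e-bound : ∀ {κ k l} c → (∀ u → d E u ≡ k → N κ l u ≤ c) → e κ k l ≤ c * x E k
    e-bound {κ} {k} {l} c N≤c = ≤-trans (sum-mono pointwise) (≤-reflexive (sum-*ˡ c _))
      where
      pointwise : ∀ u → 𝟙 (d E u ≟ k) * N κ l u ≤ c * 𝟙 (d E u ≟ k)
      pointwise u = weigh (d E u ≟ k) (N≤c u)
        where
        weigh : {P : Set} (P? : Dec P) {m : ℕ} → (P → m ≤ c) → 𝟙 P? * m ≤ c * 𝟙 P?
        weigh (yes p) m≤c = ≤-trans (≤-reflexive (+-identityʳ _))
          (≤-trans (m≤c p) (≤-reflexive (sym (*-identityʳ c))))
        weigh (no _)  m≤c = z≤n

    pigeon : ∀ {κ k l} c → c * x E k < e κ k l → ∃[ u ] d E u ≡ k × c < N κ l u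
    pigeon {κ} {k} {l} c large with Fin.any? (λ u → (d E u ≟ k) ×-dec (c <? N κ l u))
    ... | yes found = found
    ... | no nil   = contradiction (e-bound c (λ u du → ≮⇒≥ (λ c<N → nil (u , du , c<N)))) (<⇒≱ large)

    e-none : ∀ {κ k l} → ¬ Edge κ k l → e κ k l ≡ 0
    e-none {κ} {k} {l} ¬edge =
      n≤0⇒n≡0 (e-bound 0 λ u du → #-cover (λ v → (col E u v ≟ᶜ κ) ×-dec (d E v ≟ l)) [] λ v (uv , dv) →
        contradiction (edge du dv uv) ¬edge)

    private
      -- Three classes suffice for each colour: the far end of a red edge has red degree at least 1,
      -- that of a blue edge at most 2.
      rows : ∀ κ k c (i j h : ℕ) → (∀ u → d E u ≡ k → # (λ v → col E u v ≟ᶜ κ) ≡ c) →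
        (∀ u v → col E u v ≡ κ → 𝟙 (d E v ≟ i) + (𝟙 (d E v ≟ j) + 𝟙 (d E v ≟ h)) ≡ 1) →
        c * x E k ≡ e κ k i + (e κ k j + e κ k h)
      rows κ k c i j h deg labels = begin
        c * x E k                                  ≡⟨ sum-*ˡ c _ ⟨
        sum (λ u → c * δ u)                        ≡⟨ sum-cong pointwise ⟩
        sum (λ u → δ u * N κ i u + (δ u * N κ j u + δ u * N κ h u))
          ≡⟨ trans (sum-+ (λ u → δ u * N κ i u) _) (cong (λ z → e κ k i + z) (sum-+ (λ u → δ u * N κ j u) _)) ⟩
        e κ k i + (e κ k j + e κ k h) ∎
        where
        open ≡-Reasoning
        δ : V → ℕ
        δ u = 𝟙 (d E u ≟ k)
        classes : ∀ u v → 𝟙 (col E u v ≟ᶜ κ) ≡ 𝟙 ((col E u v ≟ᶜ κ) ×-dec (d E v ≟ i))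
          + (𝟙 ((col E u v ≟ᶜ κ) ×-dec (d E v ≟ j)) + 𝟙 ((col E u v ≟ᶜ κ) ×-dec (d E v ≟ h)))
        classes u v = select (col E u v ≟ᶜ κ) (d E v ≟ i) (d E v ≟ j) (d E v ≟ h) (labels u v)
          where
          select : {P A B C : Set} (P? : Dec P) (A? : Dec A) (B? : Dec B) (C? : Dec C) →
            (P → 𝟙 A? + (𝟙 B? + 𝟙 C?) ≡ 1) →
            𝟙 P? ≡ 𝟙 (P? ×-dec A?) + (𝟙 (P? ×-dec B?) + 𝟙 (P? ×-dec C?))
          select (yes p) A? B? C? one = sym (one p)
          select (no _)  A? B? C? one = refl
        by-label : ∀ u → # (λ v → col E u v ≟ᶜ κ) ≡ N κ i u + (N κ j u + N κ h u)
        by-label u = trans (sum-cong (classes u)) (trans (sum-+ _ _) (cong (λ z → N κ i u + z) (sum-+ _ _)))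
        pointwise : ∀ u → c * δ u ≡ δ u * N κ i u + (δ u * N κ j u + δ u * N κ h u)
        pointwise u = weigh (d E u ≟ k) λ du → trans (sym (deg u du)) (by-label u)
          where
          weigh : {P : Set} (P? : Dec P) {a b m : ℕ} → (P → c ≡ a + (b + m)) →
            c * 𝟙 P? ≡ 𝟙 P? * a + (𝟙 P? * b + 𝟙 P? * m)
          weigh (yes p) {a} {b} {m} c≡ = trans (*-identityʳ c) (trans (c≡ p)
            (cong₂ _+_ (sym (+-identityʳ a)) (cong₂ _+_ (sym (+-identityʳ b)) (sym (+-identityʳ m)))))
          weigh (no _)  c≡ = *-zeroʳ c

    red-row : ∀ k → k * x E k ≡ e red k 1 + (e red k 2 + e red k 3)
    red-row k = rows red k k 1 2 3 (λ u du → du) labels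
      where
      labels : ∀ u v → col E u v ≡ red → 𝟙 (d E v ≟ 1) + (𝟙 (d E v ≟ 2) + 𝟙 (d E v ≟ 3)) ≡ 1
      labels u v uv with red-label uv
      ... | inj₁ eq        rewrite eq = refl
      ... | inj₂ (inj₁ eq) rewrite eq = refl
      ... | inj₂ (inj₂ eq) rewrite eq = refl

    blue-row : ∀ k → (3 ∸ k) * x E k ≡ e blue k 0 + (e blue k 1 + e blue k 2)
    blue-row k = rows blue k (3 ∸ k) 0 1 2 (λ u du → sym (trans (cong (3 ∸_) (sym du))
        (trans (cong (_∸ d E u) (sym (red+blue u))) (m+n∸m≡n (d E u) _)))) labels
      where
      labels : ∀ u v → col E u v ≡ blue → 𝟙 (d E v ≟ 0) + (𝟙 (d E v ≟ 1) + 𝟙 (d E v ≟ 2)) ≡ 1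
      labels u v uv with blue-label uv
      ... | inj₁ eq        rewrite eq = refl
      ... | inj₂ (inj₁ eq) rewrite eq = refl
      ... | inj₂ (inj₂ eq) rewrite eq = refl

    inhabited : ∀ {k} → 0 < x E k → ∃[ u ] d E u ≡ k
    inhabited {k} 0<x with #-avoid (λ v → d E v ≟ k) [] 0<x
    ... | u , du , _ = u , du

    crowd : ∀ {k} xs → AllPairs _≢_ xs → All (λ v → d E v ≡ k) xs → length xs ≤ x E k
    crowd {k} = #-pack (λ v → d E v ≟ k)

    red-next : ∀ {u k} → d E u ≡ k → ∀ xs → {_ : True (length xs <? k)} →
      ∃[ v ] col E u v ≡ red × All (v ≢_) xs
    red-next {u} refl xs {lt} = red-nbr u xs (toWitness lt)

    blue-next : ∀ {u k} → d E u ≡ k → ∀ xs → {_ : True (length xs + k <? 3)} →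
      ∃[ v ] col E u v ≡ blue × All (v ≢_) xs
    blue-next {u} refl xs {lt} = blue-nbr u xs (toWitness lt)

    reverse : ∀ {κ k l} → Edge κ k l → Edge κ l k
    reverse (edge du dv uv) = edge dv du (trans (col-sym E _ _) uv)

    two-nbrs : ∀ {κ l a} → 1 < N κ l a →
      ∃[ u ] ∃[ v ] u ≢ v × (d E u ≡ l × col E a u ≡ κ) × (d E v ≡ l × col E a v ≡ κ)
    two-nbrs {κ} {l} {a} 1<N with #-avoid (λ v → (col E a v ≟ᶜ κ) ×-dec (d E v ≟ l)) [] (<-trans (s≤s z≤n) 1<N)
    ... | u , (au , du) , _ with #-avoid (λ v → (col E a v ≟ᶜ κ) ×-dec (d E v ≟ l)) (u ∷ []) 1<N
    ...   | v , (av , dv) , v≢u ∷ [] = u , v , v≢u ∘ sym , (du , au) , (dv , av)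

    N≤ : ∀ κ l u → N κ l u ≤ # (λ v → col E u v ≟ᶜ κ)
    N≤ κ l u = #-mono (λ v → (col E u v ≟ᶜ κ) ×-dec (d E v ≟ l)) (λ v → col E u v ≟ᶜ κ) (λ v → proj₁)

    e-red≤ : ∀ k l → e red k l ≤ k * x E k
    e-red≤ k l = e-bound k λ u du → ≤-trans (N≤ red l u) (≤-reflexive du)

    e-blue≤ : ∀ k l → e blue k l ≤ (3 ∸ k) * x E k
    e-blue≤ k l = e-bound (3 ∸ k) λ u du → ≤-trans (N≤ blue l u) (≤-reflexive
      (trans (sym (m+n∸m≡n (d E u) _)) (cong₂ _∸_ (red+blue u) du)))

    -- An edge within one class is counted from both of its ends.
    e-even : ∀ {κ} k → κ ≢ none → ∃[ h ] e κ k k ≡ h + h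
    e-even {κ} k κ≢none with symmetric-sum-even (λ u v → cell κ k k u v) (cell-sym κ k k)
      (λ u → trans (cong (λ m → 𝟙 (d E u ≟ k) * (m * 𝟙 (d E u ≟ k)))
        (𝟙-no (col E u u ≟ᶜ κ) λ uu → κ≢none (trans (sym uu) (col-irr E u)))) (*-zeroʳ (𝟙 (d E u ≟ k))))
    ... | h , even = h , trans (e-cells κ k k) even

-- How steps of one or two units change the cost.

record Shift (c δ : ℤ) (i j : ℕ) : Set where
  constructor shifts
  field
    -- `i` is a guaranteed saving and `j` a tolerated loss.
    bound : weight (c ℤ.+ δ) + i ≤ weight c + j

stay : ∀ {c} → Shift c (pos 0) 0 0
stay {c} = shifts (≤-reflexive (cong (λ c → weight c + 0) (ℤ.+-identityʳ c)))

pos-1 : ∀ {k} → Shift (pos (suc k)) (neg 0) 3 0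
pos-1 {k} = shifts (≤-reflexive (solve 1 (λ k → con 3 :* k :+ con 3 := con 3 :* (con 1 :+ k) :+ con 0) refl k))
  where
  open +-*-Solver

-- The worst case is 1 to -1, where the uneven weights still save 3 - 2 = 1. The opposite crossing,
-- -1 to 1, is the worst case of `neg+2` and loses 1; `neg+2′` starts at -2 or below and avoids it.
pos-2 : ∀ {k} → Shift (pos (suc k)) (neg 1) 1 0
pos-2 {zero}  = shifts (≤-refl)
pos-2 {suc k} = shifts (≤-trans (m≤m+n _ 5) (≤-reflexive
  (solve 1 (λ k → (con 3 :* k :+ con 1) :+ con 5 := con 3 :* (con 2 :+ k) :+ con 0) refl k)))
  where
  open +-*-Solver

neg+1 : ∀ {k} → Shift (neg k) (pos 1) 2 0
neg+1 {zero}  = shifts (≤-refl)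
neg+1 {suc k} = shifts (≤-reflexive
  (solve 1 (λ k → con 2 :* (con 1 :+ k) :+ con 2 := con 2 :* (con 2 :+ k) :+ con 0) refl k))
  where
  open +-*-Solver

neg+2 : ∀ {k} → Shift (neg k) (pos 2) 0 1
neg+2 {zero}        = shifts (≤-refl)
neg+2 {suc zero}    = shifts (z≤n)
neg+2 {suc (suc k)} = shifts (≤-trans (m≤m+n _ 5) (≤-reflexive
  (solve 1 (λ k → (con 2 :* (con 1 :+ k) :+ con 0) :+ con 5 := con 2 :* (con 3 :+ k) :+ con 1) refl k)))
  where
  open +-*-Solver

neg+2′ : ∀ {k} → Shift (neg (suc k)) (pos 2) 4 0
neg+2′ {zero}  = shifts (≤-refl)
neg+2′ {suc k} = shifts (≤-reflexive
  (solve 1 (λ k → con 2 :* (con 1 :+ k) :+ con 4 := con 2 :* (con 3 :+ k) :+ con 0) refl k))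
  where
  open +-*-Solver

zero-1 : Shift (pos 0) (neg 0) 0 2
zero-1 = shifts (≤-refl)

gain′ : ∀ {a b s δa δb δs i j i′ j′} → Small (s ℤ.+ δs) → Shift a δa i j → Shift (ℤ.- b) (ℤ.- δb) i′ j′ →
  {_ : True (j + j′ <? i + i′)} → Gain (a , b , s) (δa , δb , δs)
gain′ {a} {b} {s} {δa} {δb} {δs} {i} {j} {i′} {j′} small (shifts p) (shifts q) {lt} = small ⨾
  subst (λ c → weight (a ℤ.+ δa) + weight c < _) (sym (ℤ.neg-distrib-+ b δb))
    (+-cancelʳ-< (i + i′) _ _ (≤-<-trans
      (≤-trans (≤-reflexive (interchange A i B i′))
        (≤-trans (+-mono-≤ p q) (≤-reflexive (sym (interchange C j D j′)))))
      (+-monoʳ-< (C + D) (toWitness lt))))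
  where
  A = weight (a ℤ.+ δa)
  B = weight (ℤ.- b ℤ.+ ℤ.- δb)
  C = weight a
  D = weight (ℤ.- b)
  interchange : ∀ a i b i′ → (a + b) + (i + i′) ≡ (a + i) + (b + i′)
  interchange = solve 4 (λ a i b i′ → (a :+ b) :+ (i :+ i′) := (a :+ i) :+ (b :+ i′)) refl
    where
    open +-*-Solver

gain : ∀ {a b s δa δb i j i′ j′} → Small s → Shift a δa i j → Shift (ℤ.- b) (ℤ.- δb) i′ j′ →
  {_ : True (j + j′ <? i + i′)} → Gain (a , b , s) (δa , δb , pos 0)
gain {s = s} small p q {lt} = gain′ (subst Small (sym (ℤ.+-identityʳ s)) small) p q {lt}

surplus : ∀ {a b k} → pos a ℤ.- pos b ≡ pos k → a ≡ b + k
surplus {a} {b} {k} eq = ℤ.+-injective (begin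
  pos a                       ≡⟨ solve 2 (λ a b → a := b :+ (a :- b)) refl (pos a) (pos b) ⟩
  pos b ℤ.+ (pos a ℤ.- pos b) ≡⟨ cong (λ c → pos b ℤ.+ c) eq ⟩
  pos (b + k) ∎)
  where
  open ≡-Reasoning
  open ℤ-Solver

deficit : ∀ {a b k} → pos a ℤ.- pos b ≡ neg k → b ≡ a + suc k
deficit {a} {b} {k} eq = surplus (begin
  pos b ℤ.- pos a         ≡⟨ solve 2 (λ a b → b :- a := :- (a :- b)) refl (pos a) (pos b) ⟩
  ℤ.- (pos a ℤ.- pos b)   ≡⟨ cong ℤ.-_ eq ⟩
  pos (suc k) ∎)
  where
  open ≡-Reasoning
  open ℤ-Solver

-- Improvement when α and β are both nonzero.

module Mixed {n} (𝒢 : CubicGraph n) where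
  open Structure 𝒢 public

  module _ {E : Colouring} where

    α-pos : ∀ {k b s} → At E (pos k , b , s) → x E 1 ≡ x E 3 + (k + k)
    α-pos (at eq) = surplus {b = x E 3} (cong proj₁ eq)

    α-neg : ∀ {k b s} → At E (neg k , b , s) → x E 3 ≡ x E 1 + suc (suc (k + k))
    α-neg (at eq) = deficit (cong proj₁ eq)

    β-pos : ∀ {a k s} → At E (a , pos k , s) → x E 0 ≡ x E 2 + (k + k)
    β-pos (at eq) = surplus {b = x E 2} (cong (proj₁ ∘ proj₂) eq)

    β-neg : ∀ {a k s} → At E (a , neg k , s) → x E 2 ≡ x E 0 + suc (suc (k + k))
    β-neg (at eq) = deficit (cong (proj₁ ∘ proj₂) eq)

    σ-zero : ∀ {a b} → At E (a , b , pos 0) → x E 1 + x E 3 ≡ x E 0 + x E 2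
    σ-zero (at eq) = trans (surplus (cong (proj₂ ∘ proj₂) eq)) (+-identityʳ _)

    σ-plus : ∀ {a b} → At E (a , b , pos 1) → x E 1 + x E 3 ≡ (x E 0 + x E 2) + 2
    σ-plus (at eq) = surplus (cong (proj₂ ∘ proj₂) eq)

    σ-minus : ∀ {a b} → At E (a , b , neg 0) → x E 0 + x E 2 ≡ (x E 1 + x E 3) + 2
    σ-minus (at eq) = deficit (cong (proj₂ ∘ proj₂) eq)

  more-by : ∀ {a b k} → a ≡ b + suc k → b < a
  more-by {b = b} {k} refl = subst (b <_) (sym (+-suc b k)) (s≤s (m≤m+n b k))

  above : ∀ {a b} → b < a → 0 < a
  above (s≤s _) = s≤s z≤n

  -- If no unit step exists, D₁ is closed under blue edges. Joins inside D₁ lower α and β as wanted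
  -- but also σ, and a blue edge at D₀ with even ends restores σ.
  pos-pos : ∀ {E k m s} → At E (pos (suc k) , pos (suc m) , s) → Small s → Better (pos (suc k) , pos (suc m) , s)
  pos-pos {E} {k} {m} {s} atE small with edge? E blue 1 2 | edge? E blue 0 1
  ... | yes (edge du dv uv) | _ = move atE (1 ∷ 2 ∷ []) (join 0F 1F ∷ []) (_ ∷ _ ∷ []) (du , dv , tt) tt (uv , tt)
    (gain small pos-1 stay)
  ... | no _ | yes (edge du dv uv) = move atE (0 ∷ 1 ∷ []) (join 0F 1F ∷ []) (_ ∷ _ ∷ []) (du , dv , tt) tt (uv , tt)
    (gain small stay neg+1)
  ... | no ¬b12 | no ¬b01 = proof
    where
    b-closed : ∀ {u v} → d E u ≡ 1 → col E u v ≡ blue → d E v ≡ 1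
    b-closed {u} {v} du uv with blue-label E uv
    ... | inj₁ dv        = contradiction (edge dv du (trans (col-sym E v u) uv)) ¬b01
    ... | inj₂ (inj₁ dv) = dv
    ... | inj₂ (inj₂ dv) = contradiction (edge du dv uv) ¬b12
    proof : Better _
    proof with inhabited E {1} (above (more-by (α-pos atE))) | inhabited E {0} (above (more-by (β-pos atE)))
    ... | u , du | p , dp with blue-next E du [] | blue-next E dp []
    ...   | v , uv , _ | q , pq , _ with blue-label E pq
    ...     | inj₂ (inj₁ dq) = contradiction (edge dp dq pq) ¬b01
    ...     | inj₂ (inj₂ dq) = move atE (1 ∷ 1 ∷ 0 ∷ 2 ∷ []) (join 0F 1F ∷ join 2F 3F ∷ []) (u ∷ v ∷ p ∷ q ∷ [])
      (du , b-closed du uv , dp , dq , tt) (apart E blue uv (λ ()) , tt) (uv , pq , tt) (gain small pos-1 neg+1)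
    ...     | inj₁ dq with blue-next E du (v ∷ [])
    -- Joining `u v` and `p q` alone adds (0, -2, 0), which overshoots when β = 1. After the first
    -- join `u` has degree 2, so joining `u w` adds the missing (-1, 0, 0).
    ...       | w , uw , w≢v ∷ [] = move atE (1 ∷ 1 ∷ 1 ∷ 0 ∷ 0 ∷ [])
      (join 0F 1F ∷ join 0F 2F ∷ join 3F 4F ∷ []) (u ∷ v ∷ w ∷ p ∷ q ∷ [])
      (du , b-closed du uv , b-closed du uw , dp , dq , tt)
      (apart E blue uv (λ ()) , apart E blue uw (λ ()) , w≢v ∘ sym , apart E blue pq (λ ()) , tt)
      (uv , uw , pq , tt) (gain small pos-1 neg+2)

  -- Once no 1-2 edge is left, a blue edge at D₂ has even ends and its join raises σ; cutting red
  -- edges at D₁ pays for that.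
  pos-neg : ∀ {E k m s} → At E (pos (suc k) , neg m , s) → Small s → Better (pos (suc k) , neg m , s)
  pos-neg {E} atE small with edge? E blue 1 2 | edge? E red 1 2
  ... | yes (edge du dv uv) | _ = move atE (1 ∷ 2 ∷ []) (join 0F 1F ∷ []) (_ ∷ _ ∷ []) (du , dv , tt) tt (uv , tt)
    (gain small pos-1 stay)
  ... | no _ | yes (edge du dv uv) = move atE (1 ∷ 2 ∷ []) (cut 0F 1F ∷ []) (_ ∷ _ ∷ []) (du , dv , tt) tt (uv , tt)
    (gain small stay pos-1)
  ... | no ¬b12 | no ¬r12 = proof
    where
    -- The red edges of D₁ then all end in D₃. There are x₁ > x₃ of them, so `pigeon` finds a vertex
    -- of D₃ receiving two.
    crowded : ¬ Edge E red 1 1 → 1 * x E 3 < e E red 3 1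
    crowded ¬r11 = subst₂ _<_ (sym (*-identityˡ _)) (begin
      x E 1                                         ≡⟨ *-identityˡ _ ⟨
      1 * x E 1                                     ≡⟨ red-row E 1 ⟩
      e E red 1 1 + (e E red 1 2 + e E red 1 3)
        ≡⟨ cong₂ (λ a b → a + (b + e E red 1 3)) (e-none E ¬r11) (e-none E ¬r12) ⟩
      e E red 1 3                                   ≡⟨ e-sym E red 1 3 ⟩
      e E red 3 1 ∎)
      (more-by (α-pos atE))
      where
      open ≡-Reasoning
    proof : Better _
    proof with inhabited E {2} (above (more-by (β-neg atE)))
    ... | w , dw with blue-next E dw []
    ...   | p , wp , _ with blue-label E wp | edge? E red 1 1
    ...     | inj₂ (inj₁ dp) | _ = contradiction (edge dp dw (trans (col-sym E p w) wp)) ¬b12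
    ...     | inj₁ dp | yes (edge du dv uv) = move atE (1 ∷ 1 ∷ 2 ∷ 0 ∷ []) (cut 0F 1F ∷ join 2F 3F ∷ [])
      (_ ∷ _ ∷ w ∷ p ∷ []) (du , dv , dw , dp , tt) (apart E red uv (λ ()) , tt) (uv , wp , tt)
        (gain small pos-1 pos-1)
    ...     | inj₂ (inj₂ dp) | yes (edge du dv uv) = move atE (1 ∷ 1 ∷ 2 ∷ 2 ∷ []) (cut 0F 1F ∷ join 2F 3F ∷ [])
      (_ ∷ _ ∷ w ∷ p ∷ []) (du , dv , dw , dp , tt) (apart E red uv (λ ()) , apart E blue wp (λ ()) , tt)
        (uv , wp , tt)
      (gain small pos-2 pos-2)
    ...     | inj₁ dp | no ¬r11 with pigeon E 1 (crowded ¬r11)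
    ...       | a , da , 1<N with two-nbrs E 1<N
    ...         | u , v , u≢v , (du , au) , (dv , av) = move atE (3 ∷ 1 ∷ 1 ∷ 2 ∷ 0 ∷ [])
      (cut 0F 1F ∷ cut 0F 2F ∷ join 3F 4F ∷ []) (a ∷ u ∷ v ∷ w ∷ p ∷ []) (da , du , dv , dw , dp , tt)
      (u≢v , tt) (au , av , wp , tt) (gain small stay pos-1)
    proof | w , dw | p , wp , _ | inj₂ (inj₂ dp) | no ¬r11 with inhabited E {1} (above (more-by (α-pos atE)))
    ...       | u , du with red-next E du []
    ...         | v , uv , _ with red-label E uv
    ...           | inj₁ dv        = contradiction (edge du dv uv) ¬r11
    ...           | inj₂ (inj₁ dv) = contradiction (edge du dv uv) ¬r12
    ...           | inj₂ (inj₂ dv) = move atE (2 ∷ 2 ∷ 1 ∷ 3 ∷ []) (join 0F 1F ∷ cut 2F 3F ∷ [])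
      (w ∷ p ∷ u ∷ v ∷ []) (dw , dp , du , dv , tt) (apart E blue wp (λ ()) , tt) (wp , uv , tt)
        (gain small pos-1 pos-1)

  m≤3*m : ∀ m → m ≤ 3 * m
  m≤3*m m = m≤m+n m _

  -- Otherwise all red edges at D₃ end in D₁, where only x₁ red ends are available, and 3x₃ ≤ x₁.
  red33 : ∀ {E} → ¬ Edge E red 2 3 → x E 1 < x E 3 → Edge E red 3 3
  red33 {E} ¬r23 x1<x3 with edge? E red 3 3
  ... | yes r33 = r33
  ... | no ¬r33 = contradiction (begin
    x E 3                                     ≤⟨ m≤3*m _ ⟩
    3 * x E 3                                 ≡⟨ red-row E 3 ⟩
    e E red 3 1 + (e E red 3 2 + e E red 3 3)
      ≡⟨ cong₂ (λ a b → e E red 3 1 + (a + b)) (e-none E (¬r23 ∘ reverse E)) (e-none E ¬r33) ⟩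
    e E red 3 1 + 0                           ≡⟨ trans (+-identityʳ _) (e-sym E red 3 1) ⟩
    e E red 1 3                               ≤⟨ e-red≤ E 1 3 ⟩
    1 * x E 1                                 ≡⟨ *-identityˡ _ ⟩
    x E 1 ∎) (<⇒≱ x1<x3)
    where
    open ≤-Reasoning

  blue00 : ∀ {E} → ¬ Edge E blue 0 1 → x E 2 < x E 0 → Edge E blue 0 0
  blue00 {E} ¬b01 x2<x0 with edge? E blue 0 0
  ... | yes b00 = b00
  ... | no ¬b00 = contradiction (begin
    x E 0                                        ≤⟨ m≤3*m _ ⟩
    3 * x E 0                                    ≡⟨ blue-row E 0 ⟩
    e E blue 0 0 + (e E blue 0 1 + e E blue 0 2)
      ≡⟨ cong₂ (λ a b → a + (b + e E blue 0 2)) (e-none E ¬b00) (e-none E ¬b01) ⟩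
    e E blue 0 2                                 ≡⟨ e-sym E blue 0 2 ⟩
    e E blue 2 0                                 ≤⟨ e-blue≤ E 2 0 ⟩
    1 * x E 2                                    ≡⟨ *-identityˡ _ ⟩
    x E 2 ∎) (<⇒≱ x2<x0)
    where
    open ≤-Reasoning

  -- A 3-3 cut with a 0-0 join adds (2, -2, 0), a gain unless α = -1 and β = 1, where both
  -- coordinates overshoot. There a 0-2 join or a 1-3 cut replaces one of the two toggles, or a 1-2
  -- edge corrects one coordinate; without such edges the structure is rigid enough for one last
  -- script.
  neg-pos : ∀ {E k m s} → At E (neg k , pos (suc m) , s) → Small s → Better (neg k , pos (suc m) , s)
  neg-pos {E} {k} {m} {s} atE small with edge? E red 2 3 | edge? E blue 0 1
  ... | yes (edge du dv uv) | _ = move atE (2 ∷ 3 ∷ []) (cut 0F 1F ∷ []) (_ ∷ _ ∷ []) (du , dv , tt) tt (uv , tt)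
    (gain small neg+1 stay)
  ... | no _ | yes (edge du dv uv) = move atE (0 ∷ 1 ∷ []) (join 0F 1F ∷ []) (_ ∷ _ ∷ []) (du , dv , tt) tt (uv , tt)
    (gain small stay neg+1)
  ... | no ¬r23 | no ¬b01 = proof k m atE small (red33 ¬r23 (more-by (α-neg atE))) (blue00 ¬b01 (more-by (β-pos atE)))
    where
    proof : ∀ k m → At E (neg k , pos (suc m) , s) → Small s → Edge E red 3 3 → Edge E blue 0 0 →
      Better (neg k , pos (suc m) , s)
    proof k m atE small (edge {a} {a′} da da′ aa′) (edge {p} {q} dp dq pq)
      with edge? E blue 0 2 | edge? E red 1 3 | edge? E blue 1 2 | edge? E red 1 2
    ... | yes (edge du dv uv) | _ | _ | _ = move atE (3 ∷ 3 ∷ 0 ∷ 2 ∷ []) (cut 0F 1F ∷ join 2F 3F ∷ [])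
      (a ∷ a′ ∷ _ ∷ _ ∷ []) (da , da′ , du , dv , tt) (apart E red aa′ (λ ()) , tt) (aa′ , uv , tt)
        (gain small neg+1 neg+1)
    ... | no _ | yes (edge du dv uv) | _ | _ = move atE (0 ∷ 0 ∷ 1 ∷ 3 ∷ []) (join 0F 1F ∷ cut 2F 3F ∷ [])
      (p ∷ q ∷ _ ∷ _ ∷ []) (dp , dq , du , dv , tt) (apart E blue pq (λ ()) , tt) (pq , uv , tt)
        (gain small neg+1 neg+1)
    ... | no _ | no _ | yes (edge du dv uv) | _ = move atE (3 ∷ 3 ∷ 0 ∷ 0 ∷ 1 ∷ 2 ∷ [])
      (cut 0F 1F ∷ join 2F 3F ∷ join 4F 5F ∷ []) (a ∷ a′ ∷ p ∷ q ∷ _ ∷ _ ∷ []) (da , da′ , dp , dq , du , dv , tt)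
      (apart E red aa′ (λ ()) , apart E blue pq (λ ()) , tt) (aa′ , pq , uv , tt) (gain small neg+1 neg+2)
    ... | no _ | no _ | no _ | yes (edge du dv uv) = move atE (3 ∷ 3 ∷ 0 ∷ 0 ∷ 1 ∷ 2 ∷ [])
      (cut 0F 1F ∷ join 2F 3F ∷ cut 4F 5F ∷ []) (a ∷ a′ ∷ p ∷ q ∷ _ ∷ _ ∷ []) (da , da′ , dp , dq , du , dv , tt)
      (apart E red aa′ (λ ()) , apart E blue pq (λ ()) , tt) (aa′ , pq , uv , tt) (gain small neg+2 neg+1)
    proof (suc k) m atE small (edge {a} {a′} da da′ aa′) (edge {p} {q} dp dq pq) | no _ | no _ | no _ | no _ =
      move atE (3 ∷ 3 ∷ 0 ∷ 0 ∷ []) (cut 0F 1F ∷ join 2F 3F ∷ []) (a ∷ a′ ∷ p ∷ q ∷ []) (da , da′ , dp , dq , tt)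
        (apart E red aa′ (λ ()) , apart E blue pq (λ ()) , tt) (aa′ , pq , tt) (gain small neg+2′ neg+2)
    proof zero (suc m) atE small (edge {a} {a′} da da′ aa′) (edge {p} {q} dp dq pq) | no _ | no _ | no _ | no _ =
      move atE (3 ∷ 3 ∷ 0 ∷ 0 ∷ []) (cut 0F 1F ∷ join 2F 3F ∷ []) (a ∷ a′ ∷ p ∷ q ∷ []) (da , da′ , dp , dq , tt)
        (apart E red aa′ (λ ()) , apart E blue pq (λ ()) , tt) (aa′ , pq , tt) (gain small neg+2 neg+2′)
    proof zero zero atE small (edge {a} {a′} da da′ aa′) (edge {p} dp dq pq) | no ¬b02 | no ¬r13 | no ¬b12 | no ¬r12 =
      closed
      where
      zero-nbr : ∀ {v} → col E p v ≡ blue → d E v ≡ 0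
      zero-nbr pv with blue-label E pv
      ... | inj₁ dv        = dv
      ... | inj₂ (inj₁ dv) = contradiction (edge dp dv pv) ¬b01
      ... | inj₂ (inj₂ dv) = contradiction (edge dp dv pv) ¬b02
      -- `p` and its three blue neighbours. Since β = 1 means x₀ = x₂ + 2, this leaves at least two
      -- vertices in D₂.
      four : 4 ≤ x E 0
      four with blue-next E dp []
      ... | u , pu , _ with blue-next E dp (u ∷ [])
      ...   | v , pv , v≢u ∷ [] with blue-next E dp (v ∷ u ∷ [])
      ...     | w , pw , w≢v ∷ w≢u ∷ [] = crowd E (p ∷ w ∷ v ∷ u ∷ [])
        ((apart E blue pw (λ ()) ∷ apart E blue pv (λ ()) ∷ apart E blue pu (λ ()) ∷ [])
          ∷ (w≢v ∷ w≢u ∷ []) ∷ (v≢u ∷ []) ∷ [] ∷ [])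
        (dp ∷ zero-nbr pw ∷ zero-nbr pv ∷ zero-nbr pu ∷ [])
      closed : Better _
      closed with inhabited E {2} (<-≤-trans (s≤s z≤n) (+-cancelʳ-≤ 2 2 _ (subst (4 ≤_) (β-pos atE) four)))
      ... | w , dw with red-next E dw [] | blue-next E dw []
      ...   | v , wv , _ | y , wy , _ with red-label E wv | blue-label E wy
      ...     | inj₁ dv        | _              = contradiction (edge dv dw (trans (col-sym E v w) wv)) ¬r12
      ...     | inj₂ (inj₂ dv) | _              = contradiction (edge dw dv wv) ¬r23
      ...     | inj₂ (inj₁ dv) | inj₁ dy        = contradiction (edge dy dw (trans (col-sym E y w) wy)) ¬b02
      ...     | inj₂ (inj₁ dv) | inj₂ (inj₁ dy) = contradiction (edge dy dw (trans (col-sym E y w) wy)) ¬b12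
      -- `w` loses one red edge and gains another, so its two toggles together add (0, 1, 2); with
      -- the 3-3 cut the sum is (1, 0, 0).
      ...     | inj₂ (inj₁ dv) | inj₂ (inj₂ dy) = move atE (3 ∷ 3 ∷ 2 ∷ 2 ∷ 2 ∷ [])
        (cut 0F 1F ∷ cut 2F 3F ∷ join 2F 4F ∷ []) (a ∷ a′ ∷ w ∷ v ∷ y ∷ []) (da , da′ , dw , dv , dy , tt)
        (apart E red aa′ (λ ()) , apart E red wv (λ ()) , apart E blue wy (λ ()) , v≢y , tt) (aa′ , wv , wy , tt)
        (gain small neg+1 stay)
        where
        v≢y : v ≢ y
        v≢y refl with trans (sym wv) wy
        ... | ()

-- The case α < 0, β = 0, with the exception 3K₄.

module NegZero {n} (𝒢 : CubicGraph n) where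
  open Mixed 𝒢 public

  -- Only closed classes of four vertices are recorded; in a cubic graph `clique` makes each of them
  -- a K₄.
  ThreeK4 : Set
  ThreeK4 = Σ[ f ∈ (V → Fin 3) ] (∀ u v → adj u v ≡ true → f u ≡ f v) × (∀ (i : Fin 3) → # (λ v → f v Fin.≟ i) ≡ 4)

  coloured : ∀ E {u v} → adj u v ≡ true → col E u v ≡ red ⊎ col E u v ≡ blue
  coloured E {u} {v} uv = subst (λ a → paint a (isRed E u v) ≡ red ⊎ paint a (isRed E u v) ≡ blue) (sym uv)
    (shade (isRed E u v))
    where
    shade : ∀ c → paint true c ≡ red ⊎ paint true c ≡ blue
    shade true  = inj₁ refl
    shade false = inj₂ refl

  data Label (E : Colouring) (v : V) : Set where
    zero  : d E v ≡ 0 → Label E v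
    one   : d E v ≡ 1 → Label E v
    two   : d E v ≡ 2 → Label E v
    three : d E v ≡ 3 → Label E v

  label : ∀ E v → Label E v
  label E v with d E v in eq | d≤3 E v
  ... | 0 | _ = zero eq
  ... | 1 | _ = one eq
  ... | 2 | _ = two eq
  ... | 3 | _ = three eq
  ... | suc (suc (suc (suc _))) | s≤s (s≤s (s≤s ()))

  sum-small : ∀ {E a b s} → At E (a , b , s) → Small s → x E 1 + x E 3 ≤ (x E 0 + x E 2) + 2
  sum-small atE zero  = ≤-trans (≤-reflexive (σ-zero atE)) (m≤m+n _ 2)
  sum-small atE plus  = ≤-reflexive (σ-plus atE)
  sum-small atE minus = ≤-trans (m≤m+n _ 2) (≤-trans (≤-reflexive (sym (σ-minus atE))) (m≤m+n _ 2))

  x≡0⇒⊥ : ∀ {E k v} → x E k ≡ 0 → d E v ≢ k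
  x≡0⇒⊥ {E} {k} {v} x≡0 dv with subst (1 ≤_) x≡0 (crowd E (v ∷ []) ([] ∷ []) (dv ∷ []))
  ... | ()

  four-threes : ∀ {E a} → d E a ≡ 3 → (∀ v → col E a v ≡ red → d E v ≡ 3) → 4 ≤ x E 3
  four-threes {E} {a} da closed with red-next E da []
  ... | u , au , _ with red-next E da (u ∷ [])
  ...   | v , av , v≢u ∷ [] with red-next E da (v ∷ u ∷ [])
  ...     | w , aw , w≢v ∷ w≢u ∷ [] = crowd E (a ∷ w ∷ v ∷ u ∷ [])
    ((apart E red aw (λ ()) ∷ apart E red av (λ ()) ∷ apart E red au (λ ()) ∷ [])
      ∷ (w≢v ∷ w≢u ∷ []) ∷ (v≢u ∷ []) ∷ [] ∷ [])
    (da ∷ closed w aw ∷ closed v av ∷ closed u au ∷ [])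

  -- Without red 2-2 and 2-3 edges, 2x₂ ≤ x₁. As x₀ = x₂, the bound on σ gives x₃ ≤ 2, hence x₁ = 0
  -- and x₃ = 2. But then D₃ is closed under red edges and contains `a` with its three red
  -- neighbours.
  red22 : ∀ {E k s} → At E (neg k , pos 0 , s) → Small s → ¬ Edge E red 2 3 → Edge E red 3 3 → Edge E red 2 2
  red22 {E} {k} atE small ¬r23 (edge {a} da da′ aa′) with edge? E red 2 2
  ... | yes r22 = r22
  ... | no ¬r22 = contradiction (subst (4 ≤_) x3≡2 (four-threes {E} da closed)) (λ { (s≤s (s≤s ())) })
    where
    2x2≤x1 : 2 * x E 2 ≤ x E 1
    2x2≤x1 = begin
      2 * x E 2                                 ≡⟨ red-row E 2 ⟩
      e E red 2 1 + (e E red 2 2 + e E red 2 3)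
        ≡⟨ cong₂ (λ b c → e E red 2 1 + (b + c)) (e-none E ¬r22) (e-none E ¬r23) ⟩
      e E red 2 1 + 0                           ≡⟨ trans (+-identityʳ _) (e-sym E red 2 1) ⟩
      e E red 1 2                               ≤⟨ e-red≤ E 1 2 ⟩
      1 * x E 1                                 ≡⟨ *-identityˡ _ ⟩
      x E 1 ∎
      where
      open ≤-Reasoning
    bound : x E 1 + (k + k) ≤ 0
    bound = +-cancelʳ-≤ (x E 1 + 2) _ _ (begin
      (x E 1 + (k + k)) + (x E 1 + 2)
        ≡⟨ solve 2 (λ a k → (a :+ (k :+ k)) :+ (a :+ con 2) := a :+ (a :+ (con 2 :+ (k :+ k)))) refl (x E 1) k ⟩
      x E 1 + (x E 1 + suc (suc (k + k)))  ≡⟨ cong (λ z → x E 1 + z) (α-neg atE) ⟨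
      x E 1 + x E 3                        ≤⟨ sum-small atE small ⟩
      (x E 0 + x E 2) + 2                  ≡⟨ cong (λ z → (z + x E 2) + 2) (β-pos atE) ⟩
      ((x E 2 + 0) + x E 2) + 2
        ≡⟨ solve 1 (λ t → ((t :+ con 0) :+ t) :+ con 2 := con 2 :* t :+ con 2) refl (x E 2) ⟩
      2 * x E 2 + 2                        ≤⟨ +-monoˡ-≤ 2 2x2≤x1 ⟩
      x E 1 + 2 ∎)
      where
      open ≤-Reasoning
      open +-*-Solver
    x1≡0 : x E 1 ≡ 0
    x1≡0 = n≤0⇒n≡0 (≤-trans (m≤m+n _ _) bound)
    kk≡0 : k + k ≡ 0
    kk≡0 = n≤0⇒n≡0 (≤-trans (m≤n+m _ (x E 1)) bound)
    x3≡2 : x E 3 ≡ 2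
    x3≡2 = trans (α-neg atE) (cong₂ (λ a b → a + suc (suc b)) x1≡0 kk≡0)
    closed : ∀ v → col E a v ≡ red → d E v ≡ 3
    closed v av with red-label E av
    ... | inj₁ dv        = contradiction dv (x≡0⇒⊥ {E} x1≡0)
    ... | inj₂ (inj₁ dv) = contradiction (edge dv da (trans (col-sym E v a) av)) ¬r23
    ... | inj₂ (inj₂ dv) = dv

  -- Cutting a a′ has effect (1 , −1 , −2); most moves below combine it with toggles of total effect (0 , 1 , 2).
  module Hub {E s} (atE : At E (neg 0 , pos 0 , s)) (small : Small s) (¬r23 : ¬ Edge E red 2 3)
             {a a′ : V} (da : d E a ≡ 3) (da′ : d E a′ ≡ 3) (aa′ : col E a a′ ≡ red) where

    Goal : Set
    Goal = Better (neg 0 , pos 0 , s)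

    a≢a′ : a ≢ a′
    a≢a′ = apart E red aa′ (λ ())

    -- The three `via` scripts obtain (0, 1, 2) as (0, 0, 2) + (0, 1, 0), as (1, 1, 2) + (-1, 0, 0),
    -- and by a cut and a join at the common vertex `u`, which keeps its degree.
    via-02-12 : ∀ {z p u y} → d E z ≡ 2 → d E p ≡ 0 → col E z p ≡ blue →
      d E u ≡ 1 → d E y ≡ 2 → col E u y ≡ red → z ≢ y → Goal
    via-02-12 dz dp zp du dy uy z≢y = move atE (3 ∷ 3 ∷ 2 ∷ 0 ∷ 1 ∷ 2 ∷ []) (cut 0F 1F ∷ join 2F 3F ∷ cut 4F 5F ∷ [])
      (a ∷ a′ ∷ _ ∷ _ ∷ _ ∷ _ ∷ []) (da , da′ , dz , dp , du , dy , tt) (a≢a′ , z≢y , tt) (aa′ , zp , uy , tt)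
      (gain small neg+1 stay)

    via-22-12 : ∀ {u v w y} → d E u ≡ 2 → d E v ≡ 2 → col E u v ≡ red →
      d E w ≡ 1 → d E y ≡ 2 → col E w y ≡ blue → u ≢ y → v ≢ y → Goal
    via-22-12 du dv uv dw dy wy u≢y v≢y = move atE (3 ∷ 3 ∷ 2 ∷ 2 ∷ 1 ∷ 2 ∷ [])
      (cut 0F 1F ∷ cut 2F 3F ∷ join 4F 5F ∷ [])
      (a ∷ a′ ∷ _ ∷ _ ∷ _ ∷ _ ∷ []) (da , da′ , du , dv , dw , dy , tt)
      (a≢a′ , apart E red uv (λ ()) , u≢y , v≢y , tt) (aa′ , uv , wy , tt) (gain small neg+1 stay)

    via-22-22 : ∀ {u v y} → d E u ≡ 2 → d E v ≡ 2 → col E u v ≡ red → d E y ≡ 2 → col E u y ≡ blue → Goal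
    via-22-22 {v = v} {y} du dv uv dy uy = move atE (3 ∷ 3 ∷ 2 ∷ 2 ∷ 2 ∷ []) (cut 0F 1F ∷ cut 2F 3F ∷ join 2F 4F ∷ [])
      (a ∷ a′ ∷ _ ∷ v ∷ y ∷ []) (da , da′ , du , dv , dy , tt)
      (a≢a′ , apart E red uv (λ ()) , apart E blue uy (λ ()) , v≢y , tt) (aa′ , uv , uy , tt) (gain small neg+1 stay)
      where
      v≢y : v ≢ y
      v≢y refl with trans (sym uv) uy
      ... | ()

    path-end : ∀ {w y v z} → d E w ≡ 2 → d E y ≡ 2 → d E v ≡ 2 → col E y w ≡ red → col E y v ≡ red → w ≢ v →
      col E w z ≡ blue → Goal ⊎ d E z ≡ 0
    path-end {w} {y} {v} {z} dw dy dv yw yv w≢v wz with blue-label E wz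
    ... | inj₁ dz        = inj₂ dz
    ... | inj₂ (inj₁ dz) = inj₁ (via-22-12 dy dv yv dz dw (trans (col-sym E z w) wz)
      (apart E red yw (λ ())) (w≢v ∘ sym))
    ... | inj₂ (inj₂ dz) = inj₁ (via-22-22 dw dy (trans (col-sym E w y) yw) dz wz)

    -- Of the 2x₂ red ends at D₂ at most x₁ belong to edges into D₁ and none to edges into D₃, so
    -- more than x₂ stay inside. Some vertex of D₂ then has both red neighbours in D₂.
    few-ones : x E 1 < x E 2 → 1 * x E 2 < e E red 2 2
    few-ones x1<x2 = ≰⇒> λ e≤x2 → <⇒≱ x1<x2 (+-cancelʳ-≤ (1 * x E 2) _ _ (begin
      x E 2 + 1 * x E 2                         ≡⟨⟩
      2 * x E 2                                 ≡⟨ red-row E 2 ⟩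
      e E red 2 1 + (e E red 2 2 + e E red 2 3)
        ≡⟨ cong₂ (λ a c → a + (e E red 2 2 + c)) (e-sym E red 2 1) (e-none E ¬r23) ⟩
      e E red 1 2 + (e E red 2 2 + 0)
        ≤⟨ +-mono-≤ (e-red≤ E 1 2) (≤-trans (≤-reflexive (+-identityʳ _)) e≤x2) ⟩
      1 * x E 1 + 1 * x E 2                     ≡⟨ cong (λ z → z + 1 * x E 2) (*-identityˡ (x E 1)) ⟩
      x E 1 + 1 * x E 2 ∎))
      where
      open ≤-Reasoning

    x3≡ : x E 3 ≡ x E 1 + 2
    x3≡ = α-neg atE

    x0≡ : x E 0 ≡ x E 2
    x0≡ = trans (β-pos atE) (+-identityʳ _)

    scarce : x E 1 + x E 3 ≤ x E 0 + x E 2 → x E 1 < x E 2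
    scarce h with x E 1 <? x E 2
    ... | yes x1<x2 = x1<x2
    ... | no x1≮x2  = contradiction (subst₂ (λ c a → x E 1 + c ≤ a + x E 2) x3≡ x0≡ h) (<⇒≱ (begin-strict
      x E 2 + x E 2     ≤⟨ +-mono-≤ (≮⇒≥ x1≮x2) (≮⇒≥ x1≮x2) ⟩
      x E 1 + x E 1     <⟨ +-monoʳ-< (x E 1) (m<m+n (x E 1) (s≤s z≤n)) ⟩
      x E 1 + (x E 1 + 2) ∎))
      where
      open ≤-Reasoning

    -- At σ = 1 the fall of σ by 2 is harmless. Otherwise x₁ < x₂ gives a red path `w h v` in D₂,
    -- and `path-end` applies at both ends; two ends are prepared because one of them may be `y`.
    with-red12 : Edge E red 1 2 → Goal
    with-red12 (edge {u} {y} du dy uy) with even-heavy-or-plus small atE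
      where
      even-heavy-or-plus : ∀ {s} → Small s → At E (neg 0 , pos 0 , s) → x E 1 + x E 3 ≤ x E 0 + x E 2 ⊎ s ≡ pos 1
      even-heavy-or-plus zero  atE = inj₁ (≤-reflexive (σ-zero atE))
      even-heavy-or-plus minus atE = inj₁ (≤-trans (m≤m+n _ 2) (≤-reflexive (sym (σ-minus atE))))
      even-heavy-or-plus plus  atE = inj₂ refl
    ... | inj₂ s≡1 = move atE (3 ∷ 3 ∷ 1 ∷ 2 ∷ []) (cut 0F 1F ∷ cut 2F 3F ∷ []) (a ∷ a′ ∷ u ∷ y ∷ [])
        (da , da′ , du , dy , tt) (a≢a′ , tt) (aa′ , uy , tt)
        (gain′ (subst (λ s → Small (s ℤ.+ neg 1)) (sym s≡1) minus) neg+1 stay)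
    ... | inj₁ heavy with pigeon E 1 (few-ones (scarce heavy))
    ...   | h , dh , 1<N with two-nbrs E 1<N
    ...     | w , v , w≢v , (dw , hw) , (dv , hv) with blue-next E dw [] | blue-next E dv []
    ...       | p , wp , _ | q , vq , _ with path-end dw dh dv hw hv w≢v wp | path-end dv dh dw hv hw (w≢v ∘ sym) vq
    ...         | inj₁ goal | _         = goal
    ...         | inj₂ _    | inj₁ goal = goal
    ...         | inj₂ dp   | inj₂ dq with w Fin.≟ y
    ...           | no w≢y   = via-02-12 dw dp wp du dy uy w≢y
    ...           | yes refl = via-02-12 dv dq vq du dy uy (w≢v ∘ sym)

    module _ (¬r12 : ¬ Edge E red 1 2) (¬3K4 : ¬ ThreeK4) {y₀ : V} (dy₀ : d E y₀ ≡ 2) where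

      two-closed : ∀ {y v} → d E y ≡ 2 → col E y v ≡ red → d E v ≡ 2
      two-closed {y} {v} dy yv with red-label E yv
      ... | inj₁ dv        = contradiction (edge dv dy (trans (col-sym E v y) yv)) ¬r12
      ... | inj₂ (inj₁ dv) = dv
      ... | inj₂ (inj₂ dv) = contradiction (edge dy dv yv) ¬r23

      with-blue22 : Edge E blue 2 2 → Goal
      with-blue22 (edge {u} {y} du dy uy) with red-next E du []
      ... | v , uv , _ = via-22-22 du (two-closed du uv) uv dy uy

      with-blue12 : Edge E blue 1 2 → Goal
      with-blue12 (edge {u} {y} du dy uy) with red-next E dy []
      ... | w , yw , _ with two-closed dy yw
      ...   | dw with red-next E dw (y ∷ [])
      ...     | v , wv , v≢y ∷ [] = via-22-12 dw (two-closed dw wv) wv du dy uy (apart E red yw (λ ()) ∘ sym) v≢y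

      module _ (¬b22 : ¬ Edge E blue 2 2) (¬b12 : ¬ Edge E blue 1 2) where

        two-blue : ∀ {y p} → d E y ≡ 2 → col E y p ≡ blue → d E p ≡ 0
        two-blue {y} {p} dy yp with blue-label E yp
        ... | inj₁ dp        = dp
        ... | inj₂ (inj₁ dp) = contradiction (edge dp dy (trans (col-sym E p y) yp)) ¬b12
        ... | inj₂ (inj₂ dp) = contradiction (edge dy dp yp) ¬b22

        with-red13 : Edge E red 1 3 → Goal
        with-red13 (edge {u} {b} du db ub) with blue-next E dy₀ [] | red-next E dy₀ []
        -- Here the 1-3 cut, not `a a′`, supplies the -2 for σ. The join raises `y₀` to 3, so
        -- cutting `y₀ y′` is a 2-3 cut and adds (1, 0, 0).
        ... | p , yp , _ | y′ , yy′ , _ = move atE (2 ∷ 0 ∷ 2 ∷ 1 ∷ 3 ∷ []) (join 0F 1F ∷ cut 0F 2F ∷ cut 3F 4F ∷ [])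
          (y₀ ∷ p ∷ y′ ∷ u ∷ b ∷ []) (dy₀ , two-blue dy₀ yp , two-closed dy₀ yy′ , du , db , tt)
          (apart E red yy′ (λ ()) , tt) (yp , yy′ , ub , tt) (gain small neg+1 stay)

        module _ (¬r13 : ¬ Edge E red 1 3) where

          three-closed : ∀ {b v} → d E b ≡ 3 → col E b v ≡ red → d E v ≡ 3
          three-closed {b} {v} db bv with red-label E bv
          ... | inj₁ dv        = contradiction (edge dv db (trans (col-sym E v b) bv)) ¬r13
          ... | inj₂ (inj₁ dv) = contradiction (edge dv db (trans (col-sym E v b) bv)) ¬r23
          ... | inj₂ (inj₂ dv) = dv

          one-closed : ∀ {u v} → d E u ≡ 1 → col E u v ≡ red → d E v ≡ 1
          one-closed {u} {v} du uv with red-label E uv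
          ... | inj₁ dv        = dv
          ... | inj₂ (inj₁ dv) = contradiction (edge du dv uv) ¬r12
          ... | inj₂ (inj₂ dv) = contradiction (edge du dv uv) ¬r13

          2≤x1 : 2 ≤ x E 1
          2≤x1 = +-cancelʳ-≤ 2 2 _ (subst (4 ≤_) x3≡ (four-threes {E} da (λ v → three-closed da)))

          -- Cutting one red edge inside each of D₃, D₂ and D₁ adds (1, 1, -2). The join `w q` adds
          -- (0, 0, 2), and the join `y p`, with `y` now of degree 1, adds (0, -1, 0).
          two-targets : ∀ {y p w q} → d E y ≡ 2 → col E y p ≡ blue → d E w ≡ 2 → col E w q ≡ blue → p ≢ q → Goal
          two-targets {y} {p} {w} {q} dy yp dw wq p≢q with inhabited E {1} (<-≤-trans (s≤s z≤n) 2≤x1) | red-next E dy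
            (w ∷ [])
          ... | r , dr | y′ , yy′ , y′≢w ∷ [] with red-next E dr []
          ...   | r′ , rr′ , _ = move atE (3 ∷ 3 ∷ 2 ∷ 2 ∷ 1 ∷ 1 ∷ 2 ∷ 0 ∷ 0 ∷ [])
            (cut 0F 1F ∷ cut 2F 3F ∷ cut 4F 5F ∷ join 6F 7F ∷ join 2F 8F ∷ [])
            (a ∷ a′ ∷ y ∷ y′ ∷ r ∷ r′ ∷ w ∷ q ∷ p ∷ [])
            (da , da′ , dy , two-closed dy yy′ , dr , one-closed dr rr′ , dw , two-blue dw wq , two-blue dy yp , tt)
            (a≢a′ , apart E red yy′ (λ ()) , y≢w , y′≢w , apart E red rr′ (λ ()) , p≢q ∘ sym , tt)
            (aa′ , yy′ , rr′ , wq , yp , tt) (gain small neg+1 stay)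
            where
            y≢w : y ≢ w
            y≢w refl = p≢q (blue-unique E dy yp wq)

          p₀ : V
          p₀ = proj₁ (blue-next E dy₀ [])

          y₀p₀ : col E y₀ p₀ ≡ blue
          y₀p₀ = proj₁ (proj₂ (blue-next E dy₀ []))

          dp₀ : d E p₀ ≡ 0
          dp₀ = two-blue dy₀ y₀p₀

          module Tight (one-target : ∀ w → d E w ≡ 2 → col E w p₀ ≡ blue) where

            -- D₂ lies in the blue neighbourhood of `p₀`, which has three vertices, and contains
            -- `y₀` with its two red neighbours.
            x2≡3 : x E 2 ≡ 3
            x2≡3 = ≤-antisym
              (≤-trans (#-mono (λ v → d E v ≟ 2) (λ v → col E p₀ v ≟ᶜ blue)
                (λ v dv → trans (col-sym E p₀ v) (one-target v dv)))
                (≤-reflexive (trans (cong (λ k → k + # (λ v → col E p₀ v ≟ᶜ blue)) (sym dp₀)) (red+blue E p₀))))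
              three≤
              where
              three≤ : 3 ≤ x E 2
              three≤ with red-next E dy₀ []
              ... | u , yu , _ with red-next E dy₀ (u ∷ [])
              ...   | v , yv , v≢u ∷ [] = crowd E (y₀ ∷ v ∷ u ∷ [])
                ((apart E red yv (λ ()) ∷ apart E red yu (λ ()) ∷ []) ∷ (v≢u ∷ []) ∷ [] ∷ [])
                (dy₀ ∷ two-closed dy₀ yv ∷ two-closed dy₀ yu ∷ [])

            x0≡3 : x E 0 ≡ 3
            x0≡3 = trans x0≡ x2≡3

            -- The red edges at D₁ form a perfect matching of D₁. Parity is what excludes x₁ = 3
            -- below.
            x1-even : ∃[ h ] x E 1 ≡ h + h
            x1-even with e-even E {red} 1 (λ ())
            ... | h , even = h , (begin
              x E 1                                     ≡⟨ *-identityˡ _ ⟨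
              1 * x E 1                                 ≡⟨ red-row E 1 ⟩
              e E red 1 1 + (e E red 1 2 + e E red 1 3)
                ≡⟨ cong₂ (λ b c → e E red 1 1 + (b + c)) (e-none E ¬r12) (e-none E ¬r13) ⟩
              e E red 1 1 + 0                           ≡⟨ +-identityʳ _ ⟩
              e E red 1 1                               ≡⟨ even ⟩
              h + h ∎)
              where
              open ≡-Reasoning

            x1≤3 : x E 1 + (x E 1 + 2) ≤ 8
            x1≤3 = subst₂ (λ c z → x E 1 + c ≤ z) x3≡ (cong₂ (λ a b → (a + b) + 2) x0≡3 x2≡3) (sum-small atE small)

            x1≡2 : x E 1 ≡ 2
            x1≡2 = forced (x E 1) 2≤x1 x1≤3 x1-even
              where
              forced : ∀ t → 2 ≤ t → t + (t + 2) ≤ 8 → (∃[ h ] t ≡ h + h) → t ≡ 2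
              forced 2 _ _ _ = refl
              forced 3 _ _ (1 , ())
              forced 3 _ _ (suc (suc h) , eq) with trans eq
                (cong (λ z → 2 + z) (trans (+-suc h (suc h)) (cong suc (+-suc h h))))
              ... | ()
              forced (suc (suc (suc (suc t)))) _ (s≤s (s≤s (s≤s (s≤s h)))) _
                with subst (_≤ 4) (cong (4 +_) (+-comm t 2)) (≤-trans (m≤n+m (4 + t + 2) t) h)
              ... | s≤s (s≤s (s≤s (s≤s ())))
              forced 1 (s≤s ()) _ _

            -- The three copies of K₄: D₃, D₂ with its common blue neighbour p₀, and the rest.
            class : V → Fin 3
            class v = pick (d E v) (does (v Fin.≟ p₀))
              where
              pick : ℕ → Bool → Fin 3
              pick 0 true  = 1F
              pick 0 false = 2F
              pick 1 _     = 2F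
              pick 2 _     = 1F
              pick _ _     = 0F

            class-3 : ∀ {v} → d E v ≡ 3 → class v ≡ 0F
            class-3 dv rewrite dv = refl

            class-2 : ∀ {v} → d E v ≡ 2 → class v ≡ 1F
            class-2 dv rewrite dv = refl

            class-1 : ∀ {v} → d E v ≡ 1 → class v ≡ 2F
            class-1 dv rewrite dv = refl

            class-p₀ : class p₀ ≡ 1F
            class-p₀ rewrite dp₀ | dec-true (p₀ Fin.≟ p₀) refl = refl

            class-0 : ∀ {v} → d E v ≡ 0 → v ≢ p₀ → class v ≡ 2F
            class-0 {v} dv v≢p₀ rewrite dv | dec-false (v Fin.≟ p₀) v≢p₀ = refl

            p₀-nbrs : ∀ v → col E p₀ v ≡ blue → d E v ≡ 2
            p₀-nbrs = #-squeeze (λ v → d E v ≟ 2) (λ v → col E p₀ v ≟ᶜ blue)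
              (λ v dv → trans (col-sym E p₀ v) (one-target v dv))
              (≤-reflexive (trans (cong (λ k → k + # (λ v → col E p₀ v ≟ᶜ blue)) (sym dp₀))
                (trans (red+blue E p₀) (sym x2≡3))))

            not-p₀ : ∀ {u v k} → d E u ≡ k → k ≢ 2 → col E u v ≡ blue → v ≢ p₀
            not-p₀ {u} du k≢2 uv refl = k≢2 (trans (sym du) (p₀-nbrs u (trans (col-sym E p₀ u) uv)))

            same-class : ∀ u v → adj u v ≡ true → class u ≡ class v
            same-class u v uv with coloured E uv
            ... | inj₁ r with label E u
            ...   | three du = trans (class-3 du) (sym (class-3 (three-closed du r)))
            ...   | two du   = trans (class-2 du) (sym (class-2 (two-closed du r)))
            ...   | one du   = trans (class-1 du) (sym (class-1 (one-closed du r)))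
            ...   | zero du  with subst (1 ≤_) du (red-bound E u (v ∷ []) ([] ∷ []) (r ∷ []))
            ...     | ()
            same-class u v uv | inj₂ b with blue-label E b | blue-label E (trans (col-sym E v u) b)
            ...   | inj₂ (inj₂ dv) | _ = class-of-two dv (trans (col-sym E v u) b)
              where
              class-of-two : ∀ {u v} → d E v ≡ 2 → col E v u ≡ blue → class u ≡ class v
              class-of-two dv vu = trans (cong class (blue-unique E dv vu (one-target _ dv)))
                (trans class-p₀ (sym (class-2 dv)))
            ...   | _              | inj₂ (inj₂ du) = trans (class-2 du)
              (trans (sym class-p₀) (cong class (blue-unique E du (one-target u du) b)))
            ...   | inj₂ (inj₁ dv) | inj₂ (inj₁ du) = trans (class-1 du) (sym (class-1 dv))
            ...   | inj₁ dv        | inj₂ (inj₁ du) = trans (class-1 du) (sym (class-0 dv (not-p₀ du (λ ()) b)))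
            ...   | inj₂ (inj₁ dv) | inj₁ du        = trans (class-0 du (not-p₀ dv (λ ()) (trans (col-sym E v u) b)))
              (sym (class-1 dv))
            ...   | inj₁ dv        | inj₁ du        = trans (class-0 du (not-p₀ dv (λ ()) (trans (col-sym E v u) b)))
              (sym (class-0 dv (not-p₀ du (λ ()) b)))

            #class-0 : # (λ v → class v Fin.≟ 0F) ≡ 4
            #class-0 = trans (sum-cong pointwise) (trans x3≡ (cong (_+ 2) x1≡2))
              where
              pointwise : ∀ v → 𝟙 (class v Fin.≟ 0F) ≡ 𝟙 (d E v ≟ 3)
              pointwise v with label E v | v Fin.≟ p₀
              ... | three dv | _     rewrite dv = refl
              ... | two dv   | _     rewrite dv = refl
              ... | one dv   | _     rewrite dv = refl
              ... | zero dv  | yes _ rewrite dv = refl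
              ... | zero dv  | no _  rewrite dv = refl

            one-p₀ : sum (λ v → 𝟙 (v Fin.≟ p₀)) ≡ 1
            one-p₀ = trans (sum-cong (λ v → sym (+-identityʳ _))) (sum-multiplicity (p₀ ∷ []))

            #class-1 : # (λ v → class v Fin.≟ 1F) ≡ 4
            #class-1 = trans (sum-cong pointwise) (trans (sum-+ (λ v → 𝟙 (d E v ≟ 2)) _) (cong₂ _+_ x2≡3 one-p₀))
              where
              pointwise : ∀ v → 𝟙 (class v Fin.≟ 1F) ≡ 𝟙 (d E v ≟ 2) + 𝟙 (v Fin.≟ p₀)
              pointwise v with label E v | v Fin.≟ p₀
              ... | three dv | no _     rewrite dv = refl
              ... | two dv   | no _     rewrite dv = refl
              ... | one dv   | no _     rewrite dv = refl
              ... | zero dv  | yes _    rewrite dv = refl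
              ... | zero dv  | no _     rewrite dv = refl
              ... | three dv | yes refl = contradiction (trans (sym dv) dp₀) λ ()
              ... | two dv   | yes refl = contradiction (trans (sym dv) dp₀) λ ()
              ... | one dv   | yes refl = contradiction (trans (sym dv) dp₀) λ ()

            #class-2 : # (λ v → class v Fin.≟ 2F) ≡ 4
            #class-2 = +-cancelʳ-≡ 1 _ _ (begin
              # (λ v → class v Fin.≟ 2F) + 1
                ≡⟨ cong (λ z → # (λ v → class v Fin.≟ 2F) + z) one-p₀ ⟨
              # (λ v → class v Fin.≟ 2F) + sum (λ v → 𝟙 (v Fin.≟ p₀))
                ≡⟨ sum-+ (λ v → 𝟙 (class v Fin.≟ 2F)) _ ⟨
              sum (λ v → 𝟙 (class v Fin.≟ 2F) + 𝟙 (v Fin.≟ p₀))                 ≡⟨ sum-cong pointwise ⟩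
              sum (λ v → 𝟙 (d E v ≟ 1) + 𝟙 (d E v ≟ 0))                         ≡⟨ sum-+ (λ v → 𝟙 (d E v ≟ 1)) _ ⟩
              x E 1 + x E 0                                                     ≡⟨ cong₂ _+_ x1≡2 x0≡3 ⟩
              5 ∎)
              where
              open ≡-Reasoning
              pointwise : ∀ v → 𝟙 (class v Fin.≟ 2F) + 𝟙 (v Fin.≟ p₀) ≡ 𝟙 (d E v ≟ 1) + 𝟙 (d E v ≟ 0)
              pointwise v with label E v | v Fin.≟ p₀
              ... | three dv | no _     rewrite dv = refl
              ... | two dv   | no _     rewrite dv = refl
              ... | one dv   | no _     rewrite dv = refl
              ... | zero dv  | yes _    rewrite dv = refl
              ... | zero dv  | no _     rewrite dv = refl
              ... | three dv | yes refl = contradiction (trans (sym dv) dp₀) λ ()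
              ... | two dv   | yes refl = contradiction (trans (sym dv) dp₀) λ ()
              ... | one dv   | yes refl = contradiction (trans (sym dv) dp₀) λ ()

            threeK4 : ThreeK4
            threeK4 = class , same-class , λ { 0F → #class-0 ; 1F → #class-1 ; 2F → #class-2 }

          finish : Goal
          finish with Fin.any? (λ w → (d E w ≟ 2) ×-dec ¬? (col E w p₀ ≟ᶜ blue))
          ... | no all-p₀ = contradiction (Tight.threeK4 one-target) ¬3K4
            where
            one-target : ∀ w → d E w ≡ 2 → col E w p₀ ≡ blue
            one-target w dw with col E w p₀ ≟ᶜ blue
            ... | yes wp = wp
            ... | no ¬wp = contradiction (w , dw , ¬wp) all-p₀
          ... | yes (w , dw , ¬wp₀) with blue-next E dw []
          ...   | q , wq , _ = two-targets dy₀ y₀p₀ dw wq λ { refl → ¬wp₀ wq }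

  neg-zero : ∀ {E k s} → At E (neg k , pos 0 , s) → Small s → ¬ ThreeK4 → Better (neg k , pos 0 , s)
  neg-zero {E} {k} {s} atE small ¬3K4 with edge? E red 2 3
  ... | yes (edge du dv uv) = move atE (2 ∷ 3 ∷ []) (cut 0F 1F ∷ []) (_ ∷ _ ∷ []) (du , dv , tt) tt (uv , tt)
    (gain small neg+1 stay)
  ... | no ¬r23 = proof k atE (red33 ¬r23 (more-by (α-neg atE)))
    where
    proof : ∀ k → At E (neg k , pos 0 , s) → Edge E red 3 3 → Better (neg k , pos 0 , s)
    proof k atE r33 with red22 atE small ¬r23 r33
    -- A 3-3 cut and a 2-2 cut add (2, 0, 0). From α = -1 that would end at the costlier α = 1, so
    -- this case is left to `Hub`.
    proof (suc k) atE (edge da da′ aa′) | edge du dv uv = move atE (3 ∷ 3 ∷ 2 ∷ 2 ∷ []) (cut 0F 1F ∷ cut 2F 3F ∷ [])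
      (_ ∷ _ ∷ _ ∷ _ ∷ []) (da , da′ , du , dv , tt) (apart E red aa′ (λ ()) , apart E red uv (λ ()) , tt)
      (aa′ , uv , tt) (gain small neg+2′ stay)
    proof zero atE (edge da da′ aa′) | edge dy dv yv = by-edges
      where
      open Hub atE small ¬r23 da da′ aa′
      by-edges : Goal
      by-edges with edge? E red 1 2
      ... | yes r12 = with-red12 r12
      ... | no ¬r12 with edge? E blue 2 2 | edge? E blue 1 2
      ...   | yes b22 | _       = with-blue22 ¬r12 ¬3K4 dy b22
      ...   | no _    | yes b12 = with-blue12 ¬r12 ¬3K4 dy b12
      ...   | no ¬b22 | no ¬b12 with edge? E red 1 3
      ...     | yes r13 = with-red13 ¬r12 ¬3K4 dy ¬b22 ¬b12 r13
      ...     | no ¬r13 = finish ¬r12 ¬3K4 dy ¬b22 ¬b12 ¬r13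

-- The case α > 0, β = 0, with the exceptions K₄ and K₃,₃.

module PosZero {n} (𝒢 : CubicGraph n) where
  open NegZero 𝒢 public

  -- Absence of edges inside the parts is not recorded: it follows from the degrees, as does
  -- disjointness of the parts from the absence of loops.
  record K33 : Set where
    field
      a₀ a₁ a₂ b₀ b₁ b₂ : V
      a-distinct : AllPairs _≢_ (a₀ ∷ a₁ ∷ a₂ ∷ [])
      b-distinct : AllPairs _≢_ (b₀ ∷ b₁ ∷ b₂ ∷ [])
      complete   : All (λ a → All (λ b → adj a b ≡ true) (b₀ ∷ b₁ ∷ b₂ ∷ [])) (a₀ ∷ a₁ ∷ a₂ ∷ [])
      order      : n ≡ 6

  colour⇒adj : ∀ E {u v} κ → col E u v ≡ κ → κ ≢ none → adj u v ≡ true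
  colour⇒adj E {u} {v} κ uv κ≢none with adj u v
  ... | true  = refl
  ... | false = contradiction (sym uv) κ≢none

  order-sum : ∀ E → n ≡ (x E 0 + x E 2) + (x E 1 + x E 3)
  order-sum E = sym (begin
    (x E 0 + x E 2) + (x E 1 + x E 3)
      ≡⟨ cong₂ _+_ (sym (sum-+ (λ v → 𝟙 (d E v ≟ 0)) _)) (sym (sum-+ (λ v → 𝟙 (d E v ≟ 1)) _)) ⟩
    sum (λ v → 𝟙 (d E v ≟ 0) + 𝟙 (d E v ≟ 2)) + sum (λ v → 𝟙 (d E v ≟ 1) + 𝟙 (d E v ≟ 3))
      ≡⟨ sum-+ (λ v → 𝟙 (d E v ≟ 0) + 𝟙 (d E v ≟ 2)) _ ⟨
    sum (λ v → (𝟙 (d E v ≟ 0) + 𝟙 (d E v ≟ 2)) + (𝟙 (d E v ≟ 1) + 𝟙 (d E v ≟ 3)))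
      ≡⟨ sum-cong one-label ⟩
    sum (λ (_ : V) → 1) ≡⟨ sum-ones n ⟩
    n ∎)
    where
    open ≡-Reasoning
    one-label : ∀ v → (𝟙 (d E v ≟ 0) + 𝟙 (d E v ≟ 2)) + (𝟙 (d E v ≟ 1) + 𝟙 (d E v ≟ 3)) ≡ 1
    one-label v with label E v
    ... | zero dv  rewrite dv = refl
    ... | one dv   rewrite dv = refl
    ... | two dv   rewrite dv = refl
    ... | three dv rewrite dv = refl

  -- The order is 2t + 2h for t = x₀ = x₂ and h = (x₁ + x₃) / 2.
  data Size (t h : ℕ) : ℤ → Set where
    minus : t ≡ suc h → Size t h (neg 0)
    zero  : t ≡ h → Size t h (pos 0)
    plus  : suc t ≡ h → Size t h (pos 1)

  half-injective : ∀ {a b} → a + a ≡ b + b → a ≡ b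
  half-injective {a} {b} eq = *-cancelˡ-≡ a b 2
    (trans (cong (λ z → a + z) (+-identityʳ a)) (trans eq (cong (λ z → b + z) (sym (+-identityʳ b)))))

  only₁ : ∀ {E k u v} → x E k ≡ 1 → d E u ≡ k → d E v ≡ k → u ≡ v
  only₁ {E} {k} {u} {v} x≡1 du dv with u Fin.≟ v
  ... | yes u≡v = u≡v
  ... | no u≢v with subst (2 ≤_) x≡1 (crowd E (u ∷ v ∷ []) ((u≢v ∷ []) ∷ [] ∷ []) (du ∷ dv ∷ []))
  ...   | s≤s ()

  only₂ : ∀ {E k u v w} → x E k ≡ 2 → u ≢ v → d E u ≡ k → d E v ≡ k → d E w ≡ k → w ≢ u → w ≡ v
  only₂ {E} {k} {u} {v} {w} x≡2 u≢v du dv dw w≢u with w Fin.≟ v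
  ... | yes w≡v = w≡v
  ... | no w≢v with subst (3 ≤_) x≡2 (crowd E (u ∷ v ∷ w ∷ [])
          ((u≢v ∷ (w≢u ∘ sym) ∷ []) ∷ ((w≢v ∘ sym) ∷ []) ∷ [] ∷ []) (du ∷ dv ∷ dw ∷ []))
  ...   | s≤s (s≤s ())

  differ : ∀ {E : Colouring} {u v k l} → d E u ≡ k → d E v ≡ l → k ≢ l → u ≢ v
  differ du dv k≢l refl = k≢l (trans (sym du) dv)

  another : ∀ E {k} xs → length xs < x E k → ∃[ u ] d E u ≡ k × All (u ≢_) xs
  another E {k} = #-avoid (λ v → d E v ≟ k)

  module Rich {E k s} (atE : At E (pos (suc k) , pos 0 , s)) (small : Small s) (¬b12 : ¬ Edge E blue 1 2) where

    Goal : Set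
    Goal = Better (pos (suc k) , pos 0 , s)

    t h : ℕ
    t = x E 2
    h = x E 3 + suc k

    x0≡t : x E 0 ≡ t
    x0≡t = trans (β-pos atE) (+-identityʳ t)

    x1≡ : x E 1 ≡ h + suc k
    x1≡ = trans (α-pos atE) (sym (+-assoc (x E 3) (suc k) (suc k)))

    h<x1 : h < x E 1
    h<x1 = more-by x1≡

    0<h : 0 < h
    0<h = <-≤-trans (s≤s z≤n) (m≤n+m (suc k) (x E 3))

    odd-sum : x E 1 + x E 3 ≡ h + h
    odd-sum = trans (cong (λ z → z + x E 3) x1≡)
      (solve 2 (λ a b → ((a :+ b) :+ b) :+ a := (a :+ b) :+ (a :+ b)) refl (x E 3) (suc k))
      where
      open +-*-Solver

    even-sum : x E 0 + x E 2 ≡ t + t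
    even-sum = cong (λ z → z + t) x0≡t

    size : Size t h s
    size = by-sign small atE
      where
      two-more : ∀ m → suc m + suc m ≡ (m + m) + 2
      two-more = solve 1 (λ m → (con 1 :+ m) :+ (con 1 :+ m) := (m :+ m) :+ con 2) refl
        where
        open +-*-Solver
      by-sign : ∀ {s} → Small s → At E (pos (suc k) , pos 0 , s) → Size t h s
      by-sign zero  atE = zero (half-injective (trans (sym even-sum) (trans (sym (σ-zero atE)) odd-sum)))
      by-sign plus  atE = plus (half-injective (trans (two-more t)
        (trans (cong (λ z → z + 2) (sym even-sum)) (trans (sym (σ-plus atE)) odd-sum))))
      by-sign minus atE = minus (half-injective (trans (sym even-sum) (trans (σ-minus atE)
        (trans (cong (λ z → z + 2) odd-sum) (sym (two-more h))))))

    order : n ≡ (t + t) + (h + h)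
    order = trans (order-sum E) (cong₂ _+_ even-sum odd-sum)

    one-blue : ∀ {u v} → d E u ≡ 1 → col E u v ≡ blue → d E v ≡ 0 ⊎ d E v ≡ 1
    one-blue du uv with blue-label E uv
    ... | inj₁ dv        = inj₁ dv
    ... | inj₂ (inj₁ dv) = inj₂ dv
    ... | inj₂ (inj₂ dv) = contradiction (edge du dv uv) ¬b12

    module Blue22 (b22 : Edge E blue 2 2) where
      open Edge b22 using () renaming (u to z; v to z′; du to dz; dv to dz′; uv to zz′)

      z≢z′ : z ≢ z′
      z≢z′ = apart E blue zz′ (λ ())

      with-blue11 : Edge E blue 1 1 → Goal
      with-blue11 (edge {u} {v} du dv uv) = move atE (2 ∷ 2 ∷ 1 ∷ 1 ∷ []) (join 0F 1F ∷ join 2F 3F ∷ [])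
        (z ∷ z′ ∷ u ∷ v ∷ []) (dz , dz′ , du , dv , tt) (z≢z′ , apart E blue uv (λ ()) , tt) (zz′ , uv , tt)
        (gain small pos-2 stay)

      with-red13 : Edge E red 1 3 → Goal
      with-red13 (edge {u} {v} du dv uv) = move atE (2 ∷ 2 ∷ 1 ∷ 3 ∷ []) (join 0F 1F ∷ cut 2F 3F ∷ [])
        (z ∷ z′ ∷ u ∷ v ∷ []) (dz , dz′ , du , dv , tt) (z≢z′ , tt) (zz′ , uv , tt)
        (gain small pos-1 zero-1)

      -- The red edge at `y` turns from `u` to `w` while `y` keeps its degree, adding (-1, 1, 0).
      -- From β = 0 this saves 3 and costs 2.
      rotate : ∀ {u y w} → d E u ≡ 1 → d E y ≡ 2 → d E w ≡ 2 → col E u y ≡ red → col E y w ≡ blue → Goal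
      rotate {u} {y} {w} du dy dw uy yw = move atE (2 ∷ 2 ∷ 1 ∷ []) (join 0F 1F ∷ cut 2F 0F ∷ [])
        (y ∷ w ∷ u ∷ []) (dy , dw , du , tt) (apart E blue yw (λ ()) , tt) (yw , uy , tt) (gain small pos-1 zero-1)

      2≤t : 2 ≤ t
      2≤t = crowd E (z ∷ z′ ∷ []) ((z≢z′ ∷ []) ∷ [] ∷ []) (dz ∷ dz′ ∷ [])

      module _ (¬b11 : ¬ Edge E blue 1 1) (¬r13 : ¬ Edge E red 1 3) (t≤h : t ≤ h) where

        2<x1 : 2 < x E 1
        2<x1 = ≤-<-trans (≤-trans 2≤t t≤h) h<x1

        one-blue-zero : ∀ {u v} → d E u ≡ 1 → col E u v ≡ blue → d E v ≡ 0
        one-blue-zero du uv with one-blue du uv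
        ... | inj₁ dv = dv
        ... | inj₂ dv = contradiction (edge du dv uv) ¬b11

        with-red11 : Edge E red 1 1 → Goal
        with-red11 (edge {u} {v} du dv uv) with edge? E blue 0 2 | edge? E red 1 2
        ... | yes (edge dp dw pw) | _ = move atE (1 ∷ 1 ∷ 0 ∷ 2 ∷ []) (cut 0F 1F ∷ join 2F 3F ∷ [])
          (u ∷ v ∷ _ ∷ _ ∷ []) (du , dv , dp , dw , tt) (apart E red uv (λ ()) , tt) (uv , pw , tt)
            (gain small pos-1 zero-1)
        ... | no ¬b02 | yes (edge {r} {y} dr dy ry) with blue-next E dy []
        ...   | w , yw , _ with blue-label E yw
        ...     | inj₁ dw        = contradiction (edge dw dy (trans (col-sym E w y) yw)) ¬b02
        ...     | inj₂ (inj₁ dw) = contradiction (edge dw dy (trans (col-sym E w y) yw)) ¬b12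
        ...     | inj₂ (inj₂ dw) = rotate dr dy dw ry yw
        with-red11 (edge {u} {v} du dv uv) | no ¬b02 | no ¬r12 with another E (u ∷ v ∷ []) 2<x1
        ...   | r , dr , r≢u ∷ r≢v ∷ [] with red-next E dr [] | blue-next E dr []
        ...     | r′ , rr′ , _ | p , rp , _ = join-two (one-closed rr′)
          where
          one-closed : col E r r′ ≡ red → d E r′ ≡ 1
          one-closed rr′ with red-label E rr′
          ... | inj₁ dr′        = dr′
          ... | inj₂ (inj₁ dr′) = contradiction (edge dr dr′ rr′) ¬r12
          ... | inj₂ (inj₂ dr′) = contradiction (edge dr dr′ rr′) ¬r13
          join-two : d E r′ ≡ 1 → Goal
          join-two dr′ with blue-next E dr′ (p ∷ [])
          -- The 1-1 cut and the 2-2 join add (-2, 2, 0); the two 0-1 joins bring β back.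
          ... | p′ , rp′ , p′≢p ∷ [] = move atE (1 ∷ 1 ∷ 2 ∷ 2 ∷ 1 ∷ 0 ∷ 1 ∷ 0 ∷ [])
            (cut 0F 1F ∷ join 2F 3F ∷ join 4F 5F ∷ join 6F 7F ∷ []) (u ∷ v ∷ z ∷ z′ ∷ r ∷ p ∷ r′ ∷ p′ ∷ [])
            (du , dv , dz , dz′ , dr , one-blue-zero dr rp , dr′ , one-blue-zero dr′ rp′ , tt)
            (apart E red uv (λ ()) , r≢u ∘ sym , u≢r′ , r≢v ∘ sym , v≢r′ , z≢z′ , apart E red rr′ (λ ()) ,
              p′≢p ∘ sym , tt)
            (uv , zz′ , rp , rp′ , tt) (gain small pos-2 stay)
            where
            u≢r′ : u ≢ r′
            u≢r′ refl = r≢v (red-unique E du (trans (col-sym E u r) rr′) uv)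
            v≢r′ : v ≢ r′
            v≢r′ refl = r≢u (red-unique E dv (trans (col-sym E v r) rr′) (trans (col-sym E v u) uv))

        crowded : 1 * x E 0 < e E blue 0 1
        crowded = begin-strict
          1 * x E 0                                    ≡⟨ trans (*-identityˡ (x E 0)) x0≡t ⟩
          t                                            ≤⟨ t≤h ⟩
          h                                            <⟨ h<x1 ⟩
          x E 1                                        ≤⟨ m≤m+n (x E 1) _ ⟩
          2 * x E 1                                    ≡⟨ blue-row E 1 ⟩
          e E blue 1 0 + (e E blue 1 1 + e E blue 1 2)
            ≡⟨ cong₂ (λ a b → e E blue 1 0 + (a + b)) (e-none E ¬b11) (e-none E ¬b12) ⟩
          e E blue 1 0 + 0                             ≡⟨ trans (+-identityʳ _) (e-sym E blue 1 0) ⟩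
          e E blue 0 1 ∎
          where
          open ≤-Reasoning

        without-red11 : ¬ Edge E red 1 1 → Goal
        without-red11 ¬r11 with pigeon E 1 crowded
        ... | p , dp , 1<N with two-nbrs E 1<N
        ...   | r , r′ , r≢r′ , (dr , pr) , (dr′ , pr′) with another E (r ∷ r′ ∷ []) 2<x1
        ...     | u , du , u≢r ∷ u≢r′ ∷ [] with red-next E du []
        ...       | y , uy , _ with red-label E uy
        ...         | inj₁ dy        = contradiction (edge du dy uy) ¬r11
        ...         | inj₂ (inj₂ dy) = contradiction (edge du dy uy) ¬r13
        ...         | inj₂ (inj₁ dy) with blue-next E dy []
        ...           | w , yw , _ with blue-label E yw
        ...             | inj₂ (inj₁ dw) = contradiction (edge dw dy (trans (col-sym E w y) yw)) ¬b12
        ...             | inj₂ (inj₂ dw) = rotate du dy dw uy yw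
        -- The two joins at `p` add (0, -1, 0) and, `p` then having degree 1, (-1, -1, -2). The 2-2
        -- join and the 1-2 cut complete the sum to (-2, 0, 0).
        ...             | inj₁ dw = move atE (0 ∷ 1 ∷ 1 ∷ 2 ∷ 2 ∷ 1 ∷ 2 ∷ [])
          (join 0F 1F ∷ join 0F 2F ∷ join 3F 4F ∷ cut 5F 6F ∷ []) (p ∷ r ∷ r′ ∷ z ∷ z′ ∷ u ∷ y ∷ [])
          (dp , dr , dr′ , dz , dz′ , du , dy , tt)
          (r≢r′ , u≢r ∘ sym , u≢r′ ∘ sym , z≢z′ , z≢y , z′≢y , tt) (pr , pr′ , zz′ , uy , tt) (gain small pos-2 stay)
          where
          0≢2 : ∀ {v} → d E v ≡ 0 → d E v ≢ 2
          0≢2 d0 d2 with trans (sym d0) d2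
          ... | ()
          z≢y : z ≢ y
          z≢y refl = 0≢2 (subst (λ v → d E v ≡ 0) (blue-unique E dz yw zz′) dw) dz′
          z′≢y : z′ ≢ y
          z′≢y refl = 0≢2 (subst (λ v → d E v ≡ 0) (blue-unique E dz′ yw (trans (col-sym E z′ z) zz′)) dw) dz

      -- Joining `z z′` adds (-1, 1, 2). At σ = -1 this suffices, since lowering α saves 3 and
      -- raising β from 0 costs 2. For t ≤ h, that is σ ≥ 0, another toggle has to lower σ in
      -- return.
      blue22-move : Goal
      blue22-move with edge? E blue 1 1 | edge? E red 1 3
      ... | yes b11 | _       = with-blue11 b11
      ... | no _    | yes r13 = with-red13 r13
      ... | no ¬b11 | no ¬r13 = by-size size refl
        where
        balanced-or-plus : t ≤ h → Goal
        balanced-or-plus t≤h with edge? E red 1 1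
        ... | yes r11 = with-red11 ¬b11 ¬r13 t≤h r11
        ... | no ¬r11 = without-red11 ¬b11 ¬r13 t≤h ¬r11
        by-size : ∀ {s′} → Size t h s′ → s′ ≡ s → Goal
        by-size (zero t≡h)  _   = balanced-or-plus (≤-reflexive t≡h)
        by-size (plus t+1≡h) _  = balanced-or-plus (≤-trans (n≤1+n t) (≤-reflexive t+1≡h))
        by-size (minus _)   eq = move atE (2 ∷ 2 ∷ []) (join 0F 1F ∷ []) (z ∷ z′ ∷ []) (dz , dz′ , tt) (z≢z′ , tt)
          (zz′ , tt)
          (gain′ (subst (λ s → Small (s ℤ.+ pos 2)) eq plus) pos-1 zero-1)

    module NoBlue22 (¬b22 : ¬ Edge E blue 2 2) (n≢4 : n ≢ 4) (¬K33 : ¬ K33) where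

      two-blue : ∀ {w p} → d E w ≡ 2 → col E w p ≡ blue → d E p ≡ 0
      two-blue {w} {p} dw wp with blue-label E wp
      ... | inj₁ dp        = dp
      ... | inj₂ (inj₁ dp) = contradiction (edge dp dw (trans (col-sym E p w) wp)) ¬b12
      ... | inj₂ (inj₂ dp) = contradiction (edge dw dp wp) ¬b22

      -- With D₀ and D₂ empty, the bound on σ forces x₁ = 2, yet a vertex of D₁ has two blue
      -- neighbours and they would also lie in D₁.
      t≡0⇒⊥ : t ≢ 0
      t≡0⇒⊥ t≡0 with another E [] (≤-<-trans z≤n h<x1)
      ... | u , du , _ with blue-next E du []
      ...   | v , uv , _ with blue-next E du (v ∷ [])
      ...     | w , uw , w≢v ∷ [] = <⇒≱ (s≤s (≤-reflexive x1≡2)) (crowd E (u ∷ v ∷ w ∷ [])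
        ((apart E blue uv (λ ()) ∷ apart E blue uw (λ ()) ∷ []) ∷ ((w≢v ∘ sym) ∷ []) ∷ [] ∷ [])
        (du ∷ stays uv ∷ stays uw ∷ []))
        where
        stays : ∀ {v} → col E u v ≡ blue → d E v ≡ 1
        stays uv with one-blue du uv
        ... | inj₂ dv = dv
        ... | inj₁ dv = contradiction dv (x≡0⇒⊥ {E} (trans x0≡t t≡0))
        by-size : ∀ {s} → Size t h s → h ≡ 1
        by-size (zero t≡h)   = contradiction (trans (sym t≡0) t≡h) (<⇒≢ 0<h)
        by-size (minus t≡)   = contradiction (trans (sym t≡0) t≡) λ ()
        by-size (plus t+1≡h) = trans (sym t+1≡h) (cong suc t≡0)
        k≡0 : k ≡ 0
        k≡0 = n≤0⇒n≡0 (s≤s⁻¹ (≤-trans (m≤n+m (suc k) (x E 3)) (≤-reflexive (by-size size))))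
        x1≡2 : x E 1 ≡ 2
        x1≡2 = trans x1≡ (cong₂ _+_ (by-size size) (cong suc k≡0))

      0<t : 0 < t
      0<t = n≢0⇒n>0 t≡0⇒⊥

      with-red11 : Edge E red 1 1 → Goal
      with-red11 (edge {u} {v} du dv uv) with inhabited E 0<t
      ... | w , dw with blue-next E dw []
      ...   | p , wp , _ = move atE (1 ∷ 1 ∷ 2 ∷ 0 ∷ []) (cut 0F 1F ∷ join 2F 3F ∷ []) (u ∷ v ∷ w ∷ p ∷ [])
        (du , dv , dw , two-blue dw wp , tt) (apart E red uv (λ ()) , tt) (uv , wp , tt) (gain small pos-1 zero-1)

      -- The two ways to afford a change of (-1, 0, 2): a 1-3 cut takes the 2 back, or σ can rise
      -- from -1 to 1.
      Tilt : Set
      Tilt = Edge E red 1 3 ⊎ s ≡ neg 0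

      double-target : Tilt → ∀ {p w w′} → d E p ≡ 0 → d E w ≡ 2 → d E w′ ≡ 2 → col E p w ≡ blue → col E p w′ ≡ blue →
        w ≢ w′ → Goal
      double-target (inj₁ (edge du dv uv)) dp dw dw′ pw pw′ w≢w′ = move atE (0 ∷ 2 ∷ 2 ∷ 1 ∷ 3 ∷ [])
        (join 0F 1F ∷ join 0F 2F ∷ cut 3F 4F ∷ []) (_ ∷ _ ∷ _ ∷ _ ∷ _ ∷ []) (dp , dw , dw′ , du , dv , tt)
        (w≢w′ , tt) (pw , pw′ , uv , tt) (gain small pos-1 stay)
      double-target (inj₂ s≡) dp dw dw′ pw pw′ w≢w′ = move atE (0 ∷ 2 ∷ 2 ∷ [])
        (join 0F 1F ∷ join 0F 2F ∷ []) (_ ∷ _ ∷ _ ∷ []) (dp , dw , dw′ , tt)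
        (w≢w′ , tt) (pw , pw′ , tt) (gain′ (subst (λ s → Small (s ℤ.+ pos 2)) (sym s≡) plus) pos-1 stay)

      Matched : Set
      Matched = ∀ {p} → d E p ≡ 0 → ∃[ w ] d E w ≡ 2 × col E p w ≡ blue

      -- D₂ sends exactly x₂ = x₀ blue edges into D₀. Either some vertex of D₀ receives two of them,
      -- or each receives exactly one.
      match : Tilt → Goal ⊎ Matched
      match tilt with Fin.any? (λ p → (d E p ≟ 0) ×-dec (1 <? N E blue 2 p))
      ... | yes (p , dp , 1<N) with two-nbrs E 1<N
      ...   | w , w′ , w≢w′ , (dw , pw) , (dw′ , pw′) = inj₁ (double-target tilt dp dw dw′ pw pw′ w≢w′)
      match tilt | no none-doubled = inj₂ λ {p} dp → found (subst (1 ≤_) (trans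
          (cong (λ z → z * N E blue 2 p) (𝟙-yes (d E p ≟ 0) dp)) (*-identityˡ (N E blue 2 p)))
        (subst (_≤ 𝟙 (d E p ≟ 0) * N E blue 2 p) (𝟙-yes (d E p ≟ 0) dp) (tight p)))
        where
        found : ∀ {p} → 1 ≤ N E blue 2 p → ∃[ w ] d E w ≡ 2 × col E p w ≡ blue
        found {p} 0<N with #-avoid (λ v → (col E p v ≟ᶜ blue) ×-dec (d E v ≟ 2)) [] 0<N
        ... | w , (pw , dw) , _ = w , dw , pw
        total : sum (λ p → 𝟙 (d E p ≟ 0)) ≤ e E blue 0 2
        total = ≤-reflexive (begin
          x E 0                                        ≡⟨ trans x0≡t (sym (*-identityˡ (x E 2))) ⟩
          1 * x E 2                                    ≡⟨ blue-row E 2 ⟩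
          e E blue 2 0 + (e E blue 2 1 + e E blue 2 2)
            ≡⟨ cong₂ (λ a b → e E blue 2 0 + (a + b)) (e-none E (¬b12 ∘ reverse E)) (e-none E ¬b22) ⟩
          e E blue 2 0 + 0                             ≡⟨ trans (+-identityʳ _) (e-sym E blue 2 0) ⟩
          e E blue 0 2 ∎)
          where
          open ≡-Reasoning
        weigh : {P : Set} (P? : Dec P) {m : ℕ} → (P → m ≤ 1) → 𝟙 P? * m ≤ 𝟙 P?
        weigh (yes p) m≤1 = ≤-trans (≤-reflexive (+-identityʳ _)) (m≤1 p)
        weigh (no _)  m≤1 = z≤n
        tight : ∀ p → 𝟙 (d E p ≟ 0) ≤ 𝟙 (d E p ≟ 0) * N E blue 2 p
        tight = sum-squeeze (λ p → weigh (d E p ≟ 0) λ dp → ≮⇒≥ λ 1<N → none-doubled (p , dp , 1<N)) total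

      -- The joins at `r` add (-1, -1, -2) and then (-1, 0, 0), as `r` has degree 2 by then; the 2-2
      -- cut adds (1, 1, 2).
      via-path-22 : ∀ {r q q′ y y′} → d E r ≡ 1 → d E q ≡ 1 → d E q′ ≡ 1 → q ≢ q′ → col E r q ≡ blue →
        col E r q′ ≡ blue →
        d E y ≡ 2 → d E y′ ≡ 2 → col E y y′ ≡ red → Goal
      via-path-22 dr dq dq′ q≢q′ rq rq′ dy dy′ yy′ = move atE (1 ∷ 1 ∷ 1 ∷ 2 ∷ 2 ∷ [])
        (join 0F 1F ∷ join 0F 2F ∷ cut 3F 4F ∷ []) (_ ∷ _ ∷ _ ∷ _ ∷ _ ∷ []) (dr , dq , dq′ , dy , dy′ , tt)
        (apart E blue rq (λ ()) , apart E blue rq′ (λ ()) , q≢q′ , apart E red yy′ (λ ()) , tt)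
        (rq , rq′ , yy′ , tt) (gain small pos-1 stay)

      -- `p` climbs from 0 to 2: its joins add (0, -1, 0) and then (-1, 0, 0). The 1-2 cut restores
      -- β.
      fork : ∀ {p r w u y} → d E p ≡ 0 → d E r ≡ 1 → d E w ≡ 2 → col E p r ≡ blue → col E p w ≡ blue →
        d E u ≡ 1 → d E y ≡ 2 → col E u y ≡ red → r ≢ u → w ≢ y → Goal
      fork dp dr dw pr pw du dy uy r≢u w≢y = move atE (0 ∷ 1 ∷ 2 ∷ 1 ∷ 2 ∷ [])
        (join 0F 1F ∷ join 0F 2F ∷ cut 3F 4F ∷ []) (_ ∷ _ ∷ _ ∷ _ ∷ _ ∷ []) (dp , dr , dw , du , dy , tt)
        (r≢u , w≢y , tt) (pr , pw , uy , tt) (gain small pos-1 stay)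

      h≤t+1 : h ≤ suc t
      h≤t+1 = by-size size
        where
        by-size : ∀ {s} → Size t h s → h ≤ suc t
        by-size (zero eq)   = ≤-trans (≤-reflexive (sym eq)) (n≤1+n t)
        by-size (minus eq)  = ≤-trans (n≤1+n h) (≤-trans (≤-reflexive (sym eq)) (n≤1+n t))
        by-size (plus eq)   = ≤-reflexive (sym eq)

      module _ (¬r11 : ¬ Edge E red 1 1) where

        module _ (¬r12 : ¬ Edge E red 1 2) where

          e13 : x E 1 ≡ e E red 1 3
          e13 = trans (sym (*-identityˡ (x E 1))) (trans (red-row E 1)
            (cong₂ (λ a b → a + (b + e E red 1 3)) (e-none E ¬r11) (e-none E ¬r12)))

          crowded : 1 * x E 3 < e E red 3 1
          crowded = subst₂ _<_ (sym (*-identityˡ (x E 3))) (trans e13 (e-sym E red 1 3))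
            (≤-<-trans (m≤m+n (x E 3) (suc k)) h<x1)

          -- Otherwise all red edges of D₁ and D₂ end in D₃, so x₁ + 2t ≤ 3x₃. But x₁ = x₃ + 2(k +
          -- 1) and t ≥ h - 1 = x₃ + k make the left side at least 3x₃ + 4k + 2.
          red22-edge : Edge E red 2 2
          red22-edge with edge? E red 2 2
          ... | yes r22 = r22
          ... | no ¬r22 = contradiction big (<⇒≱ (begin-strict
            3 * x E 3 + 2
              ≡⟨ cong (λ z → z + 2) (solve 1 (λ a → con 3 :* a := a :+ con 2 :* a) refl (x E 3)) ⟩
            (x E 3 + 2 * x E 3) + 2                   <⟨ +-monoʳ-< (x E 3 + 2 * x E 3) (s≤s (s≤s (s≤s z≤n))) ⟩
            (x E 3 + 2 * x E 3) + 4                   ≤⟨ +-monoʳ-≤ (x E 3 + 2 * x E 3) (m≤m+n 4 (4 * k)) ⟩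
            (x E 3 + 2 * x E 3) + (4 + 4 * k)         ≡⟨ solve 2 (λ a k → (a :+ con 2 :* a) :+ (con 4 :+ con 4 :* k)
                                                           := ((a :+ (con 1 :+ k)) :+ (con 1 :+ k)) :+ con 2 :*
                                                             (a :+ (con 1 :+ k))) refl (x E 3) k ⟩
            (h + suc k) + 2 * h ∎))
            where
            open ≤-Reasoning
            open +-*-Solver
            big : (h + suc k) + 2 * h ≤ 3 * x E 3 + 2
            big = begin
              (h + suc k) + 2 * h                              ≤⟨ +-monoʳ-≤ (h + suc k) (*-monoʳ-≤ 2 h≤t+1) ⟩
              (h + suc k) + 2 * suc t
                ≡⟨ solve 2 (λ a t → a :+ con 2 :* (con 1 :+ t) := (a :+ con 2 :* t) :+ con 2) refl (h + suc k) t ⟩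
              ((h + suc k) + 2 * t) + 2                        ≡⟨ cong (λ z → (z + 2 * t) + 2) (sym x1≡) ⟩
              (x E 1 + 2 * t) + 2
                ≡⟨ cong₂ (λ a b → (a + b) + 2) (trans e13 (e-sym E red 1 3)) (red-row E 2) ⟩
              (e E red 3 1 + (e E red 2 1 + (e E red 2 2 + e E red 2 3))) + 2
                ≡⟨ cong₂ (λ a b → (e E red 3 1 + (a + (b + e E red 2 3))) + 2) (e-none E (¬r12 ∘ reverse E))
                  (e-none E ¬r22) ⟩
              (e E red 3 1 + e E red 2 3) + 2
                ≡⟨ cong (λ z → (e E red 3 1 + z) + 2) (e-sym E red 2 3) ⟩
              (e E red 3 1 + e E red 3 2) + 2
                ≤⟨ +-monoˡ-≤ 2 (+-monoʳ-≤ (e E red 3 1) (m≤m+n _ (e E red 3 3))) ⟩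
              (e E red 3 1 + (e E red 3 2 + e E red 3 3)) + 2  ≡⟨ cong (λ z → z + 2) (red-row E 3) ⟨
              3 * x E 3 + 2 ∎

          without-red12 : Goal
          without-red12 with red22-edge | pigeon E 1 crowded
          ... | edge {y} {y′} dy dy′ yy′ | a , da , 1<N with two-nbrs E 1<N
          ...   | u , u′ , u≢u′ , (du , au) ,
            (du′ , au′) = from-match (match (inj₁ (edge du da (trans (col-sym E u a) au))))
            where
            2<x1 : 2 < x E 1
            2<x1 = ≤-<-trans (+-mono-≤ (crowd E (a ∷ []) ([] ∷ []) (da ∷ [])) (s≤s z≤n)) h<x1
            2≤t : 2 ≤ t
            2≤t = crowd E (y ∷ y′ ∷ []) ((apart E red yy′ (λ ()) ∷ []) ∷ [] ∷ []) (dy ∷ dy′ ∷ [])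
            module _ (matched : Matched) {r} (dr : d E r ≡ 1) (r≢u : r ≢ u) (r≢u′ : r ≢ u′) where
              to-zero : ∀ {q} → d E q ≡ 0 → col E r q ≡ blue → Goal
              to-zero {q} dq rq with matched dq
              ... | w′ , dw′ , qw′ with another E (w′ ∷ []) 2≤t
              ...   | w , dw , w≢w′ ∷ [] with blue-next E dw []
              ...     | p , wp , _ with p Fin.≟ q
              ...       | yes refl = double-target (inj₁ (edge du da (trans (col-sym E u a) au))) dq dw dw′
                (trans (col-sym E p w) wp) qw′ w≢w′
              -- The two cuts at `a` add (0, 0, -2) and (0, 1, 0), the join `w p` adds (0, 0, 2),
              -- and the joins at `q` add (0, -1, 0) and (-1, 0, 0).
              ...       | no p≢q = move atE (3 ∷ 1 ∷ 1 ∷ 2 ∷ 0 ∷ 0 ∷ 1 ∷ 2 ∷ [])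
                (cut 0F 1F ∷ cut 0F 2F ∷ join 3F 4F ∷ join 5F 6F ∷ join 5F 7F ∷ [])
                (a ∷ u ∷ u′ ∷ w ∷ p ∷ q ∷ r ∷ w′ ∷ [])
                (da , du , du′ , dw , two-blue dw wp , dq , dr , dw′ , tt)
                (u≢u′ , r≢u ∘ sym , r≢u′ ∘ sym , w≢w′ , p≢q , tt)
                (au , au′ , wp , trans (col-sym E q r) rq , qw′ , tt) (gain small pos-1 stay)
            from-match : Goal ⊎ Matched → Goal
            from-match (inj₁ goal)    = goal
            from-match (inj₂ matched) with another E (u ∷ u′ ∷ []) 2<x1
            ... | r , dr , r≢u ∷ r≢u′ ∷ [] with blue-next E dr []
            ...   | q , rq , _ with blue-next E dr (q ∷ [])
            ...     | q′ , rq′ , q′≢q ∷ [] with one-blue dr rq | one-blue dr rq′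
            ...       | inj₂ dq | inj₂ dq′ = via-path-22 dr dq dq′ (q′≢q ∘ sym) rq rq′ dy dy′ yy′
            ...       | inj₁ dq | _        = to-zero matched dr r≢u r≢u′ dq rq
            ...       | inj₂ _  | inj₁ dq′ = to-zero matched dr r≢u r≢u′ dq′ rq′

        one-red : ∀ {u v} → d E u ≡ 1 → col E u v ≡ red → d E v ≡ 2 ⊎ d E v ≡ 3
        one-red du uv with red-label E uv
        ... | inj₁ dv        = contradiction (edge du dv uv) ¬r11
        ... | inj₂ (inj₁ dv) = inj₁ dv
        ... | inj₂ (inj₂ dv) = inj₂ dv

        -- At σ = 0 a single vertex in D₂ would mean t = h = 1, so n = 4: this is where K₄ stands in
        -- the way. At σ = -1, t = h + 1 is at least 2.
        spare : ∀ y → (∃[ w ] d E w ≡ 2 × w ≢ y) ⊎ s ≡ pos 1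
        spare y = by-size size refl
          where
          beyond : 1 < t → (∃[ w ] d E w ≡ 2 × w ≢ y) ⊎ s ≡ pos 1
          beyond 1<t with another E (y ∷ []) 1<t
          ... | w , dw , w≢y ∷ [] = inj₁ (w , dw , w≢y)
          by-size : ∀ {s′} → Size t h s′ → s′ ≡ s → (∃[ w ] d E w ≡ 2 × w ≢ y) ⊎ s ≡ pos 1
          by-size (plus _)     eq = inj₂ (sym eq)
          by-size (minus t≡)   _  = beyond (≤-trans (s≤s 0<h) (≤-reflexive (sym t≡)))
          by-size (zero t≡h)   _  with t ≟ 1
          ... | no t≢1  = beyond (≤∧≢⇒< 0<t (t≢1 ∘ sym))
          ... | yes t≡1 = contradiction (trans order (cong₂ (λ a b → (a + a) + (b + b)) t≡1 (trans (sym t≡h) t≡1)))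
            n≢4

        -- A 1-1 join and a 1-2 cut add (-1, 0, -2). At σ = 1 that is affordable; otherwise a 0-2
        -- join at a vertex of D₂ other than `y` returns the 2.
        touch : ∀ {u v x y} → d E u ≡ 1 → d E v ≡ 1 → col E u v ≡ blue → d E x ≡ 1 → d E y ≡ 2 → col E x y ≡ red →
          x ≢ u → x ≢ v → Goal
        touch {u} {v} {x} {y} du dv uv dx dy xy x≢u x≢v with spare y
        ... | inj₂ s≡ = move atE (1 ∷ 1 ∷ 1 ∷ 2 ∷ []) (join 0F 1F ∷ cut 2F 3F ∷ []) (u ∷ v ∷ x ∷ y ∷ [])
          (du , dv , dx , dy , tt) (apart E blue uv (λ ()) , x≢u ∘ sym , x≢v ∘ sym , tt) (uv , xy , tt)
          (gain′ (subst (λ s → Small (s ℤ.+ neg 1)) (sym s≡) minus) pos-1 stay)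
        ... | inj₁ (w , dw , w≢y) with blue-next E dw []
        ...   | p , wp , _ = move atE (1 ∷ 1 ∷ 2 ∷ 0 ∷ 1 ∷ 2 ∷ []) (join 0F 1F ∷ join 2F 3F ∷ cut 4F 5F ∷ [])
          (u ∷ v ∷ w ∷ p ∷ x ∷ y ∷ []) (du , dv , dw , two-blue dw wp , dx , dy , tt)
          (apart E blue uv (λ ()) , x≢u ∘ sym , x≢v ∘ sym , w≢y , tt) (uv , wp , xy , tt) (gain small pos-1 stay)

        module Red12 {c y} (dc : d E c ≡ 1) (dy : d E y ≡ 2) (cy : col E c y ≡ red) where

          -- Every blue edge within D₁ may be assumed to meet c.
          zero-or-c : ∀ {r q} → d E r ≡ 1 → r ≢ c → col E r q ≡ blue → Goal ⊎ d E q ≡ 0 ⊎ q ≡ c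
          zero-or-c {r} {q} dr r≢c rq with one-blue dr rq | q Fin.≟ c
          ... | inj₁ dq | _       = inj₂ (inj₁ dq)
          ... | inj₂ dq | yes q≡c = inj₂ (inj₂ q≡c)
          ... | inj₂ dq | no q≢c  = inj₁ (touch dr dq rq dc dy cy (r≢c ∘ sym) (q≢c ∘ sym))

          module Far {r} (dr : d E r ≡ 1) (r≢c : r ≢ c) (¬rc : col E r c ≢ blue) where

            -- D₀ has 3t blue ends and receives 2x₁ edges from D₁ and t from D₂, so h < x₁ ≤ t,
            -- which leaves only σ = -1.
            minus-case : ¬ Edge E red 1 3 → ¬ Edge E blue 1 1 → s ≡ neg 0
            minus-case ¬r13 ¬b11 = by-size size refl
              where
              x1≤t : x E 1 ≤ t
              x1≤t = *-cancelˡ-≤ 2 (+-cancelʳ-≤ t _ _ (begin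
                2 * x E 1 + t
                  ≡⟨ cong₂ _+_ (blue-row E 1) (trans (sym (*-identityˡ t)) (blue-row E 2)) ⟩
                (e E blue 1 0 + (e E blue 1 1 + e E blue 1 2)) + (e E blue 2 0 + (e E blue 2 1 + e E blue 2 2))
                  ≡⟨ cong₂ _+_ (cong₂ (λ a b → e E blue 1 0 + (a + b)) (e-none E ¬b11) (e-none E ¬b12))
                               (cong₂ (λ a b → e E blue 2 0 + (a + b)) (e-none E (¬b12 ∘ reverse E))
                                 (e-none E ¬b22)) ⟩
                (e E blue 1 0 + 0) + (e E blue 2 0 + 0)
                  ≡⟨ cong₂ _+_ (trans (+-identityʳ _) (e-sym E blue 1 0)) (trans (+-identityʳ _) (e-sym E blue 2 0)) ⟩
                e E blue 0 1 + e E blue 0 2     ≤⟨ m≤n+m _ (e E blue 0 0) ⟩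
                e E blue 0 0 + (e E blue 0 1 + e E blue 0 2) ≡⟨ blue-row E 0 ⟨
                3 * x E 0                       ≡⟨ cong (3 *_) x0≡t ⟩
                3 * t                           ≡⟨ solve 1 (λ t → con 3 :* t := con 2 :* t :+ t) refl t ⟩
                2 * t + t ∎))
                where
                open ≤-Reasoning
                open +-*-Solver
              by-size : ∀ {s′} → Size t h s′ → s′ ≡ s → s ≡ neg 0
              by-size (minus _)   eq = sym eq
              by-size (zero t≡h)  _  = contradiction x1≤t (<⇒≱ (subst (_< x E 1) (sym t≡h) h<x1))
              by-size (plus t+1≡h) _ = contradiction x1≤t (<⇒≱ (<-trans (≤-reflexive t+1≡h) h<x1))

            -- Without a red 1-3 edge, both `c` and `r` have their red neighbour in D₂. A blue 1-1
            -- edge avoiding either of them allows `touch`, and one meeting both would be the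
            -- excluded blue edge `r c`.
            tilt : Goal ⊎ Tilt
            tilt with edge? E red 1 3
            ... | yes r13 = inj₂ (inj₁ r13)
            ... | no ¬r13 with edge? E blue 1 1
            ...   | no ¬b11 = inj₂ (inj₂ (minus-case ¬r13 ¬b11))
            ...   | yes (edge {u} {v} du dv uv) with red-next E dr []
            ...     | y′ , ry′ , _ with one-red dr ry′
            ...       | inj₂ dy′ = contradiction (edge dr dy′ ry′) ¬r13
            ...       | inj₁ dy′ with c Fin.≟ u | c Fin.≟ v | r Fin.≟ u | r Fin.≟ v
            ...         | no c≢u | no c≢v | _ | _ = inj₁ (touch du dv uv dc dy cy c≢u c≢v)
            ...         | _ | _ | no r≢u | no r≢v = inj₁ (touch du dv uv dr dy′ ry′ r≢u r≢v)
            ...         | yes refl | _ | yes refl | _ = contradiction refl r≢c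
            ...         | yes refl | _ | _ | yes refl = contradiction (trans (col-sym E v u) uv) ¬rc
            ...         | _ | yes refl | yes refl | _ = contradiction uv ¬rc
            ...         | _ | yes refl | _ | yes refl = contradiction refl r≢c

            from-match : Goal ⊎ Matched → Goal
            from-match (inj₁ goal)    = goal
            from-match (inj₂ matched) with blue-next E dr []
            ... | p , rp , _ with blue-next E dr (p ∷ [])
            ...   | p′ , rp′ , p′≢p ∷ [] with zero-or-c dr r≢c rp | zero-or-c dr r≢c rp′
            ...     | inj₁ goal | _         = goal
            ...     | inj₂ _    | inj₁ goal = goal
            ...     | inj₂ (inj₂ refl) | _  = contradiction rp ¬rc
            ...     | inj₂ (inj₁ _) | inj₂ (inj₂ refl) = contradiction rp′ ¬rc
            ...     | inj₂ (inj₁ dp) | inj₂ (inj₁ dp′) with matched dp | matched dp′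
            ...       | w , dw , pw | w′ , dw′ , pw′ with w Fin.≟ y | w′ Fin.≟ y
            ...         | no w≢y | _ = fork dp dr dw (trans (col-sym E p r) rp) pw dc dy cy r≢c w≢y
            ...         | _ | no w′≢y = fork dp′ dr dw′ (trans (col-sym E p′ r) rp′) pw′ dc dy cy r≢c w′≢y
            ...         | yes refl | yes refl = contradiction
              (blue-unique E dy (trans (col-sym E y p′) pw′) (trans (col-sym E y p) pw)) p′≢p

            far : Goal
            far with tilt
            ... | inj₁ goal = goal
            ... | inj₂ tilted = from-match (match tilted)

          module Star (near : ∀ {r} → d E r ≡ 1 → r ≢ c → col E c r ≡ blue) where

            module Three {v v′} (dv : d E v ≡ 1) (v≢c : v ≢ c) (dv′ : d E v′ ≡ 1) (v′≢c : v′ ≢ c) (v≢v′ : v ≢ v′)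
                         (¬r22 : ¬ Edge E red 2 2) where

              touch-c : ∀ {u w} → d E u ≡ 1 → u ≢ c → d E w ≡ 2 → col E u w ≡ red → Goal
              touch-c {u} du u≢c dw uw with u Fin.≟ v
              ... | no u≢v   = touch dc dv (near dv v≢c) du dw uw u≢c u≢v
              ... | yes refl = touch dc dv′ (near dv′ v′≢c) du dw uw u≢c v≢v′

              red-three : ∀ {u} → d E u ≡ 1 → u ≢ c → Goal ⊎ ∃[ b ] d E b ≡ 3 × col E u b ≡ red
              red-three du u≢c with red-next E du []
              ... | b , ub , _ with one-red du ub
              ...   | inj₁ db = inj₁ (touch-c du u≢c db ub)
              ...   | inj₂ db = inj₂ (b , db , ub)

              red-of-two : ∀ {w b} → d E w ≡ 2 → col E w b ≡ red → b ≢ c → Goal ⊎ d E b ≡ 3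
              red-of-two {w} {b} dw wb b≢c with red-label E wb
              ... | inj₁ db        = inj₁ (touch-c db b≢c dw (trans (col-sym E b w) wb))
              ... | inj₂ (inj₁ db) = contradiction (edge dw db wb) ¬r22
              ... | inj₂ (inj₂ db) = inj₂ db

              x1≡3 : x E 1 ≡ 3
              x1≡3 = ≤-antisym (≮⇒≥ four)
                (crowd E (c ∷ v ∷ v′ ∷ []) ((v≢c ∘ sym ∷ v′≢c ∘ sym ∷ []) ∷ (v≢v′ ∷ []) ∷ [] ∷ [])
                  (dc ∷ dv ∷ dv′ ∷ []))
                where
                four : ¬ 3 < x E 1
                four 3<x1 with another E (c ∷ v ∷ v′ ∷ []) 3<x1
                ... | u , du , u≢c ∷ u≢v ∷ u≢v′ ∷ [] with subst (λ m → 3 + m ≤ 3) dc (blue-bound E c (u ∷ v ∷ v′ ∷ [])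
                        ((u≢v ∷ u≢v′ ∷ []) ∷ (v≢v′ ∷ []) ∷ [] ∷ []) (near du u≢c ∷ near dv v≢c ∷ near dv′ v′≢c ∷ []))
                ...   | s≤s (s≤s (s≤s ()))

              module _ {b} (db : d E b ≡ 3) (vb : col E v b ≡ red) where

                x3≡1 : x E 3 ≡ 1
                x3≡1 = ≤-antisym (+-cancelʳ-≤ 2 _ _ (≤-trans (+-monoʳ-≤ (x E 3) (+-mono-≤ (s≤s z≤n) (s≤s z≤n)))
                  (≤-reflexive (trans (sym (α-pos atE)) x1≡3)))) (crowd E (b ∷ []) ([] ∷ []) (db ∷ []))

                is-b : ∀ {b′} → d E b′ ≡ 3 → b′ ≡ b
                is-b db′ = only₁ {E} x3≡1 db′ db

                -- The only red neighbour of `c` is `y`, so both red neighbours of `w` avoid `c`.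
                -- Unless a script applies they lie in D₃, which contains just `b`.
                second-two : ∀ {w} → d E w ≡ 2 → w ≢ y → Goal
                second-two {w} dw w≢y with red-next E dw []
                ... | b₁ , wb₁ , _ with red-next E dw (b₁ ∷ [])
                ...   | b₂ , wb₂ , b₂≢b₁ ∷ [] with red-of-two dw wb₁ (not-c wb₁) | red-of-two dw wb₂ (not-c wb₂)
                  where
                  not-c : ∀ {b} → col E w b ≡ red → b ≢ c
                  not-c wb refl = w≢y (red-unique E dc (trans (col-sym E c w) wb) cy)
                ...     | inj₁ goal | _         = goal
                ...     | inj₂ _    | inj₁ goal = goal
                ...     | inj₂ db₁  | inj₂ db₂  = contradiction (trans (is-b db₂) (sym (is-b db₁))) b₂≢b₁

                module _ (v′b : col E v′ b ≡ red) (t≡1 : t ≡ 1) where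

                  six : n ≡ 6
                  six = trans (order-sum E)
                    (cong₂ _+_ (trans even-sum (cong (λ m → m + m) t≡1)) (cong₂ _+_ x1≡3 x3≡1))

                  k33 : col E y b ≡ red → ∀ {p} → d E p ≡ 0 → col E y p ≡ blue → col E v p ≡ blue →
                    col E v′ p ≡ blue → K33
                  k33 yb {p} dp yp vp v′p = record
                    { a₀ = v ; a₁ = v′ ; a₂ = y ; b₀ = c ; b₁ = b ; b₂ = p
                    ; a-distinct = (v≢v′ ∷ differ {E} dv dy (λ ()) ∷ []) ∷ (differ {E} dv′ dy (λ ()) ∷ []) ∷ [] ∷ []
                    ; b-distinct = (differ {E} dc db (λ ()) ∷ differ {E} dc dp (λ ()) ∷ []) ∷
                      (differ {E} db dp (λ ()) ∷ []) ∷ [] ∷ []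
                    ; complete = (b⇒ (trans (col-sym E v c) (near dv v≢c)) ∷ r⇒ vb ∷ b⇒ vp ∷ [])
                               ∷ (b⇒ (trans (col-sym E v′ c) (near dv′ v′≢c)) ∷ r⇒ v′b ∷ b⇒ v′p ∷ [])
                               ∷ (r⇒ (trans (col-sym E y c) cy) ∷ r⇒ yb ∷ b⇒ yp ∷ []) ∷ []
                    ; order = six }
                    where
                    b⇒ : ∀ {u v} → col E u v ≡ blue → adj u v ≡ true
                    b⇒ uv = colour⇒adj E blue uv (λ ())
                    r⇒ : ∀ {u v} → col E u v ≡ red → adj u v ≡ true
                    r⇒ uv = colour⇒adj E red uv (λ ())

                  blue-zero : ∀ {u} → d E u ≡ 1 → u ≢ c → Goal ⊎ ∃[ q ] d E q ≡ 0 × col E u q ≡ blue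
                  blue-zero du u≢c with blue-next E du (c ∷ [])
                  ... | q , uq , q≢c ∷ [] with zero-or-c du u≢c uq
                  ...   | inj₁ goal       = inj₁ goal
                  ...   | inj₂ (inj₁ dq)  = inj₂ (q , dq , uq)
                  ...   | inj₂ (inj₂ q≡c) = contradiction q≡c q≢c

                  single-zero : ∀ {p q} → d E p ≡ 0 → d E q ≡ 0 → p ≡ q
                  single-zero = only₁ {E} (trans x0≡t t≡1)

                  goal-or-k33 : Goal
                  goal-or-k33 with red-next E dy (c ∷ []) | blue-next E dy [] | blue-zero dv v≢c | blue-zero dv′ v′≢c
                  ... | _ | _ | inj₁ goal | _ = goal
                  ... | _ | _ | inj₂ _ | inj₁ goal = goal
                  ... | z , yz , z≢c ∷ [] | p , yp , _ | inj₂ (q , dq , vq) | inj₂ (q′ , dq′ , v′q′) with red-of-two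
                    dy yz z≢c
                  ...   | inj₁ goal = goal
                  ...   | inj₂ dz   = contradiction (k33 (subst (λ z → col E y z ≡ red) (is-b dz) yz) dp yp
                    (subst (λ q → col E v q ≡ blue) (single-zero dq dp) vq)
                    (subst (λ q → col E v′ q ≡ blue) (single-zero dq′ dp) v′q′)) ¬K33
                    where dp = two-blue dy yp

              three-star : Goal
              three-star with red-three dv v≢c | red-three dv′ v′≢c
              ... | inj₁ goal | _         = goal
              ... | inj₂ _    | inj₁ goal = goal
              ... | inj₂ (b , db , vb) | inj₂ (b′ , db′ , v′b′) with t ≟ 1
              ...   | yes t≡1 = goal-or-k33 db vb (subst (λ b → col E v′ b ≡ red) (is-b db vb db′) v′b′) t≡1
              ...   | no t≢1  with another E (y ∷ []) (≤∧≢⇒< 0<t (t≢1 ∘ sym))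
              ...     | w , dw , w≢y ∷ [] = second-two db vb dw w≢y

            module Two {v} (dv : d E v ≡ 1) (v≢c : v ≢ c) (x1≡2 : x E 1 ≡ 2) where

              x3≡0 : x E 3 ≡ 0
              x3≡0 = n≤0⇒n≡0 (+-cancelʳ-≤ 2 _ _ (≤-trans (+-monoʳ-≤ (x E 3) (+-mono-≤ (s≤s z≤n) (s≤s z≤n)))
                  (≤-reflexive (trans (sym (α-pos atE)) x1≡2))))

              h≡1 : h ≡ 1
              h≡1 = half-injective (trans (sym odd-sum) (cong₂ _+_ x1≡2 x3≡0))

              -- h = 1 leaves t ∈ {0, 1, 2}; t = 0 was excluded, and t = 1 means n = 4.
              t≡2×minus : t ≡ 2 × s ≡ neg 0
              t≡2×minus = by-size size refl
                where
                by-size : ∀ {s′} → Size t h s′ → s′ ≡ s → t ≡ 2 × s ≡ neg 0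
                by-size (minus t≡)   eq = trans t≡ (cong suc h≡1) , sym eq
                by-size (zero t≡h)   _  = contradiction
                  (trans order (cong₂ (λ a b → (a + a) + (b + b)) (trans t≡h h≡1) h≡1)) n≢4
                by-size (plus t+1≡h) _  = contradiction (suc-injective (trans t+1≡h h≡1)) t≡0⇒⊥

              t≡2 = proj₁ t≡2×minus

              tilt : Tilt
              tilt = inj₂ (proj₂ t≡2×minus)

              cv : col E c v ≡ blue
              cv = near dv v≢c

              is-v : ∀ {u} → d E u ≡ 1 → u ≢ c → u ≡ v
              is-v du u≢c = only₂ {E} x1≡2 (v≢c ∘ sym) dc dv du u≢c

              no-three : ∀ {b} → d E b ≢ 3
              no-three = x≡0⇒⊥ {E} x3≡0

              red-two : ∀ {u} → d E u ≡ 1 → ∃[ w ] d E w ≡ 2 × col E u w ≡ red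
              red-two du with red-next E du []
              ... | w , uw , _ with one-red du uw
              ...   | inj₁ dw = w , dw , uw
              ...   | inj₂ dw = contradiction dw no-three

              module _ {y′} (dy′ : d E y′ ≡ 2) (vy′ : col E v y′ ≡ red) where

                -- If `c` and `v` shared their red neighbour `y`, the other vertex of D₂ would have
                -- only `y` left as a red neighbour, though it needs two.
                y≢y′ : y ≢ y′
                y≢y′ refl with another E (y ∷ []) (≤-reflexive (sym t≡2))
                ... | z , dz , z≢y ∷ [] with red-next E dz []
                ...   | a , za , _ with red-next E dz (a ∷ [])
                ...     | b , zb , b≢a ∷ [] = b≢a (trans (is-y zb) (sym (is-y za)))
                  where
                  is-y : ∀ {a} → col E z a ≡ red → a ≡ y
                  is-y {a} za with red-label E za
                  ... | inj₂ (inj₂ da) = contradiction da no-three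
                  ... | inj₂ (inj₁ da) = only₂ {E} t≡2 z≢y dz dy da (apart E red za (λ ()) ∘ sym)
                  ... | inj₁ da with a Fin.≟ c
                  ...   | yes refl = contradiction (red-unique E dc (trans (col-sym E a z) za) cy) z≢y
                  ...   | no a≢c with is-v da a≢c
                  ...     | refl = contradiction (red-unique E dv (trans (col-sym E a z) za) vy′) z≢y

                yy′ : col E y y′ ≡ red
                yy′ with red-next E dy (c ∷ [])
                ... | a , ya , a≢c ∷ [] with red-label E ya
                ...   | inj₂ (inj₂ da) = contradiction da no-three
                ...   | inj₂ (inj₁ da) = subst (λ a → col E y a ≡ red)
                  (only₂ {E} t≡2 y≢y′ dy dy′ da (apart E red ya (λ ()) ∘ sym)) ya
                ...   | inj₁ da with is-v da a≢c
                ...     | refl = contradiction (red-unique E dv (trans (col-sym E a y) ya) vy′) y≢y′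

                module _ {p p′} (yp : col E y p ≡ blue) (y′p′ : col E y′ p′ ≡ blue) (p≢p′ : p ≢ p′) where

                  dp : d E p ≡ 0
                  dp = two-blue dy yp

                  dp′ : d E p′ ≡ 0
                  dp′ = two-blue dy′ y′p′

                  is-p : ∀ {q} → d E q ≡ 0 → q ≢ p′ → q ≡ p
                  is-p dq q≢p′ = only₂ {E} (trans x0≡t t≡2) (p≢p′ ∘ sym) dp′ dp dq q≢p′

                  is-p′ : ∀ {q} → d E q ≡ 0 → q ≢ p → q ≡ p′
                  is-p′ dq q≢p = only₂ {E} (trans x0≡t t≡2) p≢p′ dp dp′ dq q≢p

                  -- A blue edge `c p` would allow `fork` at `p`. With `v-target`, the remaining
                  -- blue edges of `c` and `v` therefore go crosswise, to `p′` and `p`, as K₃,₃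
                  -- demands.
                  c-target : ∀ {q} → col E c q ≡ blue → q ≢ v → Goal ⊎ q ≡ p′
                  c-target {q} cq q≢v with one-blue dc cq | q Fin.≟ p
                  ... | inj₂ dq | _        = contradiction (is-v dq (apart E blue cq (λ ()) ∘ sym)) q≢v
                  ... | inj₁ dq | no q≢p   = inj₂ (is-p′ dq q≢p)
                  ... | inj₁ dq | yes refl = inj₁ (fork dp dc dy (trans (col-sym E q c) cq) (trans (col-sym E q y) yp)
                    dv dy′ vy′ (v≢c ∘ sym) y≢y′)

                  v-target : ∀ {q} → col E v q ≡ blue → q ≢ c → Goal ⊎ q ≡ p
                  v-target {q} vq q≢c with one-blue dv vq | q Fin.≟ p′
                  ... | inj₂ dq | _        = contradiction (is-v dq q≢c) (apart E blue vq (λ ()) ∘ sym)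
                  ... | inj₁ dq | no q≢p′  = inj₂ (is-p dq q≢p′)
                  ... | inj₁ dq | yes refl =
                    inj₁ (fork dp′ dv dy′ (trans (col-sym E q v) vq) (trans (col-sym E q y′) y′p′)
                    dc dy cy v≢c (y≢y′ ∘ sym))

                  p-target : ∀ {q} → col E c p′ ≡ blue → col E p q ≡ blue → q ≢ y → q ≢ v → q ≡ p′
                  p-target {q} cp′ pq q≢y q≢v with blue-label E pq
                  ... | inj₁ dq = is-p′ dq (apart E blue pq (λ ()) ∘ sym)
                  ... | inj₂ (inj₂ dq) with only₂ {E} t≡2 y≢y′ dy dy′ dq q≢y
                  ...   | refl = contradiction (blue-unique E dq (trans (col-sym E q p) pq) y′p′) p≢p′
                  p-target {q} cp′ pq q≢y q≢v | inj₂ (inj₁ dq) with q Fin.≟ c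
                  ...   | no q≢c   = contradiction (is-v dq q≢c) q≢v
                  ...   | yes refl with subst (λ m → 3 + m ≤ 3) dc (blue-bound E q (v ∷ p ∷ p′ ∷ [])
                        ((differ {E} dv dp (λ ()) ∷ differ {E} dv dp′ (λ ()) ∷ []) ∷ (p≢p′ ∷ []) ∷ [] ∷ [])
                        (cv ∷ trans (col-sym E q p) pq ∷ cp′ ∷ []))
                  ...     | s≤s (s≤s (s≤s ()))

                  goal-or-k33 : Goal
                  goal-or-k33 with blue-next E dc (v ∷ []) | blue-next E dv (c ∷ [])
                  ... | q , cq , q≢v ∷ [] | q′ , vq′ , q′≢c ∷ [] with c-target cq q≢v | v-target vq′ q′≢c | blue-next
                    E dp (y ∷ v ∷ [])
                  ...   | inj₁ goal | _         | _ = goal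
                  ...   | inj₂ _    | inj₁ goal | _ = goal
                  ...   | inj₂ refl | inj₂ refl | q″ , pq″ , q″≢y ∷ q″≢v ∷ [] = contradiction (record
                    { a₀ = c ; a₁ = y′ ; a₂ = p ; b₀ = v ; b₁ = y ; b₂ = p′
                    ; a-distinct = (differ {E} dc dy′ (λ ()) ∷ differ {E} dc dp (λ ()) ∷ []) ∷
                      (differ {E} dy′ dp (λ ()) ∷ []) ∷ [] ∷ []
                    ; b-distinct = (differ {E} dv dy (λ ()) ∷ differ {E} dv dp′ (λ ()) ∷ []) ∷
                      (differ {E} dy dp′ (λ ()) ∷ []) ∷ [] ∷ []
                    ; complete = (b⇒ cv ∷ r⇒ cy ∷ b⇒ cq ∷ [])
                               ∷ (r⇒ (trans (col-sym E y′ v) vy′) ∷ r⇒ (trans (col-sym E y′ y) yy′) ∷ b⇒ y′p′ ∷ [])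
                               ∷ (b⇒ (trans (col-sym E p v) vq′) ∷ b⇒ (trans (col-sym E p y) yp)
                                   ∷ b⇒ (subst (λ q → col E p q ≡ blue) (p-target cq pq″ q″≢y q″≢v) pq″) ∷ []) ∷ []
                    ; order = trans order (cong₂ (λ a b → (a + a) + (b + b)) t≡2 h≡1) }) ¬K33
                    where
                    b⇒ : ∀ {u v} → col E u v ≡ blue → adj u v ≡ true
                    b⇒ uv = colour⇒adj E blue uv (λ ())
                    r⇒ : ∀ {u v} → col E u v ≡ red → adj u v ≡ true
                    r⇒ uv = colour⇒adj E red uv (λ ())

              two-stars : Goal
              two-stars with red-two dv
              ... | y′ , dy′ , vy′ with blue-next E dy [] | blue-next E dy′ []
              ...   | p , yp , _ | p′ , y′p′ , _ with p Fin.≟ p′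
              ...     | no p≢p′  = goal-or-k33 dy′ vy′ yp y′p′ p≢p′
              ...     | yes refl = double-target tilt (two-blue dy yp) dy dy′ (trans (col-sym E p y) yp)
                (trans (col-sym E p y′) y′p′) (y≢y′ dy′ vy′)

            -- All of D₁ except `c` lies among the two blue neighbours of `c`, so x₁ is 2 or 3. In
            -- both cases a configuration that admits no script is a K₃,₃.
            star : Goal
            star with another E (c ∷ []) (≤-<-trans 0<h h<x1)
            ... | v , dv , v≢c ∷ [] with 2 <? x E 1
            ...   | no 2≮x1 = Two.two-stars dv v≢c (≤-antisym (≮⇒≥ 2≮x1) (≤-<-trans 0<h h<x1))
            ...   | yes 2<x1 with another E (c ∷ v ∷ []) 2<x1 | edge? E red 2 2
            ...     | v′ , dv′ , v′≢c ∷ v′≢v ∷ [] | yes (edge dw dw′ ww′) =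
              via-path-22 dc dv dv′ (v′≢v ∘ sym) (near dv v≢c) (near dv′ v′≢c) dw dw′ ww′
            ...     | v′ , dv′ , v′≢c ∷ v′≢v ∷ [] | no ¬r22 = Three.three-star dv v≢c dv′ v′≢c (v′≢v ∘ sym) ¬r22

          with-red12 : Goal
          with-red12 with Fin.any? (λ r → (d E r ≟ 1) ×-dec ¬? (r Fin.≟ c) ×-dec ¬? (col E r c ≟ᶜ blue))
          ... | yes (r , dr , r≢c , ¬rc) = Far.far dr r≢c ¬rc
          ... | no none-far = Star.star near
            where
            near : ∀ {r} → d E r ≡ 1 → r ≢ c → col E c r ≡ blue
            near {r} dr r≢c with col E r c ≟ᶜ blue
            ... | yes rc = trans (col-sym E c r) rc
            ... | no ¬rc = contradiction (r , dr , r≢c , ¬rc) none-far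

      no-blue22-move : Goal
      no-blue22-move with edge? E red 1 1
      ... | yes r11 = with-red11 r11
      ... | no ¬r11 with edge? E red 1 2
      ...   | yes (edge dc dy cy) = Red12.with-red12 ¬r11 dc dy cy
      ...   | no ¬r12 = without-red12 ¬r11 ¬r12

  pos-zero : ∀ {E k s} → At E (pos (suc k) , pos 0 , s) → Small s → n ≢ 4 → ¬ K33 → Better (pos (suc k) , pos 0 , s)
  pos-zero {E} atE small n≢4 ¬K33 with edge? E blue 1 2
  ... | yes (edge du dv uv) = move atE (1 ∷ 2 ∷ []) (join 0F 1F ∷ []) (_ ∷ _ ∷ []) (du , dv , tt) tt (uv , tt)
    (gain small pos-1 stay)
  ... | no ¬b12 with edge? E blue 2 2
  ...   | yes b22 = Rich.Blue22.blue22-move atE small ¬b12 b22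
  ...   | no ¬b22 = Rich.NoBlue22.no-blue22-move atE small ¬b12 ¬b22 n≢4 ¬K33

-- Exchange of colours, the starting colouring and the descent.

module Descent {n} (𝒢 : CubicGraph n) where
  open PosZero 𝒢 public

  complement : Colouring → Colouring
  complement E .isRed u v     = not (isRed E u v)
  complement E .isRed-sym u v = cong not (isRed-sym E u v)

  d-complement : ∀ E u → d (complement E) u ≡ 3 ∸ d E u
  d-complement E u = trans (sum-cong λ v → swapped (adj u v) (isRed E u v))
    (sym (trans (cong (_∸ d E u) (sym (red+blue E u))) (m+n∸m≡n (d E u) _)))
    where
    swapped : ∀ a c → 𝟙 (paint a (not c) ≟ᶜ red) ≡ 𝟙 (paint a c ≟ᶜ blue)
    swapped false c     = refl
    swapped true  false = refl
    swapped true  true  = refl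

  x-complement : ∀ E k → k ≤ 3 → x (complement E) (3 ∸ k) ≡ x E k
  x-complement E k k≤3 = sum-cong λ v → 𝟙-cong (d (complement E) v ≟ 3 ∸ k) (d E v ≟ k)
    (λ eq → ∸-cancelˡ-≡ (d≤3 E v) k≤3 (trans (sym (d-complement E v)) eq))
    (λ eq → trans (d-complement E v) (cong (3 ∸_) eq))

  at-complement : ∀ {E a b s} → At E (a , b , s) → At (complement E) (ℤ.- b , ℤ.- a , ℤ.- s)
  at-complement {E} {a} {b} {s} (at eq) = at (cong₂ _,_
    (trans (cong₂ ℤ._-_ (X 2) (X 0)) (negate (pos (x E 0)) (pos (x E 2)) b (cong (proj₁ ∘ proj₂) eq)))
    (cong₂ _,_ (trans (cong₂ ℤ._-_ (X 3) (X 1)) (negate (pos (x E 1)) (pos (x E 3)) a (cong proj₁ eq)))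
      (trans (cong₂ ℤ._-_ (cong₂ ℤ._+_ (X 2) (X 0)) (cong₂ ℤ._+_ (X 3) (X 1)))
        (trans (solve 4 (λ a b c e → (a :+ b) :- (c :+ e) := (b :+ a) :- (e :+ c)) refl (pos (x E 2)) (pos (x E 0))
          (pos (x E 3)) (pos (x E 1)))
          (negate (pos (x E 1 + x E 3)) (pos (x E 0 + x E 2)) s (cong (proj₂ ∘ proj₂) eq))))))
    where
    open ℤ-Solver
    X : ∀ k → {_ : True (k ≤? 3)} → pos (x (complement E) (3 ∸ k)) ≡ pos (x E k)
    X k {k≤3} = cong pos (x-complement E k (toWitness k≤3))
    negate : ∀ y z c → y ℤ.- z ≡ c ℤ.+ c → z ℤ.- y ≡ ℤ.- c ℤ.+ ℤ.- c
    negate y z c eq = trans (solve 2 (λ y z → z :- y := :- (y :- z)) refl y z)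
      (trans (cong ℤ.-_ eq) (ℤ.neg-distrib-+ c c))

  small-complement : ∀ {s} → Small s → Small (ℤ.- s)
  small-complement minus = plus
  small-complement zero  = zero
  small-complement plus  = minus

  -- The improved colouring is kept as it is, without changing back: only costs are compared, and
  -- they agree for the two balances.
  better-complement : ∀ {a b s} → Better (ℤ.- b , ℤ.- a , ℤ.- s) → Better (a , b , s)
  better-complement {a} {b} (better {balance′ = p′} at′ small′ drop) = better at′ small′
    (subst (cost p′ <_) (trans (+-comm (weight (ℤ.- b)) _)
      (cong (λ z → weight z + weight (ℤ.- b)) (ℤ.neg-involutive a))) drop)

  module _ (n≢4 : n ≢ 4) (¬K33 : ¬ K33) (¬3K4 : ¬ ThreeK4) where

    improve : ∀ {E} a b {s} → At E (a , b , s) → Small s → (a ≡ pos 0 × b ≡ pos 0) ⊎ Better (a , b , s)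
    improve (pos 0)       (pos 0)       atE small = inj₁ (refl , refl)
    improve (pos 0)       (pos (suc m)) atE small =
      inj₂ (better-complement (neg-zero (at-complement atE) (small-complement small) ¬3K4))
    improve (pos 0)       (neg m)       atE small =
      inj₂ (better-complement (pos-zero (at-complement atE) (small-complement small) n≢4 ¬K33))
    improve (pos (suc k)) (pos 0)       atE small = inj₂ (pos-zero atE small n≢4 ¬K33)
    improve (pos (suc k)) (pos (suc m)) atE small = inj₂ (pos-pos atE small)
    improve (pos (suc k)) (neg m)       atE small = inj₂ (pos-neg atE small)
    improve (neg k)       (pos 0)       atE small = inj₂ (neg-zero atE small ¬3K4)
    improve (neg k)       (pos (suc m)) atE small = inj₂ (neg-pos atE small)
    improve (neg k)       (neg m)       atE small =
      inj₂ (better-complement (pos-pos (at-complement atE) (small-complement small)))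

    Balanced : Set
    Balanced = ∃[ E ] ∃[ s ] At E (pos 0 , pos 0 , s) × Small s

    descend : ∀ {E} p → Acc _<_ (cost p) → At E p → Small (proj₂ (proj₂ p)) → Balanced
    descend (a , b , s) (acc smaller) atE small with improve a b atE small
    ... | inj₁ (refl , refl)           = _ , s , atE , small
    ... | inj₂ (better at′ small′ drop) = descend _ (smaller drop) at′ small′

  -- If no edge joined two vertices of even red degree, counting edge ends would give 3(x₀ + x₂) ≤
  -- 3(x₁ + x₃), against σ < 0. Toggling such an edge raises σ by 2, whatever its type.
  even-edge : ∀ {E a b k} → At E (a , b , neg k) →
    ∃[ E′ ] ∃[ a′ ] ∃[ b′ ] At E′ (a′ , b′ , neg k ℤ.+ pos 2)
  even-edge {E} {a} {b} {k} atE with edge? E blue 0 0 | edge? E blue 0 2 | edge? E blue 2 2 | edge? E red 2 2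
  ... | yes (edge du dv uv) | _ | _ | _ = _ , _ , _ , proj₂ (surgery atE (0 ∷ 0 ∷ []) (join 0F 1F ∷ [])
    (_ ∷ _ ∷ []) (du , dv , tt) (apart E blue uv (λ ()) , tt) (uv , tt))
  ... | no _ | yes (edge du dv uv) | _ | _ = _ , _ , _ , proj₂ (surgery atE (0 ∷ 2 ∷ []) (join 0F 1F ∷ [])
    (_ ∷ _ ∷ []) (du , dv , tt) tt (uv , tt))
  ... | no _ | no _ | yes (edge du dv uv) | _ = _ , _ , _ , proj₂ (surgery atE (2 ∷ 2 ∷ []) (join 0F 1F ∷ [])
    (_ ∷ _ ∷ []) (du , dv , tt) (apart E blue uv (λ ()) , tt) (uv , tt))
  ... | no _ | no _ | no _ | yes (edge du dv uv) = _ , _ , _ , proj₂ (surgery atE (2 ∷ 2 ∷ []) (cut 0F 1F ∷ [])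
    (_ ∷ _ ∷ []) (du , dv , tt) (apart E red uv (λ ()) , tt) (uv , tt))
  ... | no ¬b00 | no ¬b02 | no ¬b22 | no ¬r22 = contradiction (*-cancelˡ-≤ 3 few-even) (<⇒≱ more-even)
    where
    more-even : x E 1 + x E 3 < x E 0 + x E 2
    more-even = more-by (deficit (cong (proj₂ ∘ proj₂) (balanced atE)))
    few-even : 3 * (x E 0 + x E 2) ≤ 3 * (x E 1 + x E 3)
    few-even = begin
      3 * (x E 0 + x E 2)
        ≡⟨ solve 2 (λ a c → con 3 :* (a :+ c) := (con 3 :* a :+ con 1 :* c) :+ con 2 :* c) refl (x E 0) (x E 2) ⟩
      (3 * x E 0 + 1 * x E 2) + 2 * x E 2 ≡⟨ cong₂ _+_ (cong₂ _+_ (blue-row E 0) (blue-row E 2)) (red-row E 2) ⟩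
      ((e E blue 0 0 + (e E blue 0 1 + e E blue 0 2)) + (e E blue 2 0 + (e E blue 2 1 + e E blue 2 2)))
        + (e E red 2 1 + (e E red 2 2 + e E red 2 3))
        ≡⟨ cong₂ _+_ (cong₂ _+_ (cong₂ (λ p q → p + (e E blue 0 1 + q)) (e-none E ¬b00) (e-none E ¬b02))
                                (cong₂ (λ p q → p + (e E blue 2 1 + q)) (e-none E (¬b02 ∘ reverse E))
                                  (e-none E ¬b22)))
                     (cong (λ p → e E red 2 1 + (p + e E red 2 3)) (e-none E ¬r22)) ⟩
      ((e E blue 0 1 + 0) + (e E blue 2 1 + 0)) + (e E red 2 1 + e E red 2 3)
        ≡⟨ cong₂ _+_ (cong₂ _+_ (trans (+-identityʳ _) (e-sym E blue 0 1)) (trans (+-identityʳ _) (e-sym E blue 2 1)))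
                     (cong₂ _+_ (e-sym E red 2 1) (e-sym E red 2 3)) ⟩
      (e E blue 1 0 + e E blue 1 2) + (e E red 1 2 + e E red 3 2)
        ≤⟨ +-mono-≤ (≤-trans (+-monoʳ-≤ (e E blue 1 0) (m≤n+m _ (e E blue 1 1))) (≤-reflexive (sym (blue-row E 1))))
                    (+-mono-≤ (e-red≤ E 1 2) (e-red≤ E 3 2)) ⟩
      2 * x E 1 + (1 * x E 1 + 3 * x E 3)
        ≡⟨ solve 2 (λ b e → con 2 :* b :+ (con 1 :* b :+ con 3 :* e) := con 3 :* (b :+ e)) refl (x E 1) (x E 3) ⟩
      3 * (x E 1 + x E 3) ∎
      where
      open ≤-Reasoning
      open +-*-Solver

  Start : Set
  Start = ∃[ E ] ∃[ p ] At E p × Small (proj₂ (proj₂ p))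

  -- Here σ = -(k + 1). Steps of 2 from below cannot jump over the interval from -1 to 1, and α and
  -- β may change freely.
  settle : ∀ k {E a b} → At E (a , b , neg k) → Start
  settle 0             atE = _ , _ , atE , minus
  settle 1             atE with even-edge atE
  ... | _ , _ , _ , at′ = _ , _ , at′ , zero
  settle (suc (suc k)) atE with even-edge atE
  ... | _ , _ , _ , at′ = settle′ k at′
    where
    settle′ : ∀ k {E a b} → At E (a , b , neg (suc (suc k)) ℤ.+ pos 2) → Start
    settle′ zero    at′ = _ , _ , at′ , minus
    settle′ (suc k) at′ = settle (suc k) at′

  -- Handshake: 3n = 2h gives n = 2(h - n). Evenness makes the halved balance (0, n/2, -n/2) of the
  -- all-blue colouring integral.
  order-even : ∃[ h ] n ≡ h + h
  order-even with symmetric-sum-even (λ u v → 𝟙 (adj u v Bool.≟ true))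
      (λ u v → cong (λ a → 𝟙 (a Bool.≟ true)) (adj-sym u v))
      (λ u → cong (λ a → 𝟙 (a Bool.≟ true)) (adj-irr u))
  ... | h , even = h ∸ n , +-cancelʳ-≡ (n + n) n _ (begin
    n + (n + n)                         ≡⟨ solve 1 (λ n → n :+ (n :+ n) := con 3 :* n) refl n ⟩
    3 * n                               ≡⟨ 3n≡2h ⟩
    h + h                               ≡⟨ cong₂ _+_ (sym (m∸n+n≡m n≤h)) (sym (m∸n+n≡m n≤h)) ⟩
    ((h ∸ n) + n) + ((h ∸ n) + n)
      ≡⟨ solve 2 (λ r n → (r :+ n) :+ (r :+ n) := (r :+ r) :+ (n :+ n)) refl (h ∸ n) n ⟩
    ((h ∸ n) + (h ∸ n)) + (n + n) ∎)
    where
    open ≡-Reasoning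
    open +-*-Solver
    3n≡2h : 3 * n ≡ h + h
    3n≡2h = trans (cong (3 *_) (sym (sum-ones n)))
      (trans (sym (sum-*ˡ 3 (λ _ → 1))) (trans (sum-cong λ u → sym (adj-three u)) even))
    n≤h : n ≤ h
    n≤h = ≮⇒≥ λ h<n → <⇒≱ (+-mono-< h<n h<n) (≤-trans (+-monoʳ-≤ n (m≤m+n n _)) (≤-reflexive 3n≡2h))

  start : Start
  start with order-even
  ... | h , n≡ = by-sign h at-start
    where
    all-blue : Colouring
    all-blue = colouring (λ _ _ → false) (λ _ _ → refl)
    d≡0 : ∀ u → d all-blue u ≡ 0
    d≡0 u = trans (sum-cong λ v → never (adj u v)) (sum-zero n)
      where
      never : ∀ a → 𝟙 (paint a false ≟ᶜ red) ≡ 0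
      never true  = refl
      never false = refl
    x-zero : x all-blue 0 ≡ n
    x-zero = trans (sum-cong λ v → 𝟙-yes (d all-blue v ≟ 0) (d≡0 v)) (sum-ones n)
    x-suc : ∀ k → x all-blue (suc k) ≡ 0
    x-suc k = trans (sum-cong λ v → 𝟙-no (d all-blue v ≟ suc k) λ eq → 0≢1+n (trans (sym (d≡0 v)) eq)) (sum-zero n)
    x-even : x all-blue 0 ≡ h + h
    x-even = trans x-zero n≡
    at-start : At all-blue (pos 0 , pos h , ℤ.- pos h)
    at-start = at (cong₂ _,_ (cong₂ (λ a c → pos a ℤ.- pos c) (x-suc 0) (x-suc 2)) (cong₂ _,_
      (trans (cong₂ (λ a c → pos a ℤ.- pos c) x-even (x-suc 1)) (cong pos (+-identityʳ (h + h))))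
      (trans (cong₂ ℤ._-_ (cong₂ (λ a c → pos (a + c)) (x-suc 0) (x-suc 2))
        (cong₂ (λ a c → pos (a + c)) x-even (x-suc 1)))
        (trans (ℤ.+-identityˡ _)
          (trans (cong (λ m → ℤ.- pos m) (+-identityʳ (h + h))) (ℤ.neg-distrib-+ (pos h) (pos h)))))))
    by-sign : ∀ h → At all-blue (pos 0 , pos h , ℤ.- pos h) → Start
    by-sign zero    atB = _ , _ , atB , zero
    by-sign (suc h) atB = settle h atB

  balanced-colouring : n ≢ 4 → ¬ K33 → ¬ ThreeK4 → ∃[ E ] ∃[ s ] At E (pos 0 , pos 0 , s) × Small s
  balanced-colouring n≢4 ¬K33 ¬3K4 =
    let E , p , atE , small = start in descend n≢4 ¬K33 ¬3K4 p (<-wellFounded (cost p)) atE small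

  Near : ℕ → Set
  Near m = m ≡ ⌊ n / 4 ⌋ ⊎ m ≡ ⌈ n / 4 ⌉

  -- α = β = 0 gives x₀ = x₂ = q and x₁ = x₃ = r, so σ = r - q and n = 2(q + r). With |q - r| ≤ 1,
  -- the smaller value is the floor of n/4, and the larger, if different, is the ceiling.
  balanced-counts : ∀ {E s} → At E (pos 0 , pos 0 , s) → Small s → ∀ k → k ≤ 3 → Near (x E k)
  balanced-counts {E} {s} atE small = all-near (sizes small atE)
    where
    x1≡x3 : x E 1 ≡ x E 3
    x1≡x3 = trans (α-pos atE) (+-identityʳ _)
    x0≡x2 : x E 0 ≡ x E 2
    x0≡x2 = trans (β-pos atE) (+-identityʳ _)
    q r : ℕ
    q = x E 2
    r = x E 3
    n≡ : n ≡ (q + q) + (r + r)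
    n≡ = trans (order-sum E) (cong₂ (λ a b → (a + q) + (b + r)) x0≡x2 x1≡x3)
    quarter : ∀ i m → (i + m * 4) / 4 ≡ i / 4 + m
    quarter i m = trans (+-distrib-/-∣ʳ i (divides-refl m)) (cong (i / 4 +_) (m*n/n≡m m 4))
    both-near : Near q × Near r → ∀ k → k ≤ 3 → Near (x E k)
    both-near (nq , nr) 0 _ = subst Near (sym x0≡x2) nq
    both-near (nq , nr) 1 _ = subst Near (sym x1≡x3) nr
    both-near (nq , nr) 2 _ = nq
    both-near (nq , nr) 3 _ = nr
    both-near _ (suc (suc (suc (suc _)))) (s≤s (s≤s (s≤s ())))
    floor : ∀ i m → i < 4 → n ≡ i + m * 4 → m ≡ ⌊ n / 4 ⌋
    floor i m i<4 eq = sym (trans (cong (_/ 4) eq) (trans (quarter i m) (cong (_+ m) (small-quotient i i<4))))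
      where
      small-quotient : ∀ i → i < 4 → i / 4 ≡ 0
      small-quotient 0 _ = refl
      small-quotient 1 _ = refl
      small-quotient 2 _ = refl
      small-quotient 3 _ = refl
      small-quotient (suc (suc (suc (suc _)))) (s≤s (s≤s (s≤s (s≤s ()))))
    ceiling : ∀ m → n ≡ 2 + m * 4 → suc m ≡ ⌈ n / 4 ⌉
    ceiling m eq = sym (trans (cong (λ n → (n + 3) / 4) eq)
      -- 5 is the remainder 2 plus the 3 added for rounding up, and 5 / 4 contributes the extra 1.
      (trans (cong (λ z → z / 4) (+-comm (2 + m * 4) 3)) (quarter 5 m)))
    sizes : ∀ {s} → Small s → At E (pos 0 , pos 0 , s) → q ≡ r ⊎ q ≡ suc r ⊎ suc q ≡ r
    sizes zero  atE = inj₁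
      (half-injective (trans (cong (λ z → z + q) (sym x0≡x2)) (trans (sym (σ-zero atE)) (cong (λ z → z + r) x1≡x3))))
    sizes minus atE = inj₂ (inj₁ (half-injective (trans (cong (λ z → z + q) (sym x0≡x2)) (trans (σ-minus atE)
      (trans (cong (λ z → (z + r) + 2) x1≡x3) (two-more r))))))
      where
      two-more : ∀ m → (m + m) + 2 ≡ suc m + suc m
      two-more = solve 1 (λ m → (m :+ m) :+ con 2 := (con 1 :+ m) :+ (con 1 :+ m)) refl
        where
        open +-*-Solver
    sizes plus  atE = inj₂ (inj₂ (half-injective (sym (trans (cong (λ z → z + r) (sym x1≡x3)) (trans (σ-plus atE)
      (trans (cong (λ z → (z + q) + 2) x0≡x2) (two-more q)))))))
      where
      two-more : ∀ m → (m + m) + 2 ≡ suc m + suc m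
      two-more = solve 1 (λ m → (m :+ m) :+ con 2 := (con 1 :+ m) :+ (con 1 :+ m)) refl
        where
        open +-*-Solver
    all-near : q ≡ r ⊎ q ≡ suc r ⊎ suc q ≡ r → ∀ k → k ≤ 3 → Near (x E k)
    all-near (inj₁ q≡r) = both-near (inj₁ (trans q≡r r≡) , inj₁ r≡)
      where
      r≡ = floor 0 r (s≤s z≤n) (trans n≡ (trans (cong (λ q → (q + q) + (r + r)) q≡r)
        (solve 1 (λ r → (r :+ r) :+ (r :+ r) := r :* con 4) refl r)))
        where
        open +-*-Solver
    all-near (inj₂ (inj₁ q≡)) = both-near (inj₂ (trans q≡ (ceiling r eq)) , inj₁ (floor 2 r (s≤s (s≤s (s≤s z≤n))) eq))
      where
      eq = trans n≡ (trans (cong (λ q → (q + q) + (r + r)) q≡)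
        (solve 1 (λ r → ((con 1 :+ r) :+ (con 1 :+ r)) :+ (r :+ r) := con 2 :+ r :* con 4) refl r))
        where
        open +-*-Solver
    all-near (inj₂ (inj₂ r≡)) =
      both-near (inj₁ (floor 2 q (s≤s (s≤s (s≤s z≤n))) eq) , inj₂ (trans (sym r≡) (ceiling q eq)))
      where
      eq = trans n≡ (trans (cong (λ r → (q + q) + (r + r)) (sym r≡))
        (solve 1 (λ q → (q :+ q) :+ ((con 1 :+ q) :+ (con 1 :+ q)) := con 2 :+ q :* con 4) refl q))
        where
        open +-*-Solver

-- Recognition of the exceptional graphs and return to `Graph`.

count≡# : ∀ {n} {P : Fin n → Set} (P? : Decidable P) → count P? (allFin n) ≡ # P?
count≡# {n} P? = count-tabulate n id
  where
  count-tabulate : ∀ m (f : Fin m → Fin n) → count P? (tabulate f) ≡ # (λ i → P? (f i))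
  count-tabulate zero    f = trans (sym (sum-zero 0)) (sum-cong λ ())
  count-tabulate (suc m) f = trans (head (P? (f zero)))
    (trans (cong (λ z → 𝟙 (P? (f zero)) + z) (count-tabulate m (f ∘ suc))) (sym (sum-suc (λ i → 𝟙 (P? (f i))))))
    where
    head : {Q : Set} (Q? : Dec Q) {c : ℕ} → (if does Q? then suc else id) c ≡ 𝟙 Q? + c
    head (yes _) = refl
    head (no _)  = refl

injective⇒surjective : ∀ {n} (f : Fin n → Fin n) → (∀ {i j} → f i ≡ f j → i ≡ j) → ∀ v → ∃[ i ] f i ≡ v
injective⇒surjective {suc n} f inj v with Fin.any? (λ i → f i Fin.≟ v)
... | yes found = found
... | no missed = contradiction (Fin.injective⇒≤ {f = λ i → punchOut (v≢ i)}
    (λ {i} {j} eq → inj (Fin.punchOut-injective (v≢ i) (v≢ j) eq))) 1+n≰n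
  where
  v≢ : ∀ i → v ≢ f i
  v≢ i v≡fi = missed (i , sym v≡fi)

lookup-injective : {A : Set} {xs : List A} → AllPairs _≢_ xs → ∀ i j → List.lookup xs i ≡ List.lookup xs j → i ≡ j
lookup-injective (x≢xs ∷ xs!) zero    zero    eq = refl
lookup-injective (x≢xs ∷ xs!) zero    (suc j) eq = contradiction eq (All.lookup x≢xs (∈-lookup j))
lookup-injective (x≢xs ∷ xs!) (suc i) zero    eq = contradiction (sym eq) (All.lookup x≢xs (∈-lookup i))
lookup-injective (x≢xs ∷ xs!) (suc i) (suc j) eq = cong suc (lookup-injective xs! i j eq)

module Embeddings {n} (G : Graph (Fin n)) (cubic : Cubic G) where

  nbrs : ∀ u → # (adj? G u) ≡ 3
  nbrs u = trans (sym (count≡# (adj? G u))) (cubic u)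

  -- `u`, its three neighbours and a non-neighbour `v` would be five members of a set of four.
  clique : {P : Fin n → Set} (P? : Decidable P) → # P? ≡ 4 → (∀ {u v} → Adj G u v → P u → P v) →
    ∀ {u v} → P u → P v → u ≢ v → Adj G u v
  clique P? #P≡4 closed {u} {v} pu pv u≢v with adj? G u v
  ... | yes uv = uv
  ... | no ¬uv with #-avoid (adj? G u) [] (subst (0 <_) (sym (nbrs u)) (s≤s z≤n))
  ...   | a , ua , _ with #-avoid (adj? G u) (a ∷ []) (subst (1 <_) (sym (nbrs u)) (s≤s (s≤s z≤n)))
  ...     | b , ub , b≢a ∷ [] with #-avoid (adj? G u) (b ∷ a ∷ []) (subst (2 <_) (sym (nbrs u)) (s≤s (s≤s (s≤s z≤n))))
  ...       | c , uc , c≢b ∷ c≢a ∷ [] = contradiction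
    (#-pack P? (u ∷ v ∷ c ∷ b ∷ a ∷ [])
      ((u≢v ∷ apart uc ∷ apart ub ∷ apart ua ∷ []) ∷ (missed uc ∷ missed ub ∷ missed ua ∷ [])
        ∷ (c≢b ∷ c≢a ∷ []) ∷ (b≢a ∷ []) ∷ [] ∷ [])
      (pu ∷ pv ∷ closed uc pu ∷ closed ub pu ∷ closed ua pu ∷ []))
    (<⇒≱ (s≤s (≤-reflexive #P≡4)))
    where
    apart : ∀ {w} → Adj G u w → u ≢ w
    apart uw u≡w = irrefl G u≡w uw
    missed : ∀ {w} → Adj G u w → v ≢ w
    missed uw refl = ¬uv uw

  module _ {W : Set} (K : Graph W) (nb : W → List W) (nb-distinct : ∀ a → AllPairs _≢_ (nb a))
           (nb-three : ∀ a → length (nb a) ≡ 3) (nb-adj : ∀ a → All (Adj K a) (nb a))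
           (index : Fin n ↔ W) (φ : W → Fin n) (φ-injective : ∀ {a b} → φ a ≡ φ b → a ≡ b)
           (φ-hom : ∀ {a b} → Adj K a b → Adj G (φ a) (φ b)) where

    -- The images of the three neighbours of `a` already exhaust the neighbours of `φ a`; the image
    -- of a non-neighbour would be a fourth.
    φ-reflects : ∀ {a b} → Adj G (φ a) (φ b) → Adj K a b
    φ-reflects {a} {b} ab with adj? K a b
    ... | yes kab = kab
    ... | no ¬kab = contradiction
      (#-pack (adj? G (φ a)) (φ b ∷ List.map φ (nb a))
        (All.map⁺ (All.map (λ kac φb≡φc → ¬kab (subst (Adj K a) (sym (φ-injective φb≡φc)) kac)) (nb-adj a))
          ∷ AllPairs.map⁺ (AllPairs.map (λ c≢e φc≡φe → c≢e (φ-injective φc≡φe)) (nb-distinct a)))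
        (ab ∷ All.map⁺ (All.map φ-hom (nb-adj a))))
      (<⇒≱ (≤-reflexive (trans (cong suc (nbrs (φ a))) (cong suc (sym (trans (length-map φ (nb a)) (nb-three a)))))))

    -- `index` shows that both vertex sets have `n` elements, so the injective `φ` is bijective, and
    -- its inverse is the isomorphism.
    embedding⇒≅ : G ≅ K
    embedding⇒≅ = mk↔ₛ′ to φ to∘φ φ∘to , λ u v →
      mk⇔ (λ uv → φ-reflects (subst₂ (Adj G) (sym (φ∘to u)) (sym (φ∘to v)) uv))
          (λ kuv → subst₂ (Adj G) (φ∘to u) (φ∘to v) (φ-hom kuv))
      where
      onto : ∀ v → ∃[ i ] φ (Inverse.to index i) ≡ v
      onto = injective⇒surjective (φ ∘ Inverse.to index) λ {i} {j} eq →
        trans (sym (Inverse.strictlyInverseʳ index i))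
          (trans (cong (Inverse.from index) (φ-injective eq)) (Inverse.strictlyInverseʳ index j))
      to : Fin n → W
      to v = Inverse.to index (proj₁ (onto v))
      φ∘to : ∀ v → φ (to v) ≡ v
      φ∘to v = proj₂ (onto v)
      to∘φ : ∀ w → to (φ w) ≡ w
      to∘φ w = φ-injective (φ∘to (φ w))

  cubicGraph : CubicGraph n
  cubicGraph = record
    { adj       = λ u v → does (adj? G u v)
    ; adj-sym   = λ u v → does-⇔ (mk⇔ (symm G) (symm G)) (adj? G u v) (adj? G v u)
    ; adj-irr   = λ u → dec-false (adj? G u u) (irrefl G refl)
    ; adj-three = λ u → trans (sum-cong λ v → 𝟙-cong (does (adj? G u v) Bool.≟ true) (adj? G u v)
        adjacent (dec-true (adj? G u v))) (nbrs u)
    }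
    where
    adjacent : ∀ {u v} → does (adj? G u v) ≡ true → Adj G u v
    adjacent {u} {v} eq with adj? G u v
    ... | yes uv = uv

  open Descent cubicGraph

  adj⇒Adj : ∀ {u v} → adj u v ≡ true → Adj G u v
  adj⇒Adj {u} {v} eq with adj? G u v
  ... | yes uv = uv

  others : Fin 4 → List (Fin 4)
  others 0F = 1F ∷ 2F ∷ 3F ∷ []
  others 1F = 0F ∷ 2F ∷ 3F ∷ []
  others 2F = 0F ∷ 1F ∷ 3F ∷ []
  others 3F = 0F ∷ 1F ∷ 2F ∷ []

  others-distinct : ∀ a → AllPairs _≢_ (others a)
  others-distinct = from-yes (Fin.all? λ a → AllPairs.allPairs? (λ b c → ¬? (b Fin.≟ c)) (others a))

  others-three : ∀ a → length (others a) ≡ 3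
  others-three = from-yes (Fin.all? λ a → length (others a) ≟ 3)

  others-adj : ∀ a → All (a ≢_) (others a)
  others-adj = from-yes (Fin.all? λ a → All.all? (λ b → ¬? (a Fin.≟ b)) (others a))

  K4-iso : n ≡ 4 → G ≅ K 4
  K4-iso refl = embedding⇒≅ (K 4) others others-distinct others-three others-adj ↔-id id id
    (clique (λ _ → yes tt) (sum-ones 4) (λ _ _ → tt) tt tt)
    where
    ↔-id : Fin 4 ↔ Fin 4
    ↔-id = mk↔ₛ′ id id (λ _ → refl) (λ _ → refl)

  K33-iso : K33 → G ≅ Kᵇ 3 3
  K33-iso record { a₀ = a₀ ; a₁ = a₁ ; a₂ = a₂ ; b₀ = b₀ ; b₁ = b₁ ; b₂ = b₂ ; a-distinct = a-distinct
                 ; b-distinct = b-distinct ; complete = complete ; order = refl } =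
    embedding⇒≅ (Kᵇ 3 3) opposite opposite-distinct (λ { (inj₁ _) → refl ; (inj₂ _) → refl })
      (λ { (inj₁ _) → tt ∷ tt ∷ tt ∷ [] ; (inj₂ _) → tt ∷ tt ∷ tt ∷ [] }) Fin.+↔⊎ φ φ-inj φ-hom
    where
    as bs : List (Fin 6)
    as = a₀ ∷ a₁ ∷ a₂ ∷ []
    bs = b₀ ∷ b₁ ∷ b₂ ∷ []
    opposite : Fin 3 ⊎ Fin 3 → List (Fin 3 ⊎ Fin 3)
    opposite (inj₁ _) = inj₂ 0F ∷ inj₂ 1F ∷ inj₂ 2F ∷ []
    opposite (inj₂ _) = inj₁ 0F ∷ inj₁ 1F ∷ inj₁ 2F ∷ []
    opposite-distinct : ∀ w → AllPairs _≢_ (opposite w)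
    opposite-distinct (inj₁ _) = ((λ ()) ∷ (λ ()) ∷ []) ∷ ((λ ()) ∷ []) ∷ [] ∷ []
    opposite-distinct (inj₂ _) = ((λ ()) ∷ (λ ()) ∷ []) ∷ ((λ ()) ∷ []) ∷ [] ∷ []
    φ : Fin 3 ⊎ Fin 3 → Fin 6
    φ (inj₁ i) = List.lookup as i
    φ (inj₂ j) = List.lookup bs j
    cross : ∀ i j → Adj G (φ (inj₁ i)) (φ (inj₂ j))
    cross i j = adj⇒Adj (All.lookup (All.lookup complete (∈-lookup {xs = as} i)) (∈-lookup {xs = bs} j))
    φ-inj : ∀ {u v} → φ u ≡ φ v → u ≡ v
    φ-inj {inj₁ i} {inj₁ j} eq = cong inj₁ (lookup-injective a-distinct i j eq)
    φ-inj {inj₁ i} {inj₂ j} eq = contradiction (cross i j) (irrefl G eq)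
    φ-inj {inj₂ i} {inj₁ j} eq = contradiction (cross j i) (irrefl G (sym eq))
    φ-inj {inj₂ i} {inj₂ j} eq = cong inj₂ (lookup-injective b-distinct i j eq)
    φ-hom : ∀ {u v} → BipartiteAdj u v → Adj G (φ u) (φ v)
    φ-hom {inj₁ i} {inj₂ j} _ = cross i j
    φ-hom {inj₂ i} {inj₁ j} _ = symm G (cross j i)

  record Four (P : Fin n → Set) : Set where
    field
      member   : Fin 4 → Fin n
      distinct : ∀ j j′ → member j ≡ member j′ → j ≡ j′
      inside   : ∀ j → P (member j)
  open Four

  four : {P : Fin n → Set} (P? : Decidable P) → # P? ≡ 4 → Four P
  four P? #P≡4 with #-avoid P? [] (subst (0 <_) (sym #P≡4) (s≤s z≤n))
  ... | a , pa , _ with #-avoid P? (a ∷ []) (subst (1 <_) (sym #P≡4) (s≤s (s≤s z≤n)))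
  ...   | b , pb , b≢a ∷ [] with #-avoid P? (b ∷ a ∷ []) (subst (2 <_) (sym #P≡4) (s≤s (s≤s (s≤s z≤n))))
  ...     | c , pc , c≢b ∷ c≢a ∷ [] with #-avoid P? (c ∷ b ∷ a ∷ [])
    (subst (3 <_) (sym #P≡4) (s≤s (s≤s (s≤s (s≤s z≤n)))))
  ...       | e , pe , e≢c ∷ e≢b ∷ e≢a ∷ [] = record
    { member   = List.lookup (e ∷ c ∷ b ∷ a ∷ [])
    ; distinct = lookup-injective ((e≢c ∷ e≢b ∷ e≢a ∷ []) ∷ (c≢b ∷ c≢a ∷ []) ∷ (b≢a ∷ []) ∷ [] ∷ [])
    ; inside   = λ { 0F → pe ; 1F → pc ; 2F → pb ; 3F → pa }
    }

  blocks-iso : (f : Fin n → Fin 3) → (∀ u v → adj u v ≡ true → f u ≡ f v) → (∀ i → # (λ v → f v Fin.≟ i) ≡ 4) →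
    (∀ i → Four (λ v → f v ≡ i)) → G ≅ (3 copiesOf K 4)
  blocks-iso f same-class fours block = embedding⇒≅ (3 copiesOf K 4) (λ (i , j) → List.map (i ,_) (others j))
    (λ (i , j) → AllPairs.map⁺ (AllPairs.map (λ b≢c eq → b≢c (cong proj₂ eq)) (others-distinct j)))
    (λ (i , j) → trans (length-map (i ,_) (others j)) (others-three j))
    (λ (i , j) → All.map⁺ (All.map (λ j≢ → refl , j≢) (others-adj j)))
    (subst (λ k → Fin k ↔ (Fin 3 × Fin 4)) (sym twelve) (Fin.*↔× {3} {4})) φ
    (λ {u} {v} → φ-inj u v) (λ {u} {v} → φ-hom u v)
    where
    twelve : n ≡ 12
    twelve = begin
      n                                               ≡⟨ sum-ones n ⟨
      sum (λ _ → 1)                                   ≡⟨ sum-cong (λ v → one-class (f v)) ⟩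
      sum (λ v → 𝟙 (f v Fin.≟ 0F) + (𝟙 (f v Fin.≟ 1F) + 𝟙 (f v Fin.≟ 2F)))
        ≡⟨ trans (sum-+ (λ v → 𝟙 (f v Fin.≟ 0F)) _) (cong₂ _+_ (fours 0F)
             (trans (sum-+ (λ v → 𝟙 (f v Fin.≟ 1F)) _) (cong₂ _+_ (fours 1F) (fours 2F)))) ⟩
      12 ∎
      where
      open ≡-Reasoning
      one-class : ∀ i → 1 ≡ 𝟙 (i Fin.≟ 0F) + (𝟙 (i Fin.≟ 1F) + 𝟙 (i Fin.≟ 2F))
      one-class 0F = refl
      one-class 1F = refl
      one-class 2F = refl

    φ : Fin 3 × Fin 4 → Fin n
    φ (i , j) = member (block i) j

    φ-inj : ∀ u v → φ u ≡ φ v → u ≡ v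
    φ-inj (i , j) (i′ , j′) eq with trans (sym (inside (block i) j)) (trans (cong f eq) (inside (block i′) j′))
    ... | refl = cong (i ,_) (distinct (block i) j j′ eq)

    φ-hom : ∀ u v → proj₁ u ≡ proj₁ v × proj₂ u ≢ proj₂ v → Adj G (φ u) (φ v)
    φ-hom (i , j) (_ , j′) (refl , j≢j′) = clique (λ v → f v Fin.≟ i) (fours i)
      (λ {u} {v} uv fu → trans (sym (same-class u v (dec-true (adj? G u v) uv))) fu)
      (inside (block i) j) (inside (block i) j′) (λ eq → j≢j′ (distinct (block i) j j′ eq))

  3K4-iso : ThreeK4 → G ≅ (3 copiesOf K 4)
  3K4-iso (f , same-class , fours) = blocks-iso f same-class fours λ i → four (λ v → f v Fin.≟ i) (fours i)

  subgraph : (∃[ E ] ∃[ s ] At E (pos 0 , pos 0 , s) × Small s) →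
    Σ[ H ∈ Graph (Fin n) ] (H IsSpanningSubgraphOf G × (∀ k → k ≤ 3 → m H k ≡ ⌊ n / 4 ⌋ ⊎ m H k ≡ ⌈ n / 4 ⌉))
  subgraph (E , s , atE , small) = H , (λ {u} {v} uv → adj⇒Adj (colour⇒adj E red uv (λ ()))) ,
      λ k k≤3 → subst Near (sym (m≡x k)) (balanced-counts atE small k k≤3)
    where
    H : Graph (Fin n)
    H = record
      { Adj    = λ u v → col E u v ≡ red
      ; adj?   = λ u v → col E u v ≟ᶜ red
      ; symm   = λ {u} {v} uv → trans (col-sym E v u) uv
      ; irrefl = λ { {u} refl uu → contradiction (trans (sym uu) (col-irr E u)) λ () }
      }
    m≡x : ∀ k → m H k ≡ x E k
    m≡x k = trans (count≡# (λ v → degree H v ≟ k))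
      (sum-cong λ v → cong (λ l → 𝟙 (l ≟ k)) (count≡# (λ w → col E v w ≟ᶜ red)))

  spanning-subgraph : ¬ (G ≅ K 4) → ¬ (G ≅ Kᵇ 3 3) → ¬ (G ≅ (3 copiesOf K 4)) →
    Σ[ H ∈ Graph (Fin n) ] (H IsSpanningSubgraphOf G × (∀ k → k ≤ 3 → m H k ≡ ⌊ n / 4 ⌋ ⊎ m H k ≡ ⌈ n / 4 ⌉))
  spanning-subgraph ¬K₄ ¬K₃₃ ¬3K₄ = subgraph
    (balanced-colouring (λ n≡4 → ¬K₄ (K4-iso n≡4)) (λ k33 → ¬K₃₃ (K33-iso k33)) (λ k4s → ¬3K₄ (3K4-iso k4s)))

theorem1p4 : ∀ (n : ℕ) (G : Graph (Fin n)) → Cubic G →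
    ¬ (G ≅ K 4) → ¬ (G ≅ Kᵇ 3 3) → ¬ (G ≅ (3 copiesOf K 4)) →
    Σ[ H ∈ Graph (Fin n) ] (H IsSpanningSubgraphOf G × (∀ k → k ≤ 3 → m H k ≡ ⌊ n / 4 ⌋ ⊎ m H k ≡ ⌈ n / 4 ⌉))
theorem1p4 n G cubic = Embeddings.spanning-subgraph G cubic
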